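{- For every integer $n\ge 1$, the polynomial $F_n(z)$ has only real zeros. Consequently, for all integers $1\le r\le n$, the polynomial $F_{r1^{n-r}}(z)$ is log-concave; that is, $F_\pi(z)$ is log-concave for every permutation $\pi\in\mathfrak{S}_n$ having at most one cycle of length greater than $1$.
   Context: $\mathfrak{S}_n$ is the symmetric group on $\{1,\dots,n\}$, $Q_n\subseteq\mathfrak{S}_n$ is the set of $n$-cycles, and $c(\eta)$ denotes the number of cycles (including fixed points) of a permutation $\eta$. Permutations are multiplied from left to right. For $\pi\in\mathfrak{S}_n$, $F_\pi(z)=\sum_{\zeta\in Q_n} z^{\lfloor (c(\zeta\pi)-1)/2\rfloor}$; this depends only on the type (multiset of cycle lengths) of $\pi$, and $F_\lambda:=F_\pi$ for $\pi$ of type $\lambda$. $F_n(z)$ denotes $F_\pi(z)$ for $\pi$ an $n$-cycle. The partition $r1^{n-r}$ has one part $r$ and $n-r$ parts equal to $1$. A polynomial $\sum_k a_kz^k$ with nonnegative coefficients is log-concave if $a_k^2\ge a_{k-1}a_{k+1}$ for all $k$. -}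

module Defs where

open import Data.Bool using (Bool; true; false; _∧_; not)
open import Data.Nat as ℕ using (ℕ; zero; suc; _∸_; ⌊_/2⌋; _≤_)
import Data.Nat.Properties as ℕP
open import Data.Fin as Fin using (Fin; toℕ)
import Data.Fin.Properties as FinP
open import Data.Vec using (Vec; []; _∷_; lookup; tabulate)
open import Data.List as List using (List; []; _∷_; length; filterᵇ; allFin; concatMap; upTo)
open import Data.Product using (Σ; ∃; _×_; _,_)
open import Relation.Nullary using (¬_; does)
open import Relation.Nullary.Decidable using (⌊_⌋; _→-dec_)
open import Relation.Binary.PropositionalEquality using (_≡_; _≢_)
open import Data.Integer using (ℤ; +_)
open import Data.Rational as ℚ using (ℚ; 0ℚ)

Map : ℕ → Set
Map n = Vec (Fin n) n

allVecs : (n m : ℕ) → List (Vec (Fin n) m)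
allVecs n zero    = [] ∷ []
allVecs n (suc m) = concatMap (λ v → List.map (_∷ v) (allFin n)) (allVecs n m)

-- ζ is a permutation of {1..n} (i.e. injective, hence bijective)
isPermᵇ : ∀ {n} → Map n → Bool
isPermᵇ ζ = ⌊ FinP.all? (λ i → FinP.all? (λ j →
              (lookup ζ i Fin.≟ lookup ζ j) →-dec (i Fin.≟ j))) ⌋

IsPerm : ∀ {n} → Map n → Set
IsPerm ζ = isPermᵇ ζ ≡ true

-- product from left to right: (ζ π)(i) = π(ζ(i))  ("first ζ, then π")
_·_ : ∀ {n} → Map n → Map n → Map n
ζ · π = tabulate (λ i → lookup π (lookup ζ i))

iter : ∀ {n} → Map n → ℕ → Fin n → Fin n
iter ζ zero    i = i
iter ζ (suc k) i = lookup ζ (iter ζ k i)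

-- i is the least element of its cycle (orbits of a permutation of
-- {1..n} have length ≤ n, so the iterates ζ^k(i), k < n, exhaust the cycle)
isCycleMinᵇ : ∀ {n} → Map n → Fin n → Bool
isCycleMinᵇ {n} ζ i = ⌊ FinP.all? (λ (k : Fin n) → i Fin.≤? iter ζ (toℕ k) i) ⌋

cycles : ∀ {n} → Map n → ℕ
cycles {n} ζ = length (filterᵇ (isCycleMinᵇ ζ) (allFin n))

nontrivialCycles : ∀ {n} → Map n → ℕ
nontrivialCycles {n} ζ =
  length (filterᵇ (λ i → isCycleMinᵇ ζ i ∧ not ⌊ lookup ζ i Fin.≟ i ⌋) (allFin n))

isNCycleᵇ : ∀ {n} → Map n → Bool
isNCycleᵇ ζ = isPermᵇ ζ ∧ ⌊ cycles ζ ℕ.≟ 1 ⌋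

IsNCycle : ∀ {n} → Map n → Set
IsNCycle ζ = isNCycleᵇ ζ ≡ true

-- coefficient of z^k in  F_π(z) = Σ_{ζ ∈ Q_n} z^⌊(c(ζπ)-1)/2⌋
Fcoeff : ∀ {n} → Map n → ℕ → ℕ
Fcoeff {n} π k = length (filterᵇ
  (λ ζ → isNCycleᵇ ζ ∧ ⌊ ⌊ cycles (ζ · π) ∸ 1 /2⌋ ℕ.≟ k ⌋)
  (allVecs n n))

-- F_π as its coefficient list [a_0, …, a_{n-1}] (all exponents are < n)
Fpoly : ∀ {n} → Map n → List ℕ
Fpoly {n} π = List.map (Fcoeff π) (upTo n)

-- Log-concavity of  Σ_k a_k z^k  (a_{-1} = 0, so k = 0 is automatic)

LogConcave : (ℕ → ℕ) → Set
LogConcave a = ∀ k → a k ℕ.* a (suc (suc k)) ≤ a (suc k) ℕ.* a (suc k)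

inv : ℕ → ℚ
inv m = (+ 1) ℚ./ suc m

record ℝ : Set where
  field
    seq : ℕ → ℚ
    reg : ∀ m n → ℚ.∣ seq m ℚ.- seq n ∣ ℚ.≤ inv m ℚ.+ inv n
open ℝ public

coeffAt : List ℚ → ℕ → ℚ
coeffAt []       k       = 0ℚ
coeffAt (a ∷ as) zero    = a
coeffAt (a ∷ as) (suc k) = coeffAt as k

scale : ℚ → List ℚ → List ℚ
scale c = List.map (c ℚ.*_)

addP : List ℚ → List ℚ → List ℚ
addP []       q        = q
addP p        []       = p
addP (a ∷ p) (b ∷ q)   = (a ℚ.+ b) ∷ addP p q

mulLin : ℚ → List ℚ → List ℚ
mulLin r p = addP (0ℚ ∷ p) (scale (ℚ.- r) p)

prodLin : ℚ → List ℚ → List ℚ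
prodLin c []       = c ∷ []
prodLin c (r ∷ rs) = mulLin r (prodLin c rs)

toList : ∀ {d} → Vec ℚ d → List ℚ
toList []       = []
toList (x ∷ xs) = x ∷ toList xs

stage : ∀ {d} → Vec ℝ d → ℕ → Vec ℚ d
stage []       m = []
stage (x ∷ xs) m = seq x m ∷ stage xs m

-- p (integer coefficients, lowest first) has only real zeros:
-- p = c · Π_{i=1}^{d} (z - r_i) for a nonzero c and real numbers r_1,…,r_d,
-- where the identity of (real) coefficients is equality in ℝ, i.e.
-- the coefficients of c·Π(z - r_i(m)) converge to those of p as m → ∞.
RealRooted : List ℕ → Set
RealRooted p =
  Σ ℕ λ d → Σ ℚ λ c → (c ≢ 0ℚ) × Σ (Vec ℝ d) λ rs →
    ∀ (k j : ℕ) → Σ ℕ λ N → ∀ m → N ≤ m →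
      ℚ.∣ coeffAt (prodLin c (toList (stage rs m))) k
          ℚ.- coeffAt (List.map (λ a → (+ a) ℚ./ 1) p) k ∣ ℚ.≤ inv j

{-# OPTIONS --safe #-}
module Submission where

-- Fix a point c.  An n-cycle is a product (c u₁)(c u₂)⋯ of star transpositions over all points u ≠ c, so ζπ is
-- reached from π by multiplying with them one at a time; each factor merges the cycle of c with the cycle of u or cuts
-- it at u.  Forgetting visited points, the number of ways to finish depends only on the cycle lengths, and the
-- resulting recurrence is solved by ∏ (1 − Eᵏ) applied to a rising factorial, E being the unit shift (Stanley's
-- formula).  For one r-cycle and fixed points this leaves a multiple of q(q+1)⋯(q+r) − q(q−1)⋯(q−r), so F_π is
-- proportional to the even part E(z) or the odd part O(z) of (x+1)⋯(x+r) = E(x²) + x O(x²), whichever misses the top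
-- degree.  Log-concavity then follows from the total positivity of order 2 of the coefficients of (x+1)⋯(x+r).
-- For real zeros put x = iy: as y grows, ∏ (k + iy) turns counterclockwise through r quarters, and E(−y²), O(−y²) are
-- (up to positive factors) its real and imaginary parts.  On a fine rational grid the quadrant number increases by at
-- most one per step, which brackets all zeros by sign changes; bisection gives the zeros as regular sequences, and
-- repeated synthetic division shows that the coefficients of c ∏ (z − rᵢ) converge to those of F_π.

-- The variable q has two roles: it weighs cycles, and it is the point at which the differences are
-- evaluated. Only because the two agree do the terms containing q cancel and the recurrence close.
-- The induction also has to cover unfinished products: visited points stay on their cycles but
-- cannot be chosen again, so a state records numbers of unvisited points, c always counting as one
-- extra. Real zeros are expressed by limits of rational data, so angles must be compared exactly.
-- Gaussian integers stand for arguments, and the half-open quadrant containing a product stands for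
-- an arctangent. Spacing 1/(r+1) is fine enough: one grid step turns each of the r factors by a
-- slope of at most 1/(r+1), which together stays below a quarter turn. The brackets are pairwise
-- disjoint, and their fixed gaps keep the division by approximate zeros stable. Log-concavity is
-- proved on integer coefficients, one linear factor at a time. Both halves meet in the coefficients
-- `paired`, since fixed points of π change F only by a constant factor.

-- Differences of rising factorials and the cut-and-join recurrence.

module RisingFactorials where

  open import Data.Nat as ℕ using (ℕ; zero; suc; _∸_)
  import Data.Nat.Properties as ℕP
  open import Data.Integer using (ℤ; +_; _+_; _*_; _-_; -_)
  import Data.Integer.Properties as ℤP
  open import Data.Integer.Tactic.RingSolver using (solve-∀)
  open import Data.List using (List; []; _∷_)
  open import Data.Nat.ListAction using (sum)
  open import Relation.Binary.PropositionalEquality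
  open ≡-Reasoning

  rise : ℕ → ℤ → ℤ
  rise zero    x = + 1
  rise (suc m) x = rise m x * (x + + m)

  rise-pred : ∀ m x → rise (suc m) (x - + 1) ≡ (x - + 1) * rise m x
  rise-pred zero x = solve₀ x
    where
    solve₀ : ∀ x → + 1 * (x - + 1 + + 0) ≡ (x - + 1) * + 1
    solve₀ = solve-∀
  rise-pred (suc m) x = begin
    rise (suc m) (x - + 1) * (x - + 1 + + suc m)         ≡⟨ cong₂ _*_ (rise-pred m x) (cong (λ ξ → x - + 1 + ξ) (ℤP.pos-+ 1 m)) ⟩
    (x - + 1) * rise m x * (x - + 1 + (+ 1 + + m))       ≡⟨ lem x (rise m x) (+ m) ⟩
    (x - + 1) * (rise m x * (x + + m))                   ∎
    where
    lem : ∀ x r m → (x - + 1) * r * (x - + 1 + (+ 1 + m)) ≡ (x - + 1) * (r * (x + m))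
    lem = solve-∀

  rise-diff : ∀ m x → rise (suc m) x - rise (suc m) (x - + 1) ≡ + suc m * rise m x
  rise-diff m x = begin
    rise m x * (x + + m) - rise (suc m) (x - + 1)   ≡⟨ cong (λ r → rise m x * (x + + m) - r) (rise-pred m x) ⟩
    rise m x * (x + + m) - (x - + 1) * rise m x     ≡⟨ lem x (rise m x) (+ m) ⟩
    (+ 1 + + m) * rise m x                          ≡⟨ cong (_* rise m x) (sym (ℤP.pos-+ 1 m)) ⟩
    + suc m * rise m x                              ∎
    where
    lem : ∀ x r m → r * (x + m) - (x - + 1) * r ≡ (+ 1 + m) * r
    lem = solve-∀

  -- Models the choice of the cycle that is merged with the cycle of c: φ gets the chosen entry and
  -- the list of the others. Equal entries at different positions count separately.
  removeSum : (ℕ → List ℕ → ℤ) → List ℕ → ℤ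
  removeSum φ []      = + 0
  removeSum φ (k ∷ l) = φ k l + removeSum (λ j l′ → φ j (k ∷ l′)) l

  removeSum-cong : ∀ {φ ψ} → (∀ k l → φ k l ≡ ψ k l) → ∀ l → removeSum φ l ≡ removeSum ψ l
  removeSum-cong e []      = refl
  removeSum-cong e (k ∷ l) = cong₂ _+_ (e k l) (removeSum-cong (λ j l′ → e j (k ∷ l′)) l)

  removeSum-- : ∀ φ ψ l → removeSum (λ k l′ → φ k l′ - ψ k l′) l ≡ removeSum φ l - removeSum ψ l
  removeSum-- φ ψ []      = refl
  removeSum-- φ ψ (k ∷ l) = trans
    (cong (λ ξ → φ k l - ψ k l + ξ) (removeSum-- (λ j l′ → φ j (k ∷ l′)) (λ j l′ → ψ j (k ∷ l′)) l))
    (lem (φ k l) (ψ k l) _ _)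
    where
    lem : ∀ a b c d → a - b + (c - d) ≡ a + c - (b + d)
    lem = solve-∀

  removeSum-* : ∀ r φ l → removeSum (λ k l′ → r * φ k l′) l ≡ r * removeSum φ l
  removeSum-* r φ []      = sym (ℤP.*-zeroʳ r)
  removeSum-* r φ (k ∷ l) = trans (cong (λ ξ → r * φ k l + ξ) (removeSum-* r (λ j l′ → φ j (k ∷ l′)) l))
    (sym (ℤP.*-distribˡ-+ r _ _))

  rangeSum : ℕ → (ℕ → ℤ) → ℤ
  rangeSum zero    φ = + 0
  rangeSum (suc a) φ = rangeSum a φ + φ a

  rangeSum-cong : ∀ a {φ ψ} → (∀ i → i ℕ.< a → φ i ≡ ψ i) → rangeSum a φ ≡ rangeSum a ψ
  rangeSum-cong zero    e = refl
  rangeSum-cong (suc a) e = cong₂ _+_ (rangeSum-cong a (λ i i<a → e i (ℕP.m<n⇒m<1+n i<a))) (e a ℕP.≤-refl)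

  rangeSum-front : ∀ a φ → rangeSum (suc a) φ ≡ φ 0 + rangeSum a (λ i → φ (suc i))
  rangeSum-front zero    φ = ℤP.+-comm (+ 0) (φ 0)
  rangeSum-front (suc a) φ = trans (cong (_+ φ (suc a)) (rangeSum-front a φ)) (ℤP.+-assoc (φ 0) _ _)

  rangeSum-reverse : ∀ a φ → rangeSum a (λ i → φ (a ∸ suc i)) ≡ rangeSum a φ
  rangeSum-reverse zero    φ = refl
  rangeSum-reverse (suc a) φ = begin
    rangeSum (suc a) (λ i → φ (a ∸ i))           ≡⟨ rangeSum-front a (λ i → φ (a ∸ i)) ⟩
    φ a + rangeSum a (λ i → φ (a ∸ suc i))       ≡⟨ cong (λ ξ → φ a + ξ) (rangeSum-reverse a φ) ⟩
    φ a + rangeSum a φ                           ≡⟨ ℤP.+-comm (φ a) _ ⟩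
    rangeSum a φ + φ a                           ∎

  -- The reflection i ↦ a - 1 - i shows that both subtracted sums are equal. The summand is the
  -- shape that (1 - Eⁱ)(1 - Eʲ) takes when i + j is constant.
  rangeSum-combine : ∀ a (g : ℕ → ℤ) u →
    rangeSum a (λ i → u - g i - g (a ∸ suc i)) ≡ + a * u - + 2 * rangeSum a g
  rangeSum-combine a g u = trans (split a) (trans
    (cong (λ r → + a * u - rangeSum a g - r) (rangeSum-reverse a g)) (lem (+ a) u (rangeSum a g)))
    where
    lem : ∀ a u s → a * u - s - s ≡ a * u - + 2 * s
    lem = solve-∀
    step : ∀ b u s t x y → b * u - s - t + (u - x - y) ≡ (+ 1 + b) * u - (s + x) - (t + y)
    step = solve-∀
    split : ∀ b → rangeSum b (λ i → u - g i - g (a ∸ suc i))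
                ≡ + b * u - rangeSum b g - rangeSum b (λ i → g (a ∸ suc i))
    split zero    = refl
    split (suc b) = begin
      rangeSum b (λ i → u - g i - g (a ∸ suc i)) + (u - g b - g (a ∸ suc b)) ≡⟨ cong (λ ξ → ξ + (u - g b - g (a ∸ suc b))) (split b) ⟩
      + b * u - rangeSum b g - rangeSum b (λ i → g (a ∸ suc i)) + (u - g b - g (a ∸ suc b))
        ≡⟨ step (+ b) u (rangeSum b g) _ (g b) _ ⟩
      (+ 1 + + b) * u - rangeSum (suc b) g - rangeSum (suc b) (λ i → g (a ∸ suc i))
        ≡⟨ cong (λ z → z * u - rangeSum (suc b) g - rangeSum (suc b) (λ i → g (a ∸ suc i))) (sym (ℤP.pos-+ 1 b)) ⟩
      + suc b * u - rangeSum (suc b) g - rangeSum (suc b) (λ i → g (a ∸ suc i)) ∎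

  module _ (q : ℤ) where

    -- For positive parts this is ∏ₖ (1 − Eᵏ) applied to the rising factorial x(x+1)⋯(x+m−1), where E is the
    -- shift x ↦ x − 1; a part 0 (a cycle with no unvisited point) contributes a factor q instead.
    diff : ℕ → ℤ → List ℕ → ℤ
    diff m x []          = rise m x
    diff m x (zero ∷ l)  = q * diff m x l
    diff m x (suc k ∷ l) = diff m x l - diff m (x - + suc k) l

    -- The backward difference commutes with every 1 - Eᵏ and with the factors q, so it lowers the
    -- index exactly as for the rising factorial alone.
    diff-shift : ∀ m x l → diff (suc m) x l - diff (suc m) (x - + 1) l ≡ + suc m * diff m x l
    diff-shift m x []         = rise-diff m x
    diff-shift m x (zero ∷ l) = begin
      q * a - q * b           ≡⟨ lem₁ q a b ⟩
      q * (a - b)             ≡⟨ cong (q *_) (diff-shift m x l) ⟩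
      q * (+ suc m * c)       ≡⟨ lem₂ q (+ suc m) c ⟩
      + suc m * (q * c)       ∎
      where
      a = diff (suc m) x l
      b = diff (suc m) (x - + 1) l
      c = diff m x l
      lem₁ : ∀ q a b → q * a - q * b ≡ q * (a - b)
      lem₁ = solve-∀
      lem₂ : ∀ q a b → q * (a * b) ≡ a * (q * b)
      lem₂ = solve-∀
    diff-shift m x (suc k ∷ l) = begin
      a - b - (c - diff (suc m) (x - + 1 - + suc k) l) ≡⟨ cong (λ y → a - b - (c - diff (suc m) y l)) (lem₀ x (+ suc k)) ⟩
      a - b - (c - d)                                ≡⟨ lem₁ a b c d ⟩
      (a - c) - (b - d)                              ≡⟨ cong₂ _-_ (diff-shift m x l) (diff-shift m (x - + suc k) l) ⟩
      + suc m * e - + suc m * f                      ≡⟨ lem₂ (+ suc m) e f ⟩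
      + suc m * (e - f)                              ∎
      where
      a = diff (suc m) x l
      b = diff (suc m) (x - + suc k) l
      c = diff (suc m) (x - + 1) l
      d = diff (suc m) (x - + suc k - + 1) l
      e = diff m x l
      f = diff m (x - + suc k) l
      lem₀ : ∀ x k → x - + 1 - k ≡ x - k - + 1
      lem₀ = solve-∀
      lem₁ : ∀ a b c d → a - b - (c - d) ≡ (a - c) - (b - d)
      lem₁ = solve-∀
      lem₂ : ∀ m e f → m * e - m * f ≡ m * (e - f)
      lem₂ = solve-∀

    private
      R : ℕ → ℤ → List ℕ → ℤ
      R m x = removeSum (λ k l → + k * diff m (x - + k) l)

      R-zero : ∀ m x l → R m x (0 ∷ l) ≡ q * R m x l
      R-zero m x l = trans (ℤP.+-identityˡ _) (trans
        (removeSum-cong (λ k l′ → lem (+ k) q (diff m (x - + k) l′)) l)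
        (removeSum-* q (λ k l′ → + k * diff m (x - + k) l′) l))
        where
        lem : ∀ k q d → k * (q * d) ≡ q * (k * d)
        lem = solve-∀

      R-suc : ∀ m x k l → R m x (suc k ∷ l)
            ≡ + suc k * diff m (x - + suc k) l + (R m x l - R m (x - + suc k) l)
      R-suc m x k l = cong (λ ξ → + suc k * diff m (x - + suc k) l + ξ) (trans
        (removeSum-cong (λ j l′ → trans
          (lem (+ j) (diff m (x - + j) l′) (diff m (x - + j - + suc k) l′))
          (cong (λ y → + j * diff m (x - + j) l′ - + j * diff m y l′) (swap x (+ j) (+ suc k)))) l)
        (removeSum-- (λ j l′ → + j * diff m (x - + j) l′) (λ j l′ → + j * diff m (x - + suc k - + j) l′) l))
        where
        lem : ∀ j a b → j * (a - b) ≡ j * a - j * b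
        lem = solve-∀
        swap : ∀ x j k → x - j - k ≡ x - k - j
        swap = solve-∀

    -- Since Eᵏ(x f) = (x - k) Eᵏ f, moving multiplication by x across 1 - Eᵏ leaves the commutator
    -- k Eᵏ. `R` collects these commutators; a part 0 has weight 0 in it, in accordance with its
    -- being a plain factor q.
    diff-suc : ∀ m x l → diff (suc m) x l
             ≡ (x + + m) * diff m x l + removeSum (λ k l′ → + k * diff m (x - + k) l′) l
    diff-suc m x [] = trans (ℤP.*-comm (rise m x) (x + + m)) (sym (ℤP.+-identityʳ _))
    diff-suc m x (zero ∷ l) = begin
      q * diff (suc m) x l                          ≡⟨ cong (q *_) (diff-suc m x l) ⟩
      q * ((x + + m) * diff m x l + R m x l)        ≡⟨ lem q (x + + m) (diff m x l) (R m x l) ⟩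
      (x + + m) * (q * diff m x l) + q * R m x l    ≡⟨ cong (λ ξ → (x + + m) * (q * diff m x l) + ξ) (sym (R-zero m x l)) ⟩
      (x + + m) * (q * diff m x l) + R m x (0 ∷ l)  ∎
      where
      lem : ∀ q s d r → q * (s * d + r) ≡ s * (q * d) + q * r
      lem = solve-∀
    diff-suc m x (suc k ∷ l) = begin
      diff (suc m) x l - diff (suc m) y l
        ≡⟨ cong₂ _-_ (diff-suc m x l) (diff-suc m y l) ⟩
      ((x + + m) * diff m x l + R m x l) - ((y + + m) * diff m y l + R m y l)
        ≡⟨ lem x (+ m) (+ suc k) (diff m x l) (diff m y l) (R m x l) (R m y l) ⟩
      (x + + m) * (diff m x l - diff m y l) + (+ suc k * diff m y l + (R m x l - R m y l))
        ≡⟨ cong (λ ξ → (x + + m) * (diff m x l - diff m y l) + ξ) (sym (R-suc m x k l)) ⟩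
      (x + + m) * (diff m x l - diff m y l) + R m x (suc k ∷ l) ∎
      where
      y = x - + suc k
      lem : ∀ x m k a b r s → ((x + m) * a + r) - ((x - k + m) * b + s)
          ≡ (x + m) * (a - b) + (k * b + (r - s))
      lem = solve-∀

    -- For a positive part k, write 1 = (1 - Eᵏ) + Eᵏ in front of the product over the other parts:
    -- the first summand restores the full product, the second gives a term of `R`.
    removeSum-diff : ∀ m x l → removeSum (λ k l′ → + k * diff m x l′) l
                   ≡ + sum l * diff m x l + removeSum (λ k l′ → + k * diff m (x - + k) l′) l
    removeSum-diff m x []         = refl
    removeSum-diff m x (zero ∷ l) = begin
      + 0 * diff m x l + removeSum (λ k l′ → + k * (q * diff m x l′)) l
        ≡⟨ trans (ℤP.+-identityˡ _) (trans (removeSum-cong (λ k l′ → lem (+ k) q _) l) (removeSum-* q _ l)) ⟩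
      q * removeSum (λ k l′ → + k * diff m x l′) l
        ≡⟨ cong (q *_) (removeSum-diff m x l) ⟩
      q * (+ sum l * diff m x l + R m x l)
        ≡⟨ lem₂ q (+ sum l) (diff m x l) (R m x l) ⟩
      + sum l * (q * diff m x l) + q * R m x l
        ≡⟨ cong (λ ξ → + sum l * (q * diff m x l) + ξ) (sym (R-zero m x l)) ⟩
      + sum l * (q * diff m x l) + R m x (0 ∷ l) ∎
      where
      lem : ∀ k q d → k * (q * d) ≡ q * (k * d)
      lem = solve-∀
      lem₂ : ∀ q s d r → q * (s * d + r) ≡ s * (q * d) + q * r
      lem₂ = solve-∀
    removeSum-diff m x (suc k ∷ l) = begin
      + suc k * diff m x l + removeSum (λ j l′ → + j * (diff m x l′ - diff m y l′)) l
        ≡⟨ cong (λ ξ → + suc k * diff m x l + ξ) (trans (removeSum-cong (λ j l′ → lem (+ j) _ _) l) (removeSum-- _ _ l)) ⟩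
      + suc k * diff m x l + (removeSum (λ j l′ → + j * diff m x l′) l - removeSum (λ j l′ → + j * diff m y l′) l)
        ≡⟨ cong (λ ξ → + suc k * diff m x l + ξ) (cong₂ _-_ (removeSum-diff m x l) (removeSum-diff m y l)) ⟩
      + suc k * diff m x l + ((+ sum l * diff m x l + R m x l) - (+ sum l * diff m y l + R m y l))
        ≡⟨ lem₂ (+ suc k) (+ sum l) (diff m x l) (diff m y l) (R m x l) (R m y l) ⟩
      (+ suc k + + sum l) * (diff m x l - diff m y l) + (+ suc k * diff m y l + (R m x l - R m y l))
        ≡⟨ cong₂ (λ s t → s * (diff m x l - diff m y l) + t) (sym (ℤP.pos-+ (suc k) (sum l))) (sym (R-suc m x k l)) ⟩
      + (suc k ℕ.+ sum l) * (diff m x l - diff m y l) + R m x (suc k ∷ l) ∎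
      where
      y = x - + suc k
      lem : ∀ j a b → j * (a - b) ≡ j * a - j * b
      lem = solve-∀
      lem₂ : ∀ k s a b r t → k * a + ((s * a + r) - (s * b + t)) ≡ (k + s) * (a - b) + (k * b + (r - t))
      lem₂ = solve-∀

    diff-telescope : ∀ m x l a →
      + suc m * rangeSum a (λ i → diff m (x - + i) l) ≡ diff (suc m) x l - diff (suc m) (x - + a) l
    diff-telescope m x l zero = begin
      + suc m * + 0                              ≡⟨ ℤP.*-zeroʳ (+ suc m) ⟩
      + 0                                        ≡⟨ sym (ℤP.+-inverseʳ (diff (suc m) x l)) ⟩
      diff (suc m) x l - diff (suc m) x l        ≡⟨ cong (λ y → diff (suc m) x l - diff (suc m) y l) (sym (ℤP.+-identityʳ x)) ⟩
      diff (suc m) x l - diff (suc m) (x - + 0) l ∎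
    diff-telescope m x l (suc a) = begin
      + suc m * (rangeSum a G + G a)         ≡⟨ ℤP.*-distribˡ-+ (+ suc m) (rangeSum a G) (G a) ⟩
      + suc m * rangeSum a G + + suc m * G a ≡⟨ cong₂ _+_ (diff-telescope m x l a) (sym (diff-shift m (x - + a) l)) ⟩
      (u - v) + (v - diff (suc m) (x - + a - + 1) l) ≡⟨ lem u v _ ⟩
      u - diff (suc m) (x - + a - + 1) l     ≡⟨ cong (λ y → u - diff (suc m) y l) (trans (lem₂ x (+ a)) (cong (λ z → x - z) (sym (ℤP.pos-+ 1 a)))) ⟩
      u - diff (suc m) (x - + suc a) l       ∎
      where
      G = λ i → diff m (x - + i) l
      u = diff (suc m) x l
      v = diff (suc m) (x - + a) l
      lem : ∀ u v w → (u - v) + (v - w) ≡ u - w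
      lem = solve-∀
      lem₂ : ∀ x a → x - a - + 1 ≡ x - (+ 1 + a)
      lem₂ = solve-∀

    -- These terms come from merging the cycle of c with one having k unvisited points, any of which
    -- may be chosen. Splitting 1 - Eᵃ⁺ᵏ leaves values of `R` at q and q - a, and `diff-suc`
    -- eliminates both.
    mergeTerms : ∀ m l a → removeSum (λ k l′ → + k * diff m q ((a ℕ.+ k) ∷ l′)) l
      ≡ + sum l * diff m q l + (diff (suc m) q l - (q + + m) * diff m q l)
        - (diff (suc m) (q - + a) l - (q - + a + + m) * diff m (q - + a) l)
    mergeTerms m l a = begin
      removeSum (λ k l′ → + k * diff m q ((a ℕ.+ k) ∷ l′)) l
        ≡⟨ removeSum-cong term l ⟩
      removeSum (λ k l′ → + k * diff m q l′ - + k * diff m (q - + a - + k) l′) l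
        ≡⟨ removeSum-- _ _ l ⟩
      removeSum (λ k l′ → + k * diff m q l′) l - R m (q - + a) l
        ≡⟨ cong (_- R m (q - + a) l) (removeSum-diff m q l) ⟩
      + sum l * diff m q l + R m q l - R m (q - + a) l
        ≡⟨ cong₂ (λ r s → + sum l * diff m q l + r - s) (isolate q) (isolate (q - + a)) ⟩
      _ ∎
      where
      isolate : ∀ x → R m x l ≡ diff (suc m) x l - (x + + m) * diff m x l
      isolate x = trans (lem ((x + + m) * diff m x l) (R m x l)) (cong (λ z → z - (x + + m) * diff m x l) (sym (diff-suc m x l)))
        where
        lem : ∀ u r → r ≡ u + r - u
        lem = solve-∀
      term : ∀ k l′ → + k * diff m q ((a ℕ.+ k) ∷ l′) ≡ + k * diff m q l′ - + k * diff m (q - + a - + k) l′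
      -- The weight 0 matters here: for a = 0 the new part would be 0, where `diff` is a factor q
      -- and not a difference.
      term zero    l′ = refl
      term (suc k) l′ rewrite ℕP.+-suc a k = begin
        + suc k * (diff m q l′ - diff m (q - + suc (a ℕ.+ k)) l′)
          ≡⟨ cong (λ y → + suc k * (diff m q l′ - diff m y l′)) shift ⟩
        + suc k * (diff m q l′ - diff m (q - + a - + suc k) l′)
          ≡⟨ lem (+ suc k) (diff m q l′) (diff m (q - + a - + suc k) l′) ⟩
        _ ∎
        where
        lem : ∀ j a b → j * (a - b) ≡ j * a - j * b
        lem = solve-∀
        lem₂ : ∀ x a b → x - (a + b) ≡ x - a - b
        lem₂ = solve-∀
        shift : q - + suc (a ℕ.+ k) ≡ q - + a - + suc k
        shift = trans (cong (λ z → q - + z) (sym (ℕP.+-suc a k)))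
          (trans (cong (λ z → q - z) (ℤP.pos-+ a (suc k))) (lem₂ q (+ a) (+ suc k)))

    -- Cutting leaves i unvisited points on the new cycle. For i > 0 expand (1 - Eᵃ⁻ⁱ)(1 - Eⁱ) = 1 +
    -- Eᵃ - Eⁱ - Eᵃ⁻ⁱ and sum. The term i = 0 is split off because an exhausted cycle contributes q
    -- instead of a difference.
    cutTerms : ∀ m l a → rangeSum a (λ i → diff m q ((a ∸ i) ∷ i ∷ l))
      ≡ (q + + a - + 1) * diff m q l + (+ a - + 1 - q) * diff m (q - + a) l
        - + 2 * rangeSum a (λ i → diff m (q - + i) l) + + 2 * diff m q l
    cutTerms m l zero = trans (lem q (diff m q l))
      (cong (λ y → (q + + 0 - + 1) * diff m q l + (+ 0 - + 1 - q) * diff m y l - + 2 * + 0 + + 2 * diff m q l)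
        (sym (ℤP.+-identityʳ q)))
      where
      lem : ∀ q d → + 0 ≡ (q + + 0 - + 1) * d + (+ 0 - + 1 - q) * d - + 2 * + 0 + + 2 * d
      lem = solve-∀
    cutTerms m l (suc a) = begin
      rangeSum (suc a) (λ i → diff m q ((suc a ∸ i) ∷ i ∷ l))
        ≡⟨ rangeSum-front a _ ⟩
      (q * g₀ - q * gₐ) + rangeSum a (λ i → diff m q ((a ∸ i) ∷ suc i ∷ l))
        ≡⟨ cong (λ ξ → q * g₀ - q * gₐ + ξ) (rangeSum-cong a term) ⟩
      (q * g₀ - q * gₐ) + rangeSum a (λ i → (g₀ + gₐ) - g i - g (a ∸ suc i))
        ≡⟨ cong (λ ξ → q * g₀ - q * gₐ + ξ) (rangeSum-combine a g (g₀ + gₐ)) ⟩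
      (q * g₀ - q * gₐ) + (+ a * (g₀ + gₐ) - + 2 * rangeSum a g)
        ≡⟨ lem q (+ a) g₀ gₐ (rangeSum a g) ⟩
      (q + (+ 1 + + a) - + 1) * g₀ + (+ 1 + + a - + 1 - q) * gₐ - + 2 * (g₀ + rangeSum a g) + + 2 * g₀
        ≡⟨ cong₂ (λ z s → (q + z - + 1) * g₀ + (z - + 1 - q) * gₐ - + 2 * s + + 2 * g₀)
            (sym (ℤP.pos-+ 1 a)) (sym frontEq) ⟩
      _ ∎
      where
      g₀ = diff m q l
      gₐ = diff m (q - + suc a) l
      g : ℕ → ℤ
      g i = diff m (q - + suc i) l
      frontEq : rangeSum (suc a) (λ i → diff m (q - + i) l) ≡ g₀ + rangeSum a g
      frontEq = trans (rangeSum-front a _) (cong (λ y → diff m y l + rangeSum a g) (ℤP.+-identityʳ q))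
      lem : ∀ q a u v s → (q * u - q * v) + (a * (u + v) - + 2 * s)
          ≡ (q + (+ 1 + a) - + 1) * u + (+ 1 + a - + 1 - q) * v - + 2 * (u + s) + + 2 * u
      lem = solve-∀
      lem₁ : ∀ u v x y → (u - x) - (y - v) ≡ (u + v) - x - y
      lem₁ = solve-∀
      lem₂ : ∀ q x y → q - x - y ≡ q - (x + y)
      lem₂ = solve-∀
      term : ∀ i → i ℕ.< a → diff m q ((a ∸ i) ∷ suc i ∷ l) ≡ (g₀ + gₐ) - g i - g (a ∸ suc i)
      term i i<a = begin
        diff m q ((a ∸ i) ∷ suc i ∷ l)
          ≡⟨ cong (λ z → diff m q (z ∷ suc i ∷ l)) (ℕP.+-∸-assoc 1 i<a) ⟩
        (g₀ - g i) - (g (a ∸ suc i) - diff m (q - + suc (a ∸ suc i) - + suc i) l)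
          ≡⟨ cong (λ y → (g₀ - g i) - (g (a ∸ suc i) - diff m y l))
               (trans (lem₂ q (+ suc (a ∸ suc i)) (+ suc i)) (cong (λ z → q - z)
                 (trans (sym (ℤP.pos-+ (suc (a ∸ suc i)) (suc i)))
                   (cong (λ z → + suc z) (ℕP.m∸n+n≡m i<a))))) ⟩
        (g₀ - g i) - (g (a ∸ suc i) - gₐ)
          ≡⟨ lem₁ g₀ gₐ (g i) _ ⟩
        _ ∎

    -- The right side lists the states after one more factor (c u): merges in the first sum, cuts in
    -- the second. The multipliers n and n + 2 come from the normalisation (n + 1)(n + 2) used in
    -- `starSum-diff`.
    diff-recurrence : ∀ l a n → n ≡ a ℕ.+ sum l →
      + n * diff (suc (suc n)) q (suc a ∷ l)
      ≡ + suc (suc n) * (removeSum (λ k l′ → + k * diff (suc n) q ((a ℕ.+ k) ∷ l′)) l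
                         + rangeSum a (λ i → diff (suc n) q ((a ∸ i) ∷ i ∷ l)))
    diff-recurrence l a n refl = sym (begin
      + suc m * (removeSum (λ k l′ → + k * diff m q ((a ℕ.+ k) ∷ l′)) l + rangeSum a (λ i → diff m q ((a ∸ i) ∷ i ∷ l)))
        ≡⟨ cong₂ (λ u v → + suc m * (u + v)) (mergeTerms m l a) (cutTerms m l a) ⟩
      + suc m * ((+ sum l * G₀ + (H₀ - (q + + m) * G₀) - (Hₐ - (q - + a + + m) * Gₐ))
                + ((q + + a - + 1) * G₀ + (+ a - + 1 - q) * Gₐ - + 2 * S + + 2 * G₀))
        ≡⟨ cong₂ (λ z w → z * ((+ sum l * G₀ + (H₀ - (q + w) * G₀) - (Hₐ - (q - + a + w) * Gₐ))
                + ((q + + a - + 1) * G₀ + (+ a - + 1 - q) * Gₐ - + 2 * S + + 2 * G₀))) m+1 m≡ ⟩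
      (+ 2 + (+ a + + sum l)) * ((+ sum l * G₀ + (H₀ - (q + (+ 1 + (+ a + + sum l))) * G₀) - (Hₐ - (q - + a + (+ 1 + (+ a + + sum l))) * Gₐ))
                + ((q + + a - + 1) * G₀ + (+ a - + 1 - q) * Gₐ - + 2 * S + + 2 * G₀))
        -- All terms in G₀ cancel, and q with them; Gₐ keeps the coefficient n = a + sum l. The
        -- factor n + 2 is what telescoping S and differencing at q - a require.
        ≡⟨ lem q (+ a) (+ sum l) G₀ Gₐ H₀ Hₐ S ⟩
      (+ 2 + (+ a + + sum l)) * (H₀ - Hₐ) - + 2 * ((+ 2 + (+ a + + sum l)) * S) + (+ a + + sum l) * ((+ 2 + (+ a + + sum l)) * Gₐ)
        ≡⟨ cong₂ (λ x y → (+ 2 + (+ a + + sum l)) * (H₀ - Hₐ) - + 2 * x + (+ a + + sum l) * y)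
             (trans (cong (_* S) (sym m+1)) (diff-telescope m q l a))
             (trans (cong (_* Gₐ) (sym m+1)) (trans (sym (diff-shift m (q - + a) l)) (cong (λ y → Hₐ - diff (suc m) y l) last))) ⟩
      (+ 2 + (+ a + + sum l)) * (H₀ - Hₐ) - + 2 * (H₀ - Hₐ) + (+ a + + sum l) * (Hₐ - Hₗ)
        ≡⟨ lem₂ (+ a + + sum l) H₀ Hₐ Hₗ ⟩
      (+ a + + sum l) * (H₀ - Hₗ)
        ≡⟨ cong (_* (H₀ - Hₗ)) (sym (ℤP.pos-+ a (sum l))) ⟩
      _ ∎)
      where
      m = suc (a ℕ.+ sum l)
      G₀ = diff m q l
      Gₐ = diff m (q - + a) l
      H₀ = diff (suc m) q l
      Hₐ = diff (suc m) (q - + a) l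
      Hₗ = diff (suc m) (q - + suc a) l
      S = rangeSum a (λ i → diff m (q - + i) l)
      m≡ : + m ≡ + 1 + (+ a + + sum l)
      m≡ = trans (ℤP.pos-+ 1 (a ℕ.+ sum l)) (cong (λ ξ → + 1 + ξ) (ℤP.pos-+ a (sum l)))
      m+1 : + suc m ≡ + 2 + (+ a + + sum l)
      m+1 = trans (ℤP.pos-+ 2 (a ℕ.+ sum l)) (cong (λ ξ → + 2 + ξ) (ℤP.pos-+ a (sum l)))
      last : q - + a - + 1 ≡ q - + suc a
      last = trans (lem₃ q (+ a)) (cong (λ z → q - z) (sym (ℤP.pos-+ 1 a)))
        where
        lem₃ : ∀ x a → x - a - + 1 ≡ x - (+ 1 + a)
        lem₃ = solve-∀
      lem : ∀ q a s G₀ Gₐ H₀ Hₐ S →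
        (+ 2 + (a + s)) * ((s * G₀ + (H₀ - (q + (+ 1 + (a + s))) * G₀) - (Hₐ - (q - a + (+ 1 + (a + s))) * Gₐ))
                + ((q + a - + 1) * G₀ + (a - + 1 - q) * Gₐ - + 2 * S + + 2 * G₀))
        ≡ (+ 2 + (a + s)) * (H₀ - Hₐ) - + 2 * ((+ 2 + (a + s)) * S) + (a + s) * ((+ 2 + (a + s)) * Gₐ)
      lem = solve-∀
      lem₂ : ∀ n x y z → (+ 2 + n) * (x - y) - + 2 * (x - y) + n * (y - z) ≡ n * (x - z)
      lem₂ = solve-∀

-- Duplicate-free lists, counting, and finite sums.

module FiniteSums where

  open import Data.Bool using (Bool; true; false; if_then_else_)
  open import Data.Nat as ℕ using (ℕ; suc)
  import Data.Nat.Properties as ℕP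
  open import Data.Integer using (ℤ; +_; _+_; _*_)
  import Data.Integer.Properties as ℤP
  open import Data.Integer.Tactic.RingSolver using (solve-∀)
  open import Data.List using (List; []; _∷_; _++_; map; concat; concatMap; length; filterᵇ)
  import Data.List.Properties as LP
  open import Data.Nat.ListAction using (sum)
  open import Data.List.Membership.Propositional using (_∈_; _∉_)
  open import Data.List.Membership.Propositional.Properties using (∈-∃++; ∈-++⁺ˡ; ∈-++⁺ʳ)
  open import Data.List.Relation.Unary.Any using (here; there)
  open import Data.List.Relation.Unary.All as All using (All; []; _∷_)
  open import Data.List.Relation.Unary.AllPairs using ([]; _∷_)
  open import Data.List.Relation.Unary.Unique.Propositional using (Unique)
  open import Data.List.Relation.Binary.Permutation.Propositional
  open import Data.List.Relation.Binary.Permutation.Propositional.Properties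
    using (∈-resp-↭; All-resp-↭; shift; ↭-length; drop-∷; ++⁺ˡ; ++⁺ʳ)
  open import Data.Product using (∃; _,_)
  open import Data.Empty using (⊥-elim)
  open import Function using (_∘_)
  open import Relation.Binary.PropositionalEquality as ≡ using (_≡_; refl; sym; cong; cong₂; subst)

  when : Bool → ℤ → ℤ
  when b z = if b then z else + 0

  module _ {X : Set} where

    Unique-resp-↭ : {xs ys : List X} → xs ↭ ys → Unique xs → Unique ys
    Unique-resp-↭ refl         u                        = u
    Unique-resp-↭ (prep x p)   (x∉ ∷ u)                 = All-resp-↭ p x∉ ∷ Unique-resp-↭ p u
    Unique-resp-↭ (swap x y p) ((x≢y ∷ x∉) ∷ (y∉ ∷ u))  =
      ((x≢y ∘ sym) ∷ All-resp-↭ p y∉) ∷ (All-resp-↭ p x∉ ∷ Unique-resp-↭ p u)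
    Unique-resp-↭ (trans p q)  u                        = Unique-resp-↭ q (Unique-resp-↭ p u)

    Unique-head : {x : X} {xs : List X} → Unique (x ∷ xs) → x ∉ xs
    Unique-head (x∉ ∷ _) x∈ = All.lookup x∉ x∈ refl

    Unique-∷ : {x : X} {xs : List X} → x ∉ xs → Unique xs → Unique (x ∷ xs)
    Unique-∷ x∉ u = All.tabulate (λ y∈ x≡y → x∉ (subst (_∈ _) (sym x≡y) y∈)) ∷ u

    Unique-++ʳ : (xs {ys} : List X) → Unique (xs ++ ys) → Unique ys
    Unique-++ʳ []       u       = u
    Unique-++ʳ (x ∷ xs) (_ ∷ u) = Unique-++ʳ xs u

    Unique-++ˡ : (xs {ys} : List X) → Unique (xs ++ ys) → Unique xs
    Unique-++ˡ []       u       = []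
    Unique-++ˡ (x ∷ xs) u@(_ ∷ u′) = Unique-∷ (Unique-head u ∘ ∈-++⁺ˡ) (Unique-++ˡ xs u′)

    -- Each entry of xs is located in ys and moved to the front. As xs has no repetitions, the later
    -- entries are still found after that occurrence is taken away.
    complement : {xs ys : List X} → Unique xs → (∀ {x} → x ∈ xs → x ∈ ys) → ∃ λ zs → ys ↭ xs ++ zs
    complement {[]}     {ys} _ _ = ys , ↭-refl
    complement {x ∷ xs} u@(_ ∷ u′) xs⊆ys with ∈-∃++ (xs⊆ys (here refl))
    ... | ys₁ , ys₂ , refl with complement u′ rest
      where
      rest : ∀ {y} → y ∈ xs → y ∈ ys₁ ++ ys₂
      rest y∈ with ∈-resp-↭ (shift x ys₁ ys₂) (xs⊆ys (there y∈))
      ... | here refl = ⊥-elim (Unique-head u y∈)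
      ... | there z   = z
    ... | zs , p = zs , ↭-trans (shift x ys₁ ys₂) (prep x p)

    -- The pigeonhole principle: a nonempty complement would make ys longer than xs.
    Unique-⊆-length⇒↭ : {xs ys : List X} → Unique xs → (∀ {x} → x ∈ xs → x ∈ ys) →
                        length xs ≡ length ys → ys ↭ xs
    Unique-⊆-length⇒↭ {xs} {ys} u xs⊆ys eq with complement u xs⊆ys
    ... | []     , p = ↭-trans p (↭-reflexive (LP.++-identityʳ xs))
    ... | z ∷ zs , p = ⊥-elim (ℕP.m≢1+m+n (length xs) (≡.trans eq (≡.trans (↭-length p)
        (≡.trans (LP.length-++ xs) (ℕP.+-suc (length xs) (length zs))))))

    Unique-≈⇒↭ : {xs ys : List X} → Unique xs → Unique ys →
                 (∀ {x} → x ∈ xs → x ∈ ys) → (∀ {x} → x ∈ ys → x ∈ xs) → ys ↭ xs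
    Unique-≈⇒↭ {xs} u v xs⊆ys ys⊆xs with complement u xs⊆ys
    ... | []     , p = ↭-trans p (↭-reflexive (LP.++-identityʳ xs))
    ... | z ∷ zs , p = ⊥-elim (Unique-head (Unique-resp-↭ (↭-trans p (shift z xs zs)) v)
                         (∈-++⁺ˡ (ys⊆xs (∈-resp-↭ (↭-sym p) (∈-++⁺ʳ xs (here refl))))))

    count : (X → Bool) → List X → ℕ
    count p []       = 0
    count p (x ∷ xs) = if p x then suc (count p xs) else count p xs

    length-filterᵇ : ∀ p xs → length (filterᵇ p xs) ≡ count p xs
    length-filterᵇ p [] = refl
    length-filterᵇ p (x ∷ xs) with p x
    ... | true  = cong suc (length-filterᵇ p xs)
    ... | false = length-filterᵇ p xs

    count-++ : ∀ p xs ys → count p (xs ++ ys) ≡ count p xs ℕ.+ count p ys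
    count-++ p []       ys = refl
    count-++ p (x ∷ xs) ys with p x
    ... | true  = cong suc (count-++ p xs ys)
    ... | false = count-++ p xs ys

    count-concat : ∀ p xss → count p (concat xss) ≡ sum (map (count p) xss)
    count-concat p []         = refl
    count-concat p (xs ∷ xss) = ≡.trans (count-++ p xs (concat xss)) (cong (count p xs ℕ.+_) (count-concat p xss))

    count-↭ : ∀ p {xs ys} → xs ↭ ys → count p xs ≡ count p ys
    count-↭ p refl = refl
    count-↭ p (prep x q) with p x
    ... | true  = cong suc (count-↭ p q)
    ... | false = count-↭ p q
    count-↭ p (swap x y q) with p x | p y
    ... | true  | true  = cong (suc ∘ suc) (count-↭ p q)
    ... | true  | false = cong suc (count-↭ p q)
    ... | false | true  = cong suc (count-↭ p q)
    ... | false | false = count-↭ p q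
    count-↭ p (trans q r) = ≡.trans (count-↭ p q) (count-↭ p r)

    count-cong : ∀ p p′ xs → (∀ {x} → x ∈ xs → p x ≡ p′ x) → count p xs ≡ count p′ xs
    count-cong p p′ []       e = refl
    count-cong p p′ (x ∷ xs) e rewrite e (here refl) with p′ x
    ... | true  = cong suc (count-cong p p′ xs (e ∘ there))
    ... | false = count-cong p p′ xs (e ∘ there)

    count-none : ∀ p xs → (∀ {x} → x ∈ xs → p x ≡ false) → count p xs ≡ 0
    count-none p []       e = refl
    count-none p (x ∷ xs) e rewrite e (here refl) = count-none p xs (e ∘ there)

    count-all : ∀ p xs → (∀ {x} → x ∈ xs → p x ≡ true) → count p xs ≡ length xs
    count-all p []       e = refl
    count-all p (x ∷ xs) e rewrite e (here refl) = cong suc (count-all p xs (e ∘ there))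

    sumOver : List X → (X → ℤ) → ℤ
    sumOver []       φ = + 0
    sumOver (x ∷ xs) φ = φ x + sumOver xs φ

    sumOver-cong : ∀ xs {φ ψ} → (∀ x → φ x ≡ ψ x) → sumOver xs φ ≡ sumOver xs ψ
    sumOver-cong []       e = refl
    sumOver-cong (x ∷ xs) e = cong₂ _+_ (e x) (sumOver-cong xs e)

    sumOver-++ : ∀ xs ys φ → sumOver (xs ++ ys) φ ≡ sumOver xs φ + sumOver ys φ
    sumOver-++ []       ys φ = sym (ℤP.+-identityˡ _)
    sumOver-++ (x ∷ xs) ys φ = ≡.trans (cong (λ ξ → φ x + ξ) (sumOver-++ xs ys φ)) (sym (ℤP.+-assoc (φ x) _ _))

    sumOver-↭ : ∀ {xs ys} φ → xs ↭ ys → sumOver xs φ ≡ sumOver ys φ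
    sumOver-↭ φ refl         = refl
    sumOver-↭ φ (prep x p)   = cong (λ ξ → φ x + ξ) (sumOver-↭ φ p)
    sumOver-↭ φ (swap {ys = ys} x y p) = ≡.trans (cong (λ s → φ x + (φ y + s)) (sumOver-↭ φ p))
      (lem (φ x) (φ y) (sumOver ys φ))
      where
      lem : ∀ a b c → a + (b + c) ≡ b + (a + c)
      lem = solve-∀
    sumOver-↭ φ (trans p q)  = ≡.trans (sumOver-↭ φ p) (sumOver-↭ φ q)

    sumOver-* : ∀ r xs φ → r * sumOver xs φ ≡ sumOver xs (λ x → r * φ x)
    sumOver-* r []       φ = ℤP.*-zeroʳ r
    sumOver-* r (x ∷ xs) φ = ≡.trans (ℤP.*-distribˡ-+ r (φ x) _) (cong (λ ξ → r * φ x + ξ) (sumOver-* r xs φ))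

    sumOver-+ : ∀ xs φ ψ → sumOver xs (λ x → φ x + ψ x) ≡ sumOver xs φ + sumOver xs ψ
    sumOver-+ []       φ ψ = refl
    sumOver-+ (x ∷ xs) φ ψ = ≡.trans (cong (λ ξ → φ x + ψ x + ξ) (sumOver-+ xs φ ψ)) (lem (φ x) (ψ x) _ _)
      where
      lem : ∀ a b c d → a + b + (c + d) ≡ a + c + (b + d)
      lem = solve-∀

    sumOver-0 : ∀ xs → sumOver xs (λ _ → + 0) ≡ + 0
    sumOver-0 []       = refl
    sumOver-0 (x ∷ xs) = ≡.trans (ℤP.+-identityˡ _) (sumOver-0 xs)

    sumOver-filterᵇ : ∀ p xs φ → sumOver (filterᵇ p xs) φ ≡ sumOver xs (λ x → when (p x) (φ x))
    sumOver-filterᵇ p []       φ = refl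
    sumOver-filterᵇ p (x ∷ xs) φ with p x
    ... | true  = cong (λ ξ → φ x + ξ) (sumOver-filterᵇ p xs φ)
    ... | false = ≡.trans (sumOver-filterᵇ p xs φ) (sym (ℤP.+-identityˡ _))

  module _ {X Y : Set} where

    sumOver-map : ∀ (f : X → Y) xs φ → sumOver (map f xs) φ ≡ sumOver xs (φ ∘ f)
    sumOver-map f []       φ = refl
    sumOver-map f (x ∷ xs) φ = cong (λ ξ → φ (f x) + ξ) (sumOver-map f xs φ)

    sumOver-concatMap : ∀ (f : X → List Y) xs φ →
      sumOver (concatMap f xs) φ ≡ sumOver xs (λ x → sumOver (f x) φ)
    sumOver-concatMap f []       φ = refl
    sumOver-concatMap f (x ∷ xs) φ = ≡.trans (sumOver-++ (f x) (concatMap f xs) φ)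
      (cong (λ ξ → sumOver (f x) φ + ξ) (sumOver-concatMap f xs φ))

    sumOver-swap : ∀ xs (ys : List Y) (φ : X → Y → ℤ) →
      sumOver xs (λ x → sumOver ys (φ x)) ≡ sumOver ys (λ y → sumOver xs (λ x → φ x y))
    sumOver-swap []       ys φ = sym (sumOver-0 ys)
    sumOver-swap (x ∷ xs) ys φ = ≡.trans (cong (λ ξ → sumOver ys (φ x) + ξ) (sumOver-swap xs ys φ))
      (sym (sumOver-+ ys (φ x) _))

    Unique-map-on : (f : X → Y) {xs : List X} → (∀ {x y} → x ∈ xs → y ∈ xs → f x ≡ f y → x ≡ y) →
                    Unique xs → Unique (map f xs)
    Unique-map-on f {[]}     inj u          = []
    Unique-map-on f {x ∷ xs} inj u@(_ ∷ u′) = Unique-∷ notin (Unique-map-on f (λ a b → inj (there a) (there b)) u′)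
      where
      open import Data.List.Membership.Propositional.Properties using (∈-map⁻)
      notin : f x ∉ map f xs
      notin m with ∈-map⁻ f m
      ... | y , y∈ , eq with inj (here refl) (there y∈) eq
      ... | refl = Unique-head u y∈

-- Cycle notation, and the effect of multiplying by a transposition.

module Cycles where

  open import Defs using (Map; _·_; iter; isCycleMinᵇ; cycles; nontrivialCycles; IsPerm)
  open FiniteSums
  open import Data.Bool using (Bool; true; false; _∧_; not)
  open import Data.Nat as ℕ using (ℕ; zero; suc; _≤_; _<_; z≤n; s≤s)
  import Data.Nat.Properties as ℕP
  open import Data.Fin as Fin using (Fin; toℕ; fromℕ<)
  import Data.Fin.Properties as FinP
  open import Data.Fin.Permutation.Components using (transpose; transpose-inverse)
  open import Data.Vec using (lookup; tabulate)
  open import Data.Vec.Properties using (lookup∘tabulate; tabulate∘lookup; tabulate-cong)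
  open import Data.List using (List; []; _∷_; _++_; map; concat; length; [_]; allFin)
  import Data.List.Properties as LP
  open import Data.Nat.ListAction using (sum)
  open import Data.List.Membership.Propositional using (_∈_)
  open import Data.List.Membership.Propositional.Properties
  open import Data.List.Relation.Unary.Any using (here; there)
  open import Data.List.Relation.Unary.All as All using (All; []; _∷_)
  import Data.List.Relation.Unary.All.Properties as AllP
  open import Data.List.Relation.Unary.Unique.Propositional using (Unique)
  open import Data.List.Relation.Unary.Unique.Propositional.Properties using (allFin⁺)
  open import Data.List.Relation.Binary.Permutation.Propositional
  open import Data.List.Relation.Binary.Permutation.Propositional.Properties
    using (∈-resp-↭; shift; shifts; ↭-length; ++⁺ˡ; ++⁺ʳ; ++-comm)
  open import Data.Product using (∃; ∃₂; _×_; _,_; proj₁; proj₂)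
  open import Data.Sum using (inj₁; inj₂)
  open import Data.Empty using (⊥; ⊥-elim)
  open import Function using (_∘_)
  open import Relation.Nullary using (¬_; Dec; yes; no)
  open import Relation.Nullary.Decidable using (⌊_⌋)
  open import Relation.Binary.PropositionalEquality as ≡ using (_≡_; _≢_; refl; sym; cong; cong₂; subst)

  ⌊⌋-true : {P : Set} (d : Dec P) → P → ⌊ d ⌋ ≡ true
  ⌊⌋-true (yes _) p = refl
  ⌊⌋-true (no ¬p) p = ⊥-elim (¬p p)

  ⌊⌋-false : {P : Set} (d : Dec P) → ¬ P → ⌊ d ⌋ ≡ false
  ⌊⌋-false (yes p) ¬p = ⊥-elim (¬p p)
  ⌊⌋-false (no _)  ¬p = refl

  ⌊⌋-true⁻¹ : {P : Set} (d : Dec P) → ⌊ d ⌋ ≡ true → P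
  ⌊⌋-true⁻¹ (yes p) _ = p

  module _ {n : ℕ} where

    lookup-ext : {ρ σ : Map n} → (∀ i → lookup ρ i ≡ lookup σ i) → ρ ≡ σ
    lookup-ext {ρ} {σ} e = ≡.trans (sym (tabulate∘lookup ρ)) (≡.trans (tabulate-cong e) (tabulate∘lookup σ))

    -- The list holds the interior points only. With the end points kept outside, a cycle is a path
    -- from x back to x, and cutting or merging cycles is splitting or joining paths.
    Path : Map n → Fin n → List (Fin n) → Fin n → Set
    Path ρ x []       y = lookup ρ x ≡ y
    Path ρ x (z ∷ zs) y = lookup ρ x ≡ z × Path ρ z zs y

    module _ {ρ : Map n} where

      Path-split : ∀ {x y u} L₁ {L₂} → Path ρ x (L₁ ++ u ∷ L₂) y → Path ρ x L₁ u × Path ρ u L₂ y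
      Path-split []       (e , p) = e , p
      Path-split (z ∷ L₁) (e , p) = let p₁ , p₂ = Path-split L₁ p in (e , p₁) , p₂

      Path-join : ∀ {x y u} L₁ {L₂} → Path ρ x L₁ u → Path ρ u L₂ y → Path ρ x (L₁ ++ u ∷ L₂) y
      Path-join []       e       p₂ = e , p₂
      Path-join (z ∷ L₁) (e , p) p₂ = e , Path-join L₁ p p₂

      Path-transfer : ∀ {ρ′ x x′ y} L → lookup ρ′ x′ ≡ lookup ρ x →
        (∀ {z} → z ∈ L → lookup ρ′ z ≡ lookup ρ z) → Path ρ x L y → Path ρ′ x′ L y
      Path-transfer []      e f p        = ≡.trans e p
      Path-transfer (z ∷ L) e f (e′ , p) = ≡.trans e e′ , Path-transfer L (f (here refl)) (f ∘ there) p

      iter-front : ∀ k x → iter ρ k (lookup ρ x) ≡ iter ρ (suc k) x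
      iter-front zero    x = refl
      iter-front (suc k) x = cong (lookup ρ) (iter-front k x)

      Path-iter : ∀ {x y z} L → Path ρ x L y → z ∈ L → ∃ λ k → k ≤ length L × iter ρ k x ≡ z
      Path-iter (z ∷ L) (e , p) (here refl) = 1 , s≤s z≤n , e
      Path-iter (w ∷ L) (e , p) (there z∈) with Path-iter L p z∈
      ... | k , k≤ , eq = suc k , s≤s k≤ , ≡.trans (sym (iter-front k _)) (≡.trans (cong (iter ρ k) e) eq)

      Path-closed : ∀ {x y z} L → Path ρ x L y → z ∈ x ∷ L → lookup ρ z ∈ y ∷ L
      Path-closed []      e       (here refl) = here e
      Path-closed (w ∷ L) (e , p) (here refl) = there (here e)
      Path-closed (w ∷ L) (e , p) (there z∈) with Path-closed L p z∈
      ... | here e′ = here e′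
      ... | there m = there (there m)

      Path-unique : ∀ {x y y′} L L′ → length L ≡ length L′ → Path ρ x L y → Path ρ x L′ y′ → L ≡ L′
      Path-unique []      []        eq p       p′        = refl
      Path-unique (z ∷ L) (z′ ∷ L′) eq (e , p) (e′ , p′) with ≡.trans (sym e) e′
      ... | refl = cong (z ∷_) (Path-unique L L′ (ℕP.suc-injective eq) p p′)

    Path-determines : ∀ {ρ σ : Map n} {x y} L → Path ρ x L y → Path σ x L y →
                      ∀ {z} → z ∈ x ∷ L → lookup ρ z ≡ lookup σ z
    Path-determines []      p       p′        (here refl) = ≡.trans p (sym p′)
    Path-determines (w ∷ L) (e , p) (e′ , p′) (here refl) = ≡.trans e (sym e′)
    Path-determines (w ∷ L) (e , p) (e′ , p′) (there z∈)  = Path-determines L p p′ z∈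

    IsCycle : Map n → List (Fin n) → Set
    IsCycle ρ []       = ⊥
    IsCycle ρ (x ∷ xs) = Path ρ x xs x

    IsCycle-transfer : ∀ {ρ ρ′} K → (∀ {z} → z ∈ K → lookup ρ′ z ≡ lookup ρ z) → IsCycle ρ K → IsCycle ρ′ K
    IsCycle-transfer (x ∷ K) f p = Path-transfer K (f (here refl)) (f ∘ there) p

    IsCycle-rotate : ∀ {ρ} L₁ u L₂ → IsCycle ρ (L₁ ++ u ∷ L₂) → Path ρ u (L₂ ++ L₁) u
    IsCycle-rotate []       u L₂ p = subst (λ L → Path _ u L u) (sym (LP.++-identityʳ L₂)) p
    IsCycle-rotate (x ∷ L₁) u L₂ p = let p₁ , p₂ = Path-split L₁ p in Path-join L₂ p₂ p₁

    IsCycle-iter : ∀ {ρ} K → IsCycle ρ K → ∀ k {x} → x ∈ K → iter ρ k x ∈ K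
    IsCycle-iter K       p zero    x∈ = x∈
    IsCycle-iter (y ∷ K) p (suc k) x∈ = Path-closed K p (IsCycle-iter (y ∷ K) p k x∈)

    least : ∀ (x : Fin n) xs → ∃ λ m → m ∈ x ∷ xs × (∀ {y} → y ∈ x ∷ xs → m Fin.≤ y)
    least x []        = x , here refl , λ { (here refl) → FinP.≤-refl }
    least x (x′ ∷ xs) with least x′ xs
    ... | m , m∈ , le with FinP.≤-total x m
    ... | inj₁ x≤m = x , here refl , λ { (here refl) → FinP.≤-refl ; (there y∈) → FinP.≤-trans x≤m (le y∈) }
    ... | inj₂ m≤x = m , there m∈ , λ { (here refl) → m≤x ; (there y∈) → le y∈ }

    -- If x is not the least point m, write the cycle starting from x: m occurs after fewer than
    -- `length K` steps, so it is among the n iterates that `isCycleMinᵇ` inspects. This is the use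
    -- of the length bound.
    cycleMin : ∀ {ρ} K → IsCycle ρ K → length K ≤ n →
      ∃ λ m → m ∈ K × isCycleMinᵇ ρ m ≡ true × (∀ {x} → x ∈ K → x ≢ m → isCycleMinᵇ ρ x ≡ false)
    cycleMin {ρ} K@(y ∷ ys) p len with least y ys
    ... | m , m∈ , le = m , m∈ , ⌊⌋-true _ (λ k → le (IsCycle-iter K p (toℕ k) m∈)) , notMin
      where
      notMin : ∀ {x} → x ∈ K → x ≢ m → isCycleMinᵇ ρ x ≡ false
      notMin {x} x∈ x≢m with ∈-∃++ x∈
      ... | L₁ , L₂ , eq with ∈-resp-↭ (↭-trans (↭-reflexive eq) (shift x L₁ L₂)) m∈
      ... | here m≡x = ⊥-elim (x≢m (sym m≡x))
      ... | there m∈′ with Path-iter (L₂ ++ L₁) (IsCycle-rotate L₁ x L₂ (subst (IsCycle ρ) eq p))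
                            (∈-resp-↭ (++-comm L₁ L₂) m∈′)
      ... | k , k≤ , ek = ⌊⌋-false _ λ all → x≢m (FinP.≤-antisym
              (subst (x Fin.≤_) (≡.trans (cong (λ j → iter ρ j x) (FinP.toℕ-fromℕ< k<n)) ek) (all (fromℕ< k<n)))
              (le x∈))
        where
        k<n : k < n
        k<n = ℕP.≤-trans (s≤s k≤) (ℕP.≤-trans (ℕP.≤-reflexive
                (sym (≡.trans (cong length eq) (↭-length (↭-trans (shift x L₁ L₂) (prep x (++-comm L₁ L₂))))))) len)

    count-single : ∀ (p : Fin n → Bool) K m → Unique K → m ∈ K → (∀ {x} → x ∈ K → x ≢ m → p x ≡ false) →
      count p K ≡ count p [ m ]
    count-single p K m u m∈ others with ∈-∃++ m∈
    ... | L₁ , L₂ , refl = ≡.trans (count-↭ p (↭-trans (shift m L₁ L₂) (++-comm [ m ] (L₁ ++ L₂))))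
        (≡.trans (count-++ p (L₁ ++ L₂) [ m ]) (cong (ℕ._+ count p [ m ]) (count-none p (L₁ ++ L₂)
          (λ {x} x∈ → others (∈-resp-↭ (↭-sym (shift m L₁ L₂)) (there x∈))
            (λ x≡m → Unique-head (Unique-resp-↭ (shift m L₁ L₂) u) (subst (_∈ _) x≡m x∈))))))

    CycleNotation : Map n → List (List (Fin n)) → Set
    CycleNotation ρ cs = All (IsCycle ρ) cs × concat cs ↭ allFin n

    notation-unique : ∀ {xs : List (Fin n)} → xs ↭ allFin n → Unique xs
    notation-unique p = Unique-resp-↭ (↭-sym p) (allFin⁺ n)

    notation-length : ∀ {xs : List (Fin n)} → xs ↭ allFin n → length xs ≡ n
    notation-length p = ≡.trans (↭-length p) (LP.length-tabulate (λ i → i))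

    cycles-length : ∀ {ρ cs} → CycleNotation ρ cs → cycles ρ ≡ length cs
    cycles-length {ρ} {cs} (cyc , p) = ≡.trans (length-filterᵇ (isCycleMinᵇ ρ) (allFin n))
      (≡.trans (count-↭ (isCycleMinᵇ ρ) (↭-sym p)) (≡.trans (count-concat (isCycleMinᵇ ρ) cs)
        (ones cs cyc (notation-unique p) (ℕP.≤-reflexive (notation-length p)))))
      where
      ones : ∀ cs → All (IsCycle ρ) cs → Unique (concat cs) → length (concat cs) ≤ n →
             sum (map (count (isCycleMinᵇ ρ)) cs) ≡ length cs
      ones []       _         _ _   = refl
      ones (K ∷ cs) (c ∷ cyc) u len = cong₂ ℕ._+_ one
          (ones cs cyc (Unique-++ʳ K u) (ℕP.≤-trans (ℕP.m≤n+m _ (length K)) len′))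
        where
        len′ : length K ℕ.+ length (concat cs) ≤ n
        len′ = subst (_≤ n) (LP.length-++ K) len
        one : count (isCycleMinᵇ ρ) K ≡ 1
        one with cycleMin K c (ℕP.≤-trans (ℕP.m≤m+n _ _) len′)
        ... | m , m∈ , min , notMin = ≡.trans (count-single _ K m (Unique-++ˡ K u) m∈ notMin) single
          where
          single : count (isCycleMinᵇ ρ) [ m ] ≡ 1
          single rewrite min = refl

    nontrivial : List (Fin n) → ℕ
    nontrivial []          = 0
    nontrivial (_ ∷ [])    = 0
    nontrivial (_ ∷ _ ∷ _) = 1

    nontrivialCycles-sum : ∀ {ρ cs} → CycleNotation ρ cs → nontrivialCycles ρ ≡ sum (map nontrivial cs)
    nontrivialCycles-sum {ρ} {cs} (cyc , p) = ≡.trans (length-filterᵇ q (allFin n))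
      (≡.trans (count-↭ q (↭-sym p)) (≡.trans (count-concat q cs)
        (go cs cyc (notation-unique p) (ℕP.≤-reflexive (notation-length p)))))
      where
      q : Fin n → Bool
      q i = isCycleMinᵇ ρ i ∧ not ⌊ lookup ρ i Fin.≟ i ⌋
      -- Rotate the cycle so that it starts at m. Its image is then a further entry of a list
      -- without repetitions, hence not m.
      moved : ∀ {x y K m} → IsCycle ρ (x ∷ y ∷ K) → Unique (x ∷ y ∷ K) → m ∈ x ∷ y ∷ K → lookup ρ m ≢ m
      moved {m = m} c u m∈ e with ∈-∃++ m∈
      ... | [] , L₂ , refl = Unique-head u (here (≡.trans (sym e) (proj₁ c)))
      ... | z ∷ L₁ , L₂ , eq = Unique-head (Unique-resp-↭ (shift m (z ∷ L₁) L₂) (subst Unique eq u)) (found L₂ rot)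
        where
        rot : Path ρ m (L₂ ++ z ∷ L₁) m
        rot = IsCycle-rotate (z ∷ L₁) m L₂ (subst (IsCycle ρ) eq c)
        found : ∀ L → Path ρ m (L ++ z ∷ L₁) m → m ∈ z ∷ L₁ ++ L
        found []      (e′ , _) = here (≡.trans (sym e) e′)
        found (w ∷ L) (e′ , _) = ∈-++⁺ʳ (z ∷ L₁) (here (≡.trans (sym e) e′))
      each : ∀ K → IsCycle ρ K → Unique K → ∀ {m} → m ∈ K → isCycleMinᵇ ρ m ≡ true →
             count q [ m ] ≡ nontrivial K
      each (x ∷ []) c u (here refl) min rewrite min | ⌊⌋-true (lookup ρ x Fin.≟ x) c = refl
      each (x ∷ y ∷ K) c u {m} m∈ min
        rewrite min | ⌊⌋-false (lookup ρ m Fin.≟ m) (moved {K = K} c u m∈) = refl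
      go : ∀ cs → All (IsCycle ρ) cs → Unique (concat cs) → length (concat cs) ≤ n →
           sum (map (count q) cs) ≡ sum (map nontrivial cs)
      go []       _         _ _   = refl
      go (K ∷ cs) (c ∷ cyc) u len = cong₂ ℕ._+_ one
          (go cs cyc (Unique-++ʳ K u) (ℕP.≤-trans (ℕP.m≤n+m _ (length K)) len′))
        where
        len′ : length K ℕ.+ length (concat cs) ≤ n
        len′ = subst (_≤ n) (LP.length-++ K) len
        one : count q K ≡ nontrivial K
        one with cycleMin K c (ℕP.≤-trans (ℕP.m≤m+n _ _) len′)
        ... | m , m∈ , min , notMin = ≡.trans (count-single q K m (Unique-++ˡ K u) m∈
                (λ x∈ x≢m → cong (_∧ not ⌊ lookup ρ _ Fin.≟ _ ⌋) (notMin x∈ x≢m))) (each K c (Unique-++ˡ K u) m∈ min)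

    -- This is (c u)ρ. As products run from left to right, it exchanges the images of c and u and
    -- keeps all others, so every path avoiding c and u survives.
    twist : Fin n → Fin n → Map n → Map n
    twist c u ρ = tabulate (transpose c u) · ρ

    lookup-twist : ∀ c u ρ i → lookup (twist c u ρ) i ≡ lookup ρ (transpose c u i)
    lookup-twist c u ρ i = ≡.trans (lookup∘tabulate _ i) (cong (lookup ρ) (lookup∘tabulate (transpose c u) i))

    transpose-left : ∀ (c u : Fin n) → transpose c u c ≡ u
    transpose-left c u with c Fin.≟ c
    ... | yes _   = refl
    ... | no c≢c = ⊥-elim (c≢c refl)

    transpose-right : ∀ (c u : Fin n) → transpose c u u ≡ c
    transpose-right c u with u Fin.≟ c
    ... | yes e = e
    ... | no _ with u Fin.≟ u
    ...   | yes _   = refl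
    ...   | no u≢u = ⊥-elim (u≢u refl)

    transpose-other : ∀ {c u z : Fin n} → z ≢ c → z ≢ u → transpose c u z ≡ z
    transpose-other {c} {u} {z} z≢c z≢u with z Fin.≟ c
    ... | yes e = ⊥-elim (z≢c e)
    ... | no _ with z Fin.≟ u
    ...   | yes e = ⊥-elim (z≢u e)
    ...   | no _  = refl

    twist-left : ∀ c u ρ → lookup (twist c u ρ) c ≡ lookup ρ u
    twist-left c u ρ = ≡.trans (lookup-twist c u ρ c) (cong (lookup ρ) (transpose-left c u))

    twist-right : ∀ c u ρ → lookup (twist c u ρ) u ≡ lookup ρ c
    twist-right c u ρ = ≡.trans (lookup-twist c u ρ u) (cong (lookup ρ) (transpose-right c u))

    twist-other : ∀ {c u z} ρ → z ≢ c → z ≢ u → lookup (twist c u ρ) z ≡ lookup ρ z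
    twist-other ρ z≢c z≢u = ≡.trans (lookup-twist _ _ ρ _) (cong (lookup ρ) (transpose-other z≢c z≢u))

    twist-fresh : ∀ {c u : Fin n} {rest : List (Fin n)} ρ → Unique (c ∷ u ∷ rest) → ∀ {z} → z ∈ rest →
                  lookup (twist c u ρ) z ≡ lookup ρ z
    twist-fresh ρ un z∈ = twist-other ρ
      (λ { refl → Unique-head un (there z∈) })
      (λ { refl → Unique-head (Unique-++ʳ [ _ ] un) z∈ })

    -- A cycle notation in which the cycle of c comes first and starts at c. Multiplying by (c u)
    -- then has two cases: u lies in M or in one of Os.
    Marked : Map n → Fin n → List (Fin n) → List (List (Fin n)) → Set
    Marked ρ c M Os = Path ρ c M c × All (IsCycle ρ) Os × c ∷ M ++ concat Os ↭ allFin n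

    unmark : ∀ {ρ c M Os} → Marked ρ c M Os → CycleNotation ρ ((c ∷ M) ∷ Os)
    unmark (p , cyc , perm) = p ∷ cyc , perm

    cycles-transfer : ∀ {ρ ρ′} Os → (∀ {z} → z ∈ concat Os → lookup ρ′ z ≡ lookup ρ z) →
                      All (IsCycle ρ) Os → All (IsCycle ρ′) Os
    cycles-transfer []       f []        = []
    cycles-transfer (K ∷ Os) f (c ∷ cyc) =
      IsCycle-transfer K (f ∘ ∈-++⁺ˡ) c ∷ cycles-transfer Os (f ∘ ∈-++⁺ʳ K) cyc

    cut-↭ : ∀ L₁ (u : Fin n) L₂ xs → (L₁ ++ u ∷ L₂) ++ xs ↭ u ∷ L₂ ++ L₁ ++ xs
    cut-↭ L₁ u L₂ xs = ↭-trans (++⁺ʳ xs (↭-trans (shift u L₁ L₂) (prep u (++-comm L₁ L₂))))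
      (prep u (↭-reflexive (LP.++-assoc L₂ L₁ xs)))

    -- After the exchange c continues with the part behind u and returns to itself, while u
    -- continues with the part formerly behind c and closes up.
    cut : ∀ {ρ c u Os} L₁ L₂ → Marked ρ c (L₁ ++ u ∷ L₂) Os → Marked (twist c u ρ) c L₂ ((u ∷ L₁) ∷ Os)
    cut {ρ} {c} {u} {Os} L₁ L₂ (p , cyc , perm) =
        Path-transfer L₂ (twist-left c u ρ) (fresh ∘ ∈-++⁺ˡ) (proj₂ parts)
      , Path-transfer L₁ (twist-right c u ρ) (fresh ∘ ∈-++⁺ʳ L₂ ∘ ∈-++⁺ˡ) (proj₁ parts)
        ∷ cycles-transfer Os (fresh ∘ ∈-++⁺ʳ L₂ ∘ ∈-++⁺ʳ L₁) cyc
      , ↭-trans (prep c (↭-trans (shift u L₂ (L₁ ++ concat Os)) (↭-sym (cut-↭ L₁ u L₂ (concat Os))))) perm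
      where
      parts = Path-split L₁ p
      fresh : ∀ {z} → z ∈ L₂ ++ L₁ ++ concat Os → lookup (twist c u ρ) z ≡ lookup ρ z
      fresh = twist-fresh ρ (Unique-resp-↭ (prep c (cut-↭ L₁ u L₂ (concat Os))) (notation-unique perm))

    extract-↭ : ∀ O₁ (K : List (Fin n)) O₂ → concat (O₁ ++ K ∷ O₂) ↭ K ++ concat (O₁ ++ O₂)
    extract-↭ O₁ K O₂ = ↭-trans (↭-reflexive (sym (LP.concat-++ O₁ (K ∷ O₂)))) (↭-trans
      (shifts (concat O₁) K) (++⁺ˡ K (↭-reflexive (LP.concat-++ O₁ O₂))))

    merge-↭ : ∀ M O₁ K₁ (u : Fin n) K₂ O₂ →
      M ++ concat (O₁ ++ (K₁ ++ u ∷ K₂) ∷ O₂) ↭ u ∷ M ++ (K₂ ++ K₁) ++ concat (O₁ ++ O₂)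
    merge-↭ M O₁ K₁ u K₂ O₂ = ↭-trans (++⁺ˡ M (↭-trans (extract-↭ O₁ (K₁ ++ u ∷ K₂) O₂)
      (↭-trans (cut-↭ K₁ u K₂ (concat (O₁ ++ O₂))) (prep u (↭-reflexive (sym (LP.++-assoc K₂ K₁ _)))))))
      (shift u M ((K₂ ++ K₁) ++ concat (O₁ ++ O₂)))

    -- After the exchange c first runs through the foreign cycle, starting behind u and ending in u,
    -- and u then continues with the old cycle of c.
    merge : ∀ {ρ c u M} O₁ O₂ K₁ K₂ → Marked ρ c M (O₁ ++ (K₁ ++ u ∷ K₂) ∷ O₂) →
            Marked (twist c u ρ) c ((K₂ ++ K₁) ++ u ∷ M) (O₁ ++ O₂)
    merge {ρ} {c} {u} {M} O₁ O₂ K₁ K₂ (p , cyc , perm) =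
        Path-join (K₂ ++ K₁)
          (Path-transfer (K₂ ++ K₁) (twist-left c u ρ) (fresh ∘ ∈-++⁺ʳ M ∘ ∈-++⁺ˡ) rot)
          (Path-transfer M (twist-right c u ρ) (fresh ∘ ∈-++⁺ˡ) p)
      , cycles-transfer (O₁ ++ O₂) (fresh ∘ ∈-++⁺ʳ M ∘ ∈-++⁺ʳ (K₂ ++ K₁)) (AllP.++⁺ (AllP.++⁻ˡ O₁ cyc) cyc₂)
      , ↭-trans (prep c (↭-trans (cut-↭ (K₂ ++ K₁) u M C) (↭-sym (merge-↭ M O₁ K₁ u K₂ O₂)))) perm
      where
      C = concat (O₁ ++ O₂)
      cyc₂ : All (IsCycle ρ) O₂
      cyc₂ with AllP.++⁻ʳ O₁ cyc
      ... | _ ∷ r = r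
      rot : Path ρ u (K₂ ++ K₁) u
      rot with AllP.++⁻ʳ O₁ cyc
      ... | r ∷ _ = IsCycle-rotate K₁ u K₂ r
      fresh : ∀ {z} → z ∈ M ++ (K₂ ++ K₁) ++ C → lookup (twist c u ρ) z ≡ lookup ρ z
      fresh = twist-fresh ρ (Unique-resp-↭ (prep c (merge-↭ M O₁ K₁ u K₂ O₂)) (notation-unique perm))

    mark-at : ∀ {ρ} O₁ K₁ c K₂ O₂ → CycleNotation ρ (O₁ ++ (K₁ ++ c ∷ K₂) ∷ O₂) → Marked ρ c (K₂ ++ K₁) (O₁ ++ O₂)
    mark-at {ρ} O₁ K₁ c K₂ O₂ (cyc , perm) with AllP.++⁻ʳ O₁ cyc
    ... | r ∷ cyc₂ = IsCycle-rotate K₁ c K₂ r , AllP.++⁺ (AllP.++⁻ˡ O₁ cyc) cyc₂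
      , ↭-trans (↭-sym (↭-trans (extract-↭ O₁ (K₁ ++ c ∷ K₂) O₂) (↭-trans (cut-↭ K₁ c K₂ (concat (O₁ ++ O₂)))
          (prep c (↭-reflexive (sym (LP.++-assoc K₂ K₁ _))))))) perm

    find-cycle : ∀ {u : Fin n} Os → u ∈ concat Os →
      ∃ λ O₁ → ∃ λ K₁ → ∃ λ K₂ → ∃ λ O₂ → Os ≡ O₁ ++ (K₁ ++ u ∷ K₂) ∷ O₂
    find-cycle Os u∈ with ∈-concat⁻′ Os u∈
    ... | K , u∈K , K∈ with ∈-∃++ u∈K | ∈-∃++ K∈
    ... | K₁ , K₂ , refl | O₁ , O₂ , refl = O₁ , K₁ , K₂ , O₂ , refl

    mark : ∀ {ρ cs} c → CycleNotation ρ cs → ∃₂ λ M Os → Marked ρ c M Os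
    mark {ρ} {cs} c cn@(_ , perm) with find-cycle cs (∈-resp-↭ (↭-sym perm) (∈-allFin c))
    ... | O₁ , K₁ , K₂ , O₂ , refl = K₂ ++ K₁ , O₁ ++ O₂ , mark-at O₁ K₁ c K₂ O₂ cn

    twist-notation : ∀ {ρ cs c u} → c ≢ u → CycleNotation ρ cs → ∃ λ cs′ → CycleNotation (twist c u ρ) cs′
    twist-notation {c = c} {u} c≢u cn with mark c cn
    ... | M , Os , mk@(_ , _ , perm) with ∈-resp-↭ (↭-sym perm) (∈-allFin u)
    ... | here u≡c = ⊥-elim (c≢u (sym u≡c))
    ... | there u∈ with ∈-++⁻ M u∈
    ... | inj₁ u∈M with ∈-∃++ u∈M
    ...   | L₁ , L₂ , refl = _ , unmark (cut L₁ L₂ mk)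
    twist-notation {c = c} {u} c≢u cn | M , Os , mk | there u∈ | inj₂ u∈O with find-cycle Os u∈O
    ...   | O₁ , K₁ , K₂ , O₂ , refl = _ , unmark (merge O₁ O₂ K₁ K₂ mk)

    Inj : Map n → Set
    Inj ρ = ∀ i j → lookup ρ i ≡ lookup ρ j → i ≡ j

    IsPerm⇒Inj : ∀ ρ → IsPerm ρ → Inj ρ
    IsPerm⇒Inj ρ p = ⌊⌋-true⁻¹ _ p

    Inj⇒IsPerm : ∀ ρ → Inj ρ → IsPerm ρ
    Inj⇒IsPerm ρ p = ⌊⌋-true _ p

    -- The images form a list without repetitions that is as long as the list of all points.
    Inj⇒surjective : ∀ {ρ} → Inj ρ → ∀ i → ∃ λ j → lookup ρ j ≡ i
    Inj⇒surjective {ρ} inj i with ∈-map⁻ (lookup ρ) (∈-resp-↭ images (∈-allFin i))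
      where
      images : allFin n ↭ map (lookup ρ) (allFin n)
      images = Unique-⊆-length⇒↭ (Unique-map-on (lookup ρ) (λ _ _ → inj _ _) (allFin⁺ n))
        (λ _ → ∈-allFin _) (LP.length-map (lookup ρ) (allFin n))
    ... | j , _ , e = j , sym e

    twist-Inj : ∀ c u {ρ} → Inj ρ → Inj (twist c u ρ)
    twist-Inj c u {ρ} inj i j e = ≡.trans (sym (transpose-inverse u c)) (≡.trans (cong (transpose u c)
      (inj _ _ (≡.trans (sym (lookup-twist c u ρ i)) (≡.trans e (lookup-twist c u ρ j))))) (transpose-inverse u c))

    twist-involutive : ∀ c u ρ → twist u c (twist c u ρ) ≡ ρ
    twist-involutive c u ρ = lookup-ext (λ i → ≡.trans (lookup-twist u c (twist c u ρ) i)
      (≡.trans (lookup-twist c u ρ _) (cong (lookup ρ) (transpose-inverse c u))))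

    -- Orbits need not be traced: ρ is reduced to the identity, whose cycles are singletons, by
    -- transpositions, and these are undone by `twist-notation`. The induction assumes that all
    -- points from d on are fixed.
    notation-exists : ∀ {ρ} → Inj ρ → ∃ λ cs → CycleNotation ρ cs
    notation-exists {ρ} inj = go n ρ inj (λ i n≤i → ⊥-elim (ℕP.<⇒≱ (FinP.toℕ<n i) n≤i))
      where
      go : ∀ d ρ → Inj ρ → (∀ i → d ≤ toℕ i → lookup ρ i ≡ i) → ∃ λ cs → CycleNotation ρ cs
      go zero ρ inj fix = map [_] (allFin n)
        , AllP.map⁺ (All.tabulate (λ {i} _ → fix i z≤n))
        , ↭-reflexive (LP.concat-map-[_] (allFin n))
      go (suc d) ρ inj fix with d ℕP.<? n
      ... | no d≮n = go d ρ inj (λ i d≤i → ⊥-elim (d≮n (ℕP.≤-<-trans d≤i (FinP.toℕ<n i))))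
      ... | yes d<n with Inj⇒surjective {ρ} inj (fromℕ< d<n)
      ... | j , ρj≡i with j Fin.≟ fromℕ< d<n
      ... | yes refl = go d ρ inj fix′
        where
        fix′ : ∀ x → d ≤ toℕ x → lookup ρ x ≡ x
        fix′ x d≤x with ℕP.m≤n⇒m<n∨m≡n d≤x
        ... | inj₁ d<x = fix x d<x
        ... | inj₂ refl = subst (λ y → lookup ρ y ≡ y) (FinP.fromℕ<-toℕ x d<n) ρj≡i
      -- As ρ sends j to i, exchanging the images of i and j fixes i. Points above i differ from
      -- both i and j and stay fixed.
      ... | no j≢i with go d (twist i j ρ) (twist-Inj i j {ρ} inj) fix′
        where
        i = fromℕ< d<n
        fix′ : ∀ x → d ≤ toℕ x → lookup (twist i j ρ) x ≡ x
        fix′ x d≤x with ℕP.m≤n⇒m<n∨m≡n d≤x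
        ... | inj₁ d<x = ≡.trans (twist-other ρ x≢i x≢j) (fix x d<x)
          where
          x≢i : x ≢ i
          x≢i refl = ℕP.<-irrefl (sym (FinP.toℕ-fromℕ< d<n)) d<x
          x≢j : x ≢ j
          x≢j refl = x≢i (≡.trans (sym (fix x d<x)) ρj≡i)
        ... | inj₂ refl = subst (λ y → lookup (twist i j ρ) y ≡ y) (FinP.fromℕ<-toℕ x d<n)
                            (≡.trans (twist-left i j ρ) ρj≡i)
      ... | cs , cn with twist-notation j≢i cn
      ... | cs′ , cn′ = cs′ , subst (λ σ → CycleNotation σ cs′) (twist-involutive (fromℕ< d<n) j ρ) cn′

-- Summing over products of star transpositions.

module StarProducts where

  open import Defs using (Map; cycles; allVecs)
  open RisingFactorials
  open FiniteSums
  open Cycles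
  open import Data.Bool using (Bool; true; false; _∧_; not)
  open import Data.Nat as ℕ using (ℕ; zero; suc; _∸_)
  import Data.Nat.Properties as ℕP
  open import Data.Integer using (ℤ; +_; _+_; _*_; _-_; _^_)
  import Data.Integer.Properties as ℤP
  open import Data.Integer.Tactic.RingSolver using (solve-∀)
  open import Data.Fin as Fin using (Fin)
  open import Data.Vec using (Vec; []; _∷_)
  open import Data.List using (List; []; _∷_; _++_; map; concat; length; [_]; allFin)
  import Data.List.Properties as LP
  open import Data.Nat.ListAction using (sum)
  open import Data.List.Membership.Propositional using (_∈_; _∉_)
  open import Data.List.Membership.Propositional.Properties
  open import Data.List.Relation.Unary.Any using (here; there)
  open import Data.List.Relation.Binary.Permutation.Propositional
  open import Data.Product using (_,_)
  open import Function using (_∘_)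
  open import Relation.Binary.PropositionalEquality as ≡ using (_≡_; _≢_; refl; sym; cong; cong₂; module ≡-Reasoning)

  when-∧ : ∀ a b z → when (a ∧ b) z ≡ when a (when b z)
  when-∧ true  b z = refl
  when-∧ false b z = refl

  module _ {X : Set} where

    sumOver-when : ∀ b (xs : List X) φ → sumOver xs (λ x → when b (φ x)) ≡ when b (sumOver xs φ)
    sumOver-when true  xs φ = refl
    sumOver-when false xs φ = sumOver-0 xs

    sumOver-const : ∀ (p : X → Bool) (K : List X) (φ : X → ℤ) t → (∀ {u} → u ∈ K → p u ≡ true → φ u ≡ t) →
      sumOver K (λ u → when (p u) (φ u)) ≡ + count p K * t
    sumOver-const p []      φ t e = refl
    sumOver-const p (x ∷ K) φ t e with p x in px
    ... | false = ≡.trans (ℤP.+-identityˡ _) (sumOver-const p K φ t (e ∘ there))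
    ... | true  = ≡.trans (cong₂ _+_ (e (here refl) px) (sumOver-const p K φ t (e ∘ there)))
      (≡.trans (lem t (+ count p K)) (cong (_* t) (sym (ℤP.pos-+ 1 (count p K)))))
      where
      lem : ∀ t k → t + k * t ≡ (+ 1 + k) * t
      lem = solve-∀

    -- Only the numbers of selected entries before and after u enter the value, so selected entries
    -- may be replaced by their ranks.
    cutSum : ∀ (p : X → Bool) (L : List X) (φ : X → ℤ) (Θ : ℕ → ℕ → ℤ) →
      (∀ L₁ u L₂ → L ≡ L₁ ++ u ∷ L₂ → p u ≡ true → φ u ≡ Θ (count p L₁) (count p L₂)) →
      sumOver L (λ u → when (p u) (φ u)) ≡ rangeSum (count p L) (λ i → Θ i (count p L ∸ suc i))
    cutSum p []      φ Θ e = refl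
    cutSum p (x ∷ L) φ Θ e with p x in px
    ... | false = ≡.trans (ℤP.+-identityˡ _) (cutSum p L φ Θ (λ L₁ u L₂ eq pu →
            ≡.trans (e (x ∷ L₁) u L₂ (cong (x ∷_) eq) pu)
              (cong (λ k → Θ k (count p L₂)) (skip L₁))))
      where
      skip : ∀ L₁ → count p (x ∷ L₁) ≡ count p L₁
      skip L₁ rewrite px = refl
    ... | true  = ≡.trans (cong₂ _+_ (e [] x L refl px)
        (cutSum p L φ (λ i j → Θ (suc i) j) (λ L₁ u L₂ eq pu →
          ≡.trans (e (x ∷ L₁) u L₂ (cong (x ∷_) eq) pu) (cong (λ k → Θ k (count p L₂)) (keep L₁)))))
        (sym (rangeSum-front (count p L) _))
      where
      keep : ∀ L₁ → count p (x ∷ L₁) ≡ suc (count p L₁)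
      keep L₁ rewrite px = refl

    -- All selected points of one list K give the same value, which is therefore counted `count p K`
    -- times; hence the weight k in `removeSum`.
    mergeSum : ∀ (p : X → Bool) (Os : List (List X)) (φ : X → ℤ) (Θ : ℕ → List ℕ → ℤ) →
      (∀ O₁ K₁ u K₂ O₂ → Os ≡ O₁ ++ (K₁ ++ u ∷ K₂) ∷ O₂ → p u ≡ true →
        φ u ≡ Θ (count p (K₁ ++ u ∷ K₂)) (map (count p) (O₁ ++ O₂))) →
      sumOver (concat Os) (λ u → when (p u) (φ u)) ≡ removeSum (λ k l → + k * Θ k l) (map (count p) Os)
    mergeSum p []       φ Θ e = refl
    mergeSum p (K ∷ Os) φ Θ e = ≡.trans (sumOver-++ K (concat Os) _) (cong₂ _+_
      (sumOver-const p K φ (Θ (count p K) (map (count p) Os)) inK)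
      (mergeSum p Os φ (λ k l → Θ k (count p K ∷ l))
        (λ O₁ K₁ u K₂ O₂ eq pu → e (K ∷ O₁) K₁ u K₂ O₂ (cong (K ∷_) eq) pu)))
      where
      inK : ∀ {u} → u ∈ K → p u ≡ true → φ u ≡ Θ (count p K) (map (count p) Os)
      inK {u} u∈ pu with ∈-∃++ u∈
      ... | K₁ , K₂ , refl = e [] K₁ u K₂ Os refl pu

  module _ {n : ℕ} where

    remove : Fin n → (Fin n → Bool) → Fin n → Bool
    remove u p x = p x ∧ not (⌊ x Fin.≟ u ⌋)
      where open import Relation.Nullary.Decidable using (⌊_⌋)

    remove-self : ∀ u p → remove u p u ≡ false
    remove-self u p rewrite ⌊⌋-true (u Fin.≟ u) refl with p u
    ... | true  = refl
    ... | false = refl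

    remove-other : ∀ {u x} p → x ≢ u → remove u p x ≡ p x
    remove-other {u} {x} p x≢u rewrite ⌊⌋-false (x Fin.≟ u) x≢u with p x
    ... | true  = refl
    ... | false = refl

    count-remove : ∀ {u} p L → u ∉ L → count (remove u p) L ≡ count p L
    count-remove {u} p L u∉ = count-cong _ _ L (λ x∈ → remove-other p (λ { refl → u∉ x∈ }))

    count-removed : ∀ u p L → count (remove u p) (u ∷ L) ≡ count (remove u p) L
    count-removed u p L rewrite remove-self u p = refl

    count-take : ∀ u (p : Fin n → Bool) L → p u ≡ true → count p (u ∷ L) ≡ suc (count p L)
    count-take u p L e rewrite e = refl

    counts-remove : ∀ {u} p Os → u ∉ concat Os → map (count (remove u p)) Os ≡ map (count p) Os
    counts-remove p []       u∉ = refl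
    counts-remove p (K ∷ Os) u∉ = cong₂ _∷_ (count-remove p K (u∉ ∘ ∈-++⁺ˡ)) (counts-remove p Os (u∉ ∘ ∈-++⁺ʳ K))

    admissible : (Fin n → Bool) → ∀ {k} → Vec (Fin n) k → Bool
    admissible p []      = true
    admissible p (u ∷ w) = p u ∧ admissible (remove u p) w

    -- star c (u₁ ∷ u₂ ∷ ⋯ ∷ uₖ) id is the cycle (c uₖ ⋯ u₂ u₁), products being taken from left to right.
    star : Fin n → ∀ {k} → Vec (Fin n) k → Map n → Map n
    star c []      ρ = ρ
    star c (u ∷ w) ρ = star c w (twist c u ρ)

    sumVecs-suc : ∀ k (φ : Vec (Fin n) (suc k) → ℤ) →
      sumOver (allVecs n (suc k)) φ ≡ sumOver (allFin n) (λ u → sumOver (allVecs n k) (λ w → φ (u ∷ w)))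
    sumVecs-suc k φ = ≡.trans (sumOver-concatMap _ (allVecs n k) φ) (≡.trans
      (sumOver-cong (allVecs n k) (λ w → sumOver-map (_∷ w) (allFin n) φ))
      (sumOver-swap (allVecs n k) (allFin n) (λ w u → φ (u ∷ w))))

    diff-zeros : ∀ q m x l → sum l ≡ 0 → diff q m x l ≡ q ^ length l * rise m x
    diff-zeros q m x []         e = sym (ℤP.*-identityˡ _)
    diff-zeros q m x (zero ∷ l) e = ≡.trans (cong (q *_) (diff-zeros q m x l e)) (sym (ℤP.*-assoc q _ _))

    module _ (q : ℤ) (c : Fin n) where

      starSum : (Fin n → Bool) → ℕ → Map n → ℤ
      starSum p k ρ = sumOver (allVecs n k) (λ w → when (admissible p w) (q ^ cycles (star c w ρ)))

      starSum-suc : ∀ p k ρ → starSum p (suc k) ρ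
        ≡ sumOver (allFin n) (λ u → when (p u) (starSum (remove u p) k (twist c u ρ)))
      starSum-suc p k ρ = ≡.trans (sumVecs-suc k _) (sumOver-cong (allFin n) (λ u → ≡.trans
        (sumOver-cong (allVecs n k) (λ w → when-∧ (p u) _ _)) (sumOver-when (p u) (allVecs n k) _)))

      -- Here k unvisited points remain. Splitting off the first letter u gives a cut or a merge,
      -- the induction hypothesis applies to the new marking, and `diff-recurrence` adds up the
      -- results; k is then cancelled for k > 0. The `suc` in the first part counts c, although c
      -- itself is never chosen.
      starSum-diff : ∀ k p {ρ M Os} → Marked ρ c M Os → p c ≡ false → k ≡ count p (M ++ concat Os) →
        + suc k * + suc (suc k) * starSum p k ρ ≡ diff q (suc (suc k)) q (suc (count p M) ∷ map (count p) Os)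
      starSum-diff zero p {ρ} {M} {Os} mk pc eq = begin
        + 1 * + 2 * (q ^ cycles ρ + + 0)
          ≡⟨ cong (λ j → + 1 * + 2 * (q ^ j + + 0)) (cycles-length (unmark mk)) ⟩
        + 1 * + 2 * (q * q ^ length Os + + 0)
          -- With nothing left to visit, the other cycles are parts 0 and supply q each; the part 1
          -- of c gives q(q + 1) - (q - 1)q = 2q, which explains the factor 1 · 2.
          ≡⟨ lem q (q ^ length Os) ⟩
        q ^ length Os * rise 2 q - q ^ length Os * rise 2 (q - + 1)
          ≡⟨ cong (λ j → q ^ j * rise 2 q - q ^ j * rise 2 (q - + 1)) (sym (LP.length-map (count p) Os)) ⟩
        q ^ length l * rise 2 q - q ^ length l * rise 2 (q - + 1)
          ≡⟨ cong₂ _-_ (sym (diff-zeros q 2 q l zeros)) (sym (diff-zeros q 2 (q - + 1) l zeros)) ⟩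
        diff q 2 q l - diff q 2 (q - + 1) l
          ≡⟨ cong (λ a → diff q 2 q (suc a ∷ l)) (sym zeroM) ⟩
        diff q 2 q (suc (count p M) ∷ l) ∎
        where
        open ≡-Reasoning
        l = map (count p) Os
        split : count p M ℕ.+ sum l ≡ 0
        split = sym (≡.trans eq (≡.trans (count-++ p M (concat Os)) (cong (count p M ℕ.+_) (count-concat p Os))))
        zeroM : count p M ≡ 0
        zeroM = ℕP.m+n≡0⇒m≡0 (count p M) split
        zeros : sum l ≡ 0
        zeros = ℕP.m+n≡0⇒n≡0 (count p M) split
        lem : ∀ q z → + 1 * + 2 * (q * z + + 0)
            ≡ z * (+ 1 * (q + + 0) * (q + + 1)) - z * (+ 1 * (q - + 1 + + 0) * (q - + 1 + + 1))
        lem = solve-∀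
      starSum-diff (suc k) p {ρ} {M} {Os} mk@(_ , _ , perm) pc eq = ℤP.*-cancelˡ-≡ (+ suc k) _ _ (begin
        + suc k * (+ suc (suc k) * + suc (suc (suc k)) * S)
          ≡⟨ lem₁ (+ suc k) (+ suc (suc k)) (+ suc (suc (suc k))) S ⟩
        + suc (suc (suc k)) * (+ suc k * + suc (suc k) * S)
          ≡⟨ cong (+ suc (suc (suc k)) *_) expand ⟩
        + suc (suc (suc k)) * (removeSum (λ j l′ → + j * diff q (suc (suc k)) q ((a ℕ.+ j) ∷ l′)) l
                               + rangeSum a (λ i → diff q (suc (suc k)) q ((a ∸ i) ∷ i ∷ l)))
          ≡⟨ sym (diff-recurrence q l a (suc k) total) ⟩
        + suc k * diff q (suc (suc (suc k))) q (suc a ∷ l) ∎)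
        where
        open ≡-Reasoning
        a = count p M
        l = map (count p) Os
        S = starSum p (suc k) ρ
        total : suc k ≡ a ℕ.+ sum l
        total = ≡.trans eq (≡.trans (count-++ p M (concat Os)) (cong (a ℕ.+_) (count-concat p Os)))
        lem₁ : ∀ x y z s → x * (y * z * s) ≡ z * (x * y * s)
        lem₁ = solve-∀
        Y : Fin n → ℤ
        Y u = + suc k * + suc (suc k) * starSum (remove u p) k (twist c u ρ)
        remaining : ∀ {u rest M′ Os′} → M ++ concat Os ↭ u ∷ rest → M′ ++ concat Os′ ↭ u ∷ rest → p u ≡ true →
          u ∉ rest → k ≡ count (remove u p) (M′ ++ concat Os′)
        remaining {u} {rest} p₁ p₂ pu u∉ = ℕP.suc-injective (≡.trans eq (≡.trans (count-↭ p p₁) (≡.trans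
          (count-take u p rest pu) (cong suc (sym (≡.trans (count-↭ (remove u p) p₂)
            (≡.trans (count-removed u p rest) (count-remove p rest u∉))))))))
        absent : ∀ {u rest} → M ++ concat Os ↭ u ∷ rest → u ∉ rest
        absent p₁ = Unique-head (Unique-++ʳ [ c ] (Unique-resp-↭ (prep c p₁) (notation-unique perm)))
        pc′ : ∀ u → remove u p c ≡ false
        pc′ u rewrite pc = refl
        -- The new cycle starts with u, but u has just been visited: it contributes only the
        -- unvisited points of L₁, possibly none.
        atCut : ∀ L₁ u L₂ → M ≡ L₁ ++ u ∷ L₂ → p u ≡ true →
          Y u ≡ diff q (suc (suc k)) q (suc (count p L₂) ∷ count p L₁ ∷ l)
        atCut L₁ u L₂ refl pu = ≡.trans
          (starSum-diff k (remove u p) (cut L₁ L₂ mk) (pc′ u) (remaining {M′ = L₂} {Os′ = (u ∷ L₁) ∷ Os} p₁ (shift u L₂ _) pu u∉))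
          (cong₂ (λ x y → diff q (suc (suc k)) q (suc x ∷ y))
            (count-remove p L₂ (u∉ ∘ ∈-++⁺ˡ))
            (cong₂ _∷_ (≡.trans (count-removed u p L₁) (count-remove p L₁ (u∉ ∘ ∈-++⁺ʳ L₂ ∘ ∈-++⁺ˡ)))
              (counts-remove p Os (u∉ ∘ ∈-++⁺ʳ L₂ ∘ ∈-++⁺ʳ L₁))))
          where
          open import Data.List.Relation.Binary.Permutation.Propositional.Properties using (shift)
          p₁ = cut-↭ L₁ u L₂ (concat Os)
          u∉ = absent p₁
        atMerge : ∀ O₁ K₁ u K₂ O₂ → Os ≡ O₁ ++ (K₁ ++ u ∷ K₂) ∷ O₂ → p u ≡ true →
          Y u ≡ diff q (suc (suc k)) q ((a ℕ.+ count p (K₁ ++ u ∷ K₂)) ∷ map (count p) (O₁ ++ O₂))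
        atMerge O₁ K₁ u K₂ O₂ refl pu = ≡.trans
          (starSum-diff k (remove u p) (merge O₁ O₂ K₁ K₂ mk) (pc′ u)
            (remaining {M′ = (K₂ ++ K₁) ++ u ∷ M} {Os′ = O₁ ++ O₂} p₁ (cut-↭ (K₂ ++ K₁) u M (concat (O₁ ++ O₂))) pu u∉))
          (cong₂ (λ x y → diff q (suc (suc k)) q (x ∷ y)) size
            (counts-remove p (O₁ ++ O₂) (u∉ ∘ ∈-++⁺ʳ M ∘ ∈-++⁺ʳ (K₂ ++ K₁))))
          where
          p₁ = merge-↭ M O₁ K₁ u K₂ O₂
          u∉ = absent p₁
          -- The merged cycle loses u as an unvisited point, and the extra unit for c makes up for
          -- it.
          size : suc (count (remove u p) ((K₂ ++ K₁) ++ u ∷ M)) ≡ a ℕ.+ count p (K₁ ++ u ∷ K₂)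
          size = begin
            suc (count (remove u p) ((K₂ ++ K₁) ++ u ∷ M))
              ≡⟨ cong suc (≡.trans (count-++ (remove u p) (K₂ ++ K₁) (u ∷ M)) (cong₂ ℕ._+_
                   (count-remove p (K₂ ++ K₁) (u∉ ∘ ∈-++⁺ʳ M ∘ ∈-++⁺ˡ))
                   (≡.trans (count-removed u p M) (count-remove p M (u∉ ∘ ∈-++⁺ˡ))))) ⟩
            suc (count p (K₂ ++ K₁)) ℕ.+ a
              ≡⟨ cong (ℕ._+ a) (sym (count-take u p (K₂ ++ K₁) pu)) ⟩
            count p (u ∷ K₂ ++ K₁) ℕ.+ a
              ≡⟨ cong (ℕ._+ a) (count-↭ p (++-comm (u ∷ K₂) K₁)) ⟩
            count p (K₁ ++ u ∷ K₂) ℕ.+ a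
              ≡⟨ ℕP.+-comm _ a ⟩
            a ℕ.+ count p (K₁ ++ u ∷ K₂) ∎
            where open import Data.List.Relation.Binary.Permutation.Propositional.Properties using (++-comm)
        expand : + suc k * + suc (suc k) * S
          ≡ removeSum (λ j l′ → + j * diff q (suc (suc k)) q ((a ℕ.+ j) ∷ l′)) l
            + rangeSum a (λ i → diff q (suc (suc k)) q ((a ∸ i) ∷ i ∷ l))
        expand = begin
          r * S
            ≡⟨ cong (r *_) (starSum-suc p k ρ) ⟩
          r * sumOver (allFin n) (λ u → when (p u) (starSum (remove u p) k (twist c u ρ)))
            ≡⟨ sumOver-* r (allFin n) _ ⟩
          sumOver (allFin n) (λ u → r * when (p u) (starSum (remove u p) k (twist c u ρ)))
            ≡⟨ sumOver-cong (allFin n) (λ u → *-when (p u) r _) ⟩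
          sumOver (allFin n) ψ
            ≡⟨ sumOver-↭ ψ (↭-sym perm) ⟩
          ψ c + sumOver (M ++ concat Os) ψ
            ≡⟨ cong₂ _+_ ψc (sumOver-++ M (concat Os) ψ) ⟩
          + 0 + (sumOver M ψ + sumOver (concat Os) ψ)
            ≡⟨ cong₂ (λ x y → + 0 + (x + y))
                 (≡.trans (cutSum p M Y (λ i j → diff q (suc (suc k)) q (suc j ∷ i ∷ l)) atCut) (rangeSum-cong a (λ i i<a →
                   cong (λ z → diff q (suc (suc k)) q (z ∷ i ∷ l)) (sym (ℕP.+-∸-assoc 1 i<a)))))
                 (mergeSum p Os Y _ atMerge) ⟩
          + 0 + (rangeSum a (λ i → diff q (suc (suc k)) q ((a ∸ i) ∷ i ∷ l))
            + removeSum (λ j l′ → + j * diff q (suc (suc k)) q ((a ℕ.+ j) ∷ l′)) l)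
            ≡⟨ ≡.trans (ℤP.+-identityˡ _) (ℤP.+-comm (rangeSum a _) _) ⟩
          _ ∎
          where
          r = + suc k * + suc (suc k)
          ψ : Fin n → ℤ
          ψ u = when (p u) (Y u)
          ψc : ψ c ≡ + 0
          ψc rewrite pc = refl
          *-when : ∀ b r z → r * when b z ≡ when b (r * z)
          *-when true  r z = refl
          *-when false r z = ℤP.*-zeroʳ r

-- Long cycles as words of star transpositions; Stanley's formula.

module LongCycles where

  open import Defs using (Map; _·_; cycles; allVecs; isPermᵇ; isNCycleᵇ; IsPerm; IsNCycle; nontrivialCycles)
  open RisingFactorials
  open FiniteSums
  open Cycles
  open StarProducts
  open import Data.Bool using (Bool; true; false; _∧_)
  open import Data.Bool.Properties using (T-≡)
  open import Data.Nat as ℕ using (ℕ; zero; suc; _≤_; s≤s)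
  import Data.Nat.Properties as ℕP
  open import Data.Integer using (ℤ; +_; _+_; _*_; _^_)
  open import Data.Fin as Fin using (Fin)
  open import Data.Vec as Vec using (Vec; []; _∷_; lookup; tabulate; toList; fromList)
  import Data.Vec.Properties as VP
  open import Data.List as List using (List; []; _∷_; _++_; map; concat; concatMap; length; [_]; allFin; _ʳ++_; reverse; filterᵇ)
  import Data.List.Properties as LP
  open import Data.Nat.ListAction using (sum)
  open import Data.List.Membership.Propositional using (_∈_; _∉_)
  open import Data.List.Membership.Propositional.Properties
  open import Data.List.Relation.Unary.Any using (here; there)
  open import Data.List.Relation.Unary.All using (All; []; _∷_)
  open import Data.List.Relation.Unary.AllPairs using ([]; _∷_)
  open import Data.List.Relation.Unary.Unique.Propositional using (Unique)
  open import Data.List.Relation.Unary.Unique.Propositional.Properties using (allFin⁺; map⁺; ++⁺; filter⁺)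
  open import Data.List.Relation.Binary.Permutation.Propositional
  open import Data.List.Relation.Binary.Permutation.Propositional.Properties using (∈-resp-↭; ↭-reverse)
  open import Data.Product using (∃; ∃₂; _×_; _,_; proj₁; proj₂)
  open import Data.Empty using (⊥; ⊥-elim)
  open import Function using (_∘_; id)
  open import Function.Bundles using (Equivalence)
  open import Relation.Nullary.Decidable using (T?)
  open import Relation.Binary.PropositionalEquality as ≡ using (_≡_; _≢_; refl; sym; cong; cong₂; subst; module ≡-Reasoning)

  ∧-true⁻¹ : ∀ a {b} → a ∧ b ≡ true → a ≡ true × b ≡ true
  ∧-true⁻¹ true e = refl , e

  module _ {n : ℕ} where

    allVecs-complete : ∀ {k} (w : Vec (Fin n) k) → w ∈ allVecs n k
    allVecs-complete []      = here refl
    allVecs-complete (u ∷ w) = ∈-concat⁺′ (∈-map⁺ (_∷ w) (∈-allFin u)) (∈-map⁺ _ (allVecs-complete w))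

    allVecs-unique : ∀ k → Unique (allVecs n k)
    allVecs-unique zero    = [] ∷ []
    allVecs-unique (suc k) = go (allVecs n k) (allVecs-unique k)
      where
      heads : Vec (Fin n) k → List (Vec (Fin n) (suc k))
      heads w = map (_∷ w) (allFin n)
      tail∈ : ∀ {x : Vec (Fin n) (suc k)} ws → x ∈ concatMap heads ws → Vec.tail x ∈ ws
      tail∈ ws x∈ with ∈-concat⁻′ (map heads ws) x∈
      ... | xs , x∈xs , xs∈ with ∈-map⁻ heads xs∈
      ... | w , w∈ , refl with ∈-map⁻ (_∷ w) x∈xs
      ... | u , _ , refl = w∈
      go : ∀ ws → Unique ws → Unique (concatMap heads ws)
      go []       _            = []
      go (w ∷ ws) un@(_ ∷ un′) = ++⁺ (map⁺ (cong Vec.head) (allFin⁺ n)) (go ws un′) disjoint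
        where
        disjoint : ∀ {x} → x ∈ heads w × x ∈ concatMap heads ws → ⊥
        disjoint (x∈ , x∈′) with ∈-map⁻ (_∷ w) x∈
        ... | u , _ , refl = Unique-head un (tail∈ ws x∈′)

    remove-false : ∀ u (p : Fin n → Bool) x → p x ≡ false → remove u p x ≡ false
    remove-false u p x e rewrite e = refl

    remove-true⁻¹ : ∀ u (p : Fin n → Bool) x → remove u p x ≡ true → p x ≡ true × x ≢ u
    remove-true⁻¹ u p x e = proj₁ (∧-true⁻¹ (p x) e) , λ { refl → false≢true (≡.trans (sym (remove-self u p)) e) }
      where
      false≢true : false ≢ true
      false≢true ()

    true≢false : ∀ {b} → b ≡ true → b ≢ false
    true≢false refl ()

    star-Inj : ∀ c {k} (w : Vec (Fin n) k) {ρ} → Inj ρ → Inj (star c w ρ)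
    star-Inj c []          inj = inj
    star-Inj c (u ∷ w) {ρ} inj = star-Inj c w {twist c u ρ} (twist-Inj c u {ρ} inj)

    -- Each factor (c u) with u a new fixed point inserts u right behind c.
    star-Path : ∀ c {k} (w : Vec (Fin n) k) p ρ M → admissible p w ≡ true → p c ≡ false → c ∉ M →
      (∀ {x} → x ∈ M → p x ≡ false) → (∀ x → p x ≡ true → lookup ρ x ≡ x) →
      Path ρ c M c → Path (star c w ρ) c (toList w ʳ++ M) c
    star-Path c []      p ρ M adm pc c∉ vis fix path = path
    star-Path c (u ∷ w) p ρ M adm pc c∉ vis fix path with ∧-true⁻¹ (p u) adm
    ... | pu , adm′ = star-Path c w (remove u p) (twist c u ρ) (u ∷ M) adm′ (remove-false u p c pc)
        (λ { (here c≡u) → u≢c (sym c≡u) ; (there c∈) → c∉ c∈ })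
        (λ { (here refl) → remove-self u p ; (there x∈) → remove-false u p _ (vis x∈) })
        (λ x px → let px′ , x≢u = remove-true⁻¹ u p x px in
          ≡.trans (twist-other ρ (λ { refl → true≢false px′ pc }) x≢u) (fix x px′))
        ( ≡.trans (twist-left c u ρ) (fix u pu)
        , Path-transfer M (twist-right c u ρ)
            (λ z∈ → twist-other ρ (λ { refl → c∉ z∈ }) (λ { refl → true≢false pu (vis z∈) })) path)
      where
      u≢c : u ≢ c
      u≢c refl = true≢false pu pc

    admissible-Unique : ∀ c {k} (w : Vec (Fin n) k) p M → admissible p w ≡ true →
      (∀ {x} → x ∈ c ∷ M → p x ≡ false) → Unique (c ∷ M) → Unique (c ∷ (toList w ʳ++ M))
    admissible-Unique c []      p M adm vis un = un
    admissible-Unique c (u ∷ w) p M adm vis un with ∧-true⁻¹ (p u) adm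
    ... | pu , adm′ = admissible-Unique c w (remove u p) (u ∷ M) adm′
        (λ { (here refl) → remove-false u p _ (vis (here refl)) ; (there (here refl)) → remove-self u p
           ; (there (there x∈)) → remove-false u p _ (vis (there x∈)) })
        (Unique-resp-↭ (swap u c refl) (Unique-∷ (λ u∈ → true≢false pu (vis u∈)) un))

    Unique-admissible : ∀ {k} (w : Vec (Fin n) k) p → Unique (toList w) → (∀ {x} → x ∈ toList w → p x ≡ true) →
      admissible p w ≡ true
    Unique-admissible []      p un         all = refl
    Unique-admissible (u ∷ w) p un@(_ ∷ un′) all rewrite all (here refl) = Unique-admissible w (remove u p) un′
      (λ x∈ → ≡.trans (remove-other p (λ { refl → Unique-head un x∈ })) (all (there x∈)))

    idMap : Map n
    idMap = tabulate id

    -- Star factors act from the left and π from the right. Hence the sum over ζπ is a sum of star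
    -- products that start from π instead of the identity.
    star-· : ∀ c {k} (w : Vec (Fin n) k) ρ π → star c w ρ · π ≡ star c w (ρ · π)
    star-· c []      ρ π = refl
    star-· c (u ∷ w) ρ π = ≡.trans (star-· c w (twist c u ρ) π) (cong (star c w) (lookup-ext (λ i →
      ≡.trans (VP.lookup∘tabulate _ i) (≡.trans (cong (lookup π) (lookup-twist c u ρ i))
        (sym (≡.trans (lookup-twist c u (ρ · π) i) (VP.lookup∘tabulate _ (transpose c u i))))))))
      where open import Data.Fin.Permutation.Components using (transpose)

    idMap-· : ∀ π → idMap · π ≡ π
    idMap-· π = lookup-ext (λ i → ≡.trans (VP.lookup∘tabulate _ i) (cong (lookup π) (VP.lookup∘tabulate id i)))

  toVec : {X : Set} (L : List X) {k : ℕ} → length L ≡ k → ∃ λ (w : Vec X k) → toList w ≡ L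
  toVec L refl = fromList L , VP.toList∘fromList L

  ∈-filterᵇ⁺ : {X : Set} (p : X → Bool) {xs : List X} {x : X} → x ∈ xs → p x ≡ true → x ∈ filterᵇ p xs
  ∈-filterᵇ⁺ p x∈ px = ∈-filter⁺ (T? ∘ p) x∈ (Equivalence.from T-≡ px)

  ∈-filterᵇ⁻ : {X : Set} (p : X → Bool) (xs : List X) {x : X} → x ∈ filterᵇ p xs → p x ≡ true
  ∈-filterᵇ⁻ p xs x∈ = Equivalence.to T-≡ (proj₂ (∈-filter⁻ (T? ∘ p) {xs = xs} x∈))

  module _ {m : ℕ} (c : Fin (suc m)) where

    private
      N = suc m
      avail : Fin N → Bool
      avail = remove c (λ _ → true)
      avail-c : avail c ≡ false
      avail-c = remove-self c (λ _ → true)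

    fromWord : Vec (Fin N) m → Map N
    fromWord w = star c w idMap

    private
      word-Path : ∀ w → admissible avail w ≡ true → Path (fromWord w) c (reverse (toList w)) c
      word-Path w adm = star-Path c w avail idMap [] adm avail-c (λ ()) (λ ())
        (λ x _ → VP.lookup∘tabulate id x) (VP.lookup∘tabulate id c)

      word-length : ∀ (w : Vec (Fin N) m) → length (reverse (toList w)) ≡ m
      word-length w = ≡.trans (LP.length-reverse (toList w)) (VP.length-toList w)

      word-Marked : ∀ w → admissible avail w ≡ true → Marked (fromWord w) c (reverse (toList w)) []
      word-Marked w adm = word-Path w adm , []
        , ↭-trans (↭-reflexive (cong (c ∷_) (LP.++-identityʳ _)))
            (↭-sym (Unique-⊆-length⇒↭ (admissible-Unique c w avail [] adm (λ { (here refl) → avail-c }) ([] ∷ []))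
              (λ _ → ∈-allFin _) (≡.trans (cong suc (word-length w)) (sym (LP.length-tabulate id)))))

      word-NCycle : ∀ w → admissible avail w ≡ true → IsNCycle (fromWord w)
      word-NCycle w adm = cong₂ _∧_
        (Inj⇒IsPerm (fromWord w) (star-Inj c w {idMap} (λ i j e → ≡.trans (sym (VP.lookup∘tabulate id i))
          (≡.trans e (VP.lookup∘tabulate id j)))))
        (⌊⌋-true (cycles (fromWord w) ℕ.≟ 1) (cycles-length (unmark (word-Marked w adm))))

      -- The word can be read off from the permutation: it is the cycle written from c, reversed.
      word-injective : ∀ w w′ → admissible avail w ≡ true → admissible avail w′ ≡ true →
        fromWord w ≡ fromWord w′ → w ≡ w′
      word-injective w w′ adm adm′ e = ≡.trans (sym (VP.cast-is-id refl w)) (VP.toList-injective refl w w′ (LP.reverse-injective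
        (Path-unique _ _ (≡.trans (word-length w) (sym (word-length w′))) (word-Path w adm)
          (subst (λ ρ → Path ρ c (reverse (toList w′)) c) (sym e) (word-Path w′ adm′)))))

    NCycle-Marked : ∀ ζ → IsNCycle ζ → ∃ λ M → Marked ζ c M []
    NCycle-Marked ζ nc = single (mark c (proj₂ (notation-exists {ρ = ζ} (IsPerm⇒Inj ζ (proj₁ parts)))))
      where
      parts = ∧-true⁻¹ (isPermᵇ ζ) nc
      single : (∃₂ λ M Os → Marked ζ c M Os) → ∃ λ M → Marked ζ c M []
      single (M , []     , mk) = M , mk
      single (M , K ∷ Os , mk) = ⊥-elim (ℕP.1+n≢0 (ℕP.suc-injective
        (≡.trans (sym (cycles-length (unmark mk))) (⌊⌋-true⁻¹ (cycles ζ ℕ.≟ 1) (proj₂ parts)))))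

    private
      -- Later letters are inserted closer to c, so the word for ζ is its cycle behind c in reverse
      -- order. Both permutations follow the same path through all points, hence are equal.
      word-surjective : ∀ ζ → IsNCycle ζ → ∃ λ w → admissible avail w ≡ true × fromWord w ≡ ζ
      word-surjective ζ nc = build (NCycle-Marked ζ nc)
        where
        build : (∃ λ M → Marked ζ c M []) → ∃ λ w → admissible avail w ≡ true × fromWord w ≡ ζ
        build (M , path , _ , perm′) = w , adm ,
            lookup-ext (λ i → Path-determines M path′ path (∈-resp-↭ (↭-sym perm) (∈-allFin i)))
          where
          perm : c ∷ M ↭ allFin N
          perm = ↭-trans (↭-reflexive (cong (c ∷_) (sym (LP.++-identityʳ M)))) perm′
          vec : ∃ λ (w : Vec (Fin N) m) → toList w ≡ reverse M
          vec = toVec (reverse M) (≡.trans (LP.length-reverse M) (ℕP.suc-injective (notation-length perm)))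
          w = proj₁ vec
          un : Unique (c ∷ reverse M)
          un = Unique-resp-↭ (prep c (↭-sym (↭-reverse M))) (notation-unique perm)
          adm : admissible avail w ≡ true
          adm = Unique-admissible w avail (subst Unique (sym (proj₂ vec)) (Unique-++ʳ [ c ] un))
            (λ x∈ → remove-other (λ _ → true) (λ { refl → Unique-head un (subst (c ∈_) (proj₂ vec) x∈) }))
          path′ : Path (fromWord w) c M c
          path′ = subst (λ L → Path (fromWord w) c L c)
            (≡.trans (cong reverse (proj₂ vec)) (LP.reverse-involutive M)) (word-Path w adm)

    -- A change of variables: the duplicate-free list of n-cycles and the list of images of the
    -- admissible words have the same members.
    sum-NCycles : ∀ (φ : Map N → ℤ) → sumOver (allVecs N N) (λ ζ → when (isNCycleᵇ ζ) (φ ζ))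
      ≡ sumOver (allVecs N m) (λ w → when (admissible avail w) (φ (fromWord w)))
    sum-NCycles φ = begin
      sumOver (allVecs N N) (λ ζ → when (isNCycleᵇ ζ) (φ ζ))  ≡⟨ sym (sumOver-filterᵇ isNCycleᵇ (allVecs N N) φ) ⟩
      sumOver (filterᵇ isNCycleᵇ (allVecs N N)) φ             ≡⟨ sumOver-↭ φ same ⟩
      sumOver (map fromWord words) φ                          ≡⟨ sumOver-map fromWord words φ ⟩
      sumOver words (φ ∘ fromWord)                            ≡⟨ sumOver-filterᵇ (admissible avail) (allVecs N m) (φ ∘ fromWord) ⟩
      sumOver (allVecs N m) (λ w → when (admissible avail w) (φ (fromWord w))) ∎
      where
      open ≡-Reasoning
      words = filterᵇ (admissible avail) (allVecs N m)
      ok : ∀ {w} → w ∈ words → admissible avail w ≡ true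
      ok = ∈-filterᵇ⁻ (admissible avail) (allVecs N m)
      same : filterᵇ isNCycleᵇ (allVecs N N) ↭ map fromWord words
      same = Unique-≈⇒↭
        (Unique-map-on fromWord (λ x∈ y∈ → word-injective _ _ (ok x∈) (ok y∈))
          (filter⁺ (T? ∘ admissible avail) (allVecs-unique m)))
        (filter⁺ (T? ∘ isNCycleᵇ) (allVecs-unique N)) forward backward
        where
        forward : ∀ {ζ} → ζ ∈ map fromWord words → ζ ∈ filterᵇ isNCycleᵇ (allVecs N N)
        forward ζ∈ = let w , w∈ , e = ∈-map⁻ fromWord ζ∈ in subst (_∈ filterᵇ isNCycleᵇ (allVecs N N)) (sym e)
          (∈-filterᵇ⁺ isNCycleᵇ (allVecs-complete (fromWord w)) (word-NCycle w (ok w∈)))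
        backward : ∀ {ζ} → ζ ∈ filterᵇ isNCycleᵇ (allVecs N N) → ζ ∈ map fromWord words
        backward {ζ} ζ∈ = let w , adm , e = word-surjective ζ (∈-filterᵇ⁻ isNCycleᵇ (allVecs N N) ζ∈) in
          subst (_∈ map fromWord words) e
            (∈-map⁺ fromWord (∈-filterᵇ⁺ (admissible avail) (allVecs-complete w) adm))

    -- Stanley's formula for n = m + 1, with its denominator n(n + 1) moved to the left. At the
    -- start every point except c is unvisited, so the parts of `diff` are the cycle lengths of π.
    cycleSum-diff : ∀ q π M Os → Marked π c M Os →
      + suc m * + suc (suc m) * sumOver (allVecs N N) (λ ζ → when (isNCycleᵇ ζ) (q ^ cycles (ζ · π)))
      ≡ diff q (suc (suc m)) q (suc (length M) ∷ map length Os)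
    cycleSum-diff q π M Os mk@(_ , _ , perm) = begin
      r * sumOver (allVecs N N) (λ ζ → when (isNCycleᵇ ζ) (q ^ cycles (ζ · π)))
        ≡⟨ cong (r *_) (sum-NCycles (λ ζ → q ^ cycles (ζ · π))) ⟩
      r * sumOver (allVecs N m) (λ w → when (admissible avail w) (q ^ cycles (fromWord w · π)))
        ≡⟨ cong (r *_) (sumOver-cong (allVecs N m) (λ w → cong (λ ρ → when (admissible avail w) (q ^ cycles ρ))
             (≡.trans (star-· c w idMap π) (cong (star c w) (idMap-· π))))) ⟩
      r * starSum q c avail m π
        ≡⟨ starSum-diff q c m avail mk avail-c
             (sym (≡.trans (counts (M ++ concat Os) (Unique-head un)) (ℕP.suc-injective (notation-length perm)))) ⟩
      diff q (suc (suc m)) q (suc (count avail M) ∷ map (count avail) Os)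
        ≡⟨ cong₂ (λ a l → diff q (suc (suc m)) q (suc a ∷ l)) (counts M (Unique-head un ∘ ∈-++⁺ˡ))
             (countsOs Os (Unique-head un ∘ ∈-++⁺ʳ M)) ⟩
      diff q (suc (suc m)) q (suc (length M) ∷ map length Os) ∎
      where
      open ≡-Reasoning
      r = + suc m * + suc (suc m)
      un = notation-unique perm
      counts : ∀ L → c ∉ L → count avail L ≡ length L
      counts L c∉ = count-all avail L (λ x∈ → remove-other (λ _ → true) (λ { refl → c∉ x∈ }))
      countsOs : ∀ Os → c ∉ concat Os → map (count avail) Os ≡ map length Os
      countsOs []       c∉ = refl
      countsOs (K ∷ Os) c∉ = cong₂ _∷_ (counts K (c∉ ∘ ∈-++⁺ˡ)) (countsOs Os (c∉ ∘ ∈-++⁺ʳ K))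

  module _ {m : ℕ} where

    private
      allTrivial : ∀ {ρ : Map (suc m)} cs → All (IsCycle ρ) cs → sum (map nontrivial cs) ≤ 0 →
                   All (λ K → length K ≡ 1) cs
      allTrivial []                []        le = []
      allTrivial ((x ∷ []) ∷ cs)   (c ∷ cyc) le = refl ∷ allTrivial cs cyc le

      -- The cycle singled out is the first nontrivial one or, for the identity, the last fixed
      -- point, so that the identity is the case of cycle length 1.
      isolate : ∀ {ρ : Map (suc m)} K cs → All (IsCycle ρ) (K ∷ cs) → sum (map nontrivial (K ∷ cs)) ≤ 1 →
        ∃ λ O₁ → ∃ λ x → ∃ λ K′ → ∃ λ O₂ → K ∷ cs ≡ O₁ ++ (x ∷ K′) ∷ O₂ × All (λ K → length K ≡ 1) (O₁ ++ O₂)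
      isolate []       cs        (() ∷ _)  le
      isolate (x ∷ []) []        _         le = [] , x , [] , [] , refl , []
      isolate (x ∷ []) (K ∷ cs)  (_ ∷ cyc) le with isolate K cs cyc le
      ... | O₁ , y , K′ , O₂ , e , triv = (x ∷ []) ∷ O₁ , y , K′ , O₂ , cong ((x ∷ []) ∷_) e , refl ∷ triv
      isolate (x ∷ y ∷ K) cs     (_ ∷ cyc) (s≤s le) = [] , x , y ∷ K , cs , refl , allTrivial cs cyc le

    atMostOne-Marked : ∀ (π : Map (suc m)) → IsPerm π → nontrivialCycles π ≤ 1 →
      ∃ λ c → ∃₂ λ M Os → Marked π c M Os × All (λ K → length K ≡ 1) Os
    atMostOne-Marked π perm le = choose (notation-exists {ρ = π} (IsPerm⇒Inj π perm))
      where
      choose : (∃ λ cs → CycleNotation π cs) → ∃ λ c → ∃₂ λ M Os → Marked π c M Os × All (λ K → length K ≡ 1) Os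
      choose ([] , _ , p) = ⊥-elim (ℕP.1+n≢0 (sym (notation-length p)))
      choose (K ∷ cs , cn@(cyc , _)) =
        let O₁ , x , K′ , O₂ , e , triv = isolate K cs cyc (subst (_≤ 1) (nontrivialCycles-sum cn) le)
        in x , K′ ++ [] , O₁ ++ O₂ , mark-at O₁ [] x K′ O₂ (subst (CycleNotation π) e cn) , triv

-- Coefficients of F for a single nontrivial cycle, and log-concavity.

module Coefficients where

  open import Defs using (Map; _·_; cycles; allVecs; isNCycleᵇ; IsPerm; Fcoeff; LogConcave; nontrivialCycles)
  open RisingFactorials
  open FiniteSums
  open Cycles using (⌊⌋-true; ⌊⌋-false; Marked; notation-length)
  open LongCycles
  open import Data.Bool using (Bool; true; false; if_then_else_; _∧_)
  open import Data.Nat using (ℕ; zero; suc; _+_; _*_; _∸_; _^_; _≤_; _<_; z≤n; s≤s; ⌊_/2⌋; _≟_; NonZero)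
  open import Data.Nat.Properties
  open import Data.Nat.DivMod using (_%_; [m+kn]%n≡m%n; m<n⇒m%n≡m)
  open import Data.Nat.Tactic.RingSolver using () renaming (solve-∀ to ℕ-solve)
  open import Data.Integer as ℤ using (ℤ; +_)
  import Data.Integer.Properties as ℤP
  open import Data.Integer.Tactic.RingSolver using () renaming (solve-∀ to ℤ-solve)
  open import Data.List as List using (List; []; _∷_; _++_; map; length; replicate; allFin)
  import Data.List.Properties as LP
  open import Data.List.Relation.Unary.All using (All; []; _∷_)
  open import Data.Product using (_×_; _,_; proj₁; proj₂)
  open import Data.Sum using (_⊎_; inj₁; inj₂)
  open import Function using (_∘_)
  open import Relation.Nullary using (yes; no)
  open import Relation.Nullary.Decidable using (⌊_⌋)
  open import Relation.Binary.PropositionalEquality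

  eval : ℕ → (ℕ → ℕ) → ℕ → ℕ
  eval zero    a x = 0
  eval (suc d) a x = a 0 + x * eval d (a ∘ suc) x

  shiftUp : (ℕ → ℕ) → ℕ → ℕ
  shiftUp a zero    = 0
  shiftUp a (suc k) = a k

  eval-cong : ∀ d {a b} x → (∀ k → a k ≡ b k) → eval d a x ≡ eval d b x
  eval-cong zero    x e = refl
  eval-cong (suc d) x e = cong₂ (λ u v → u + x * v) (e 0) (eval-cong d x (e ∘ suc))

  eval-+ : ∀ d a b x → eval d (λ k → a k + b k) x ≡ eval d a x + eval d b x
  eval-+ zero    a b x = refl
  eval-+ (suc d) a b x = trans (cong (λ v → a 0 + b 0 + x * v) (eval-+ d (a ∘ suc) (b ∘ suc) x)) (lem (a 0) (b 0) x _ _)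
    where
    lem : ∀ a b x u v → a + b + x * (u + v) ≡ a + x * u + (b + x * v)
    lem = ℕ-solve

  eval-* : ∀ d r a x → eval d (λ k → r * a k) x ≡ r * eval d a x
  eval-* zero    r a x = sym (*-zeroʳ r)
  eval-* (suc d) r a x = trans (cong (λ v → r * a 0 + x * v) (eval-* d r (a ∘ suc) x)) (lem r (a 0) x _)
    where
    lem : ∀ r a x u → r * a + x * (r * u) ≡ r * (a + x * u)
    lem = ℕ-solve

  eval-0 : ∀ d x → eval d (λ _ → 0) x ≡ 0
  eval-0 zero    x = refl
  eval-0 (suc d) x = trans (cong (x *_) (eval-0 d x)) (*-zeroʳ x)

  -- Evaluating beyond both constant terms recovers them as remainders.
  eval-injective : ∀ d a b → (∀ x → eval d a (suc x) ≡ eval d b (suc x)) → ∀ k → k < d → a k ≡ b k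
  eval-injective (suc d) a b e = go
    where
    constant : a 0 ≡ b 0
    constant = begin
      a 0                     ≡⟨ sym (m<n⇒m%n≡m (s≤s (m≤m+n (a 0) (b 0)))) ⟩
      a 0 % X                 ≡⟨ sym ([m+kn]%n≡m%n (a 0) (eval d (a ∘ suc) X) X) ⟩
      (a 0 + eval d (a ∘ suc) X * X) % X ≡⟨ cong (λ z → (a 0 + z) % X) (*-comm _ X) ⟩
      eval (suc d) a X % X    ≡⟨ cong (_% X) (e (a 0 + b 0)) ⟩
      eval (suc d) b X % X    ≡⟨ cong (λ z → (b 0 + z) % X) (*-comm X _) ⟩
      (b 0 + eval d (b ∘ suc) X * X) % X ≡⟨ [m+kn]%n≡m%n (b 0) (eval d (b ∘ suc) X) X ⟩
      b 0 % X                 ≡⟨ m<n⇒m%n≡m (s≤s (m≤n+m (b 0) (a 0))) ⟩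
      b 0                     ∎
      where
      open ≡-Reasoning
      X = suc (a 0 + b 0)
    go : ∀ k → k < suc d → a k ≡ b k
    go zero    _         = constant
    go (suc k) (s≤s k<d) = eval-injective d (a ∘ suc) (b ∘ suc)
      (λ x → *-cancelˡ-≡ _ _ (suc x) (+-cancelˡ-≡ (b 0) _ _ (trans (cong (_+ _) (sym constant)) (e x)))) k k<d

  bit : Bool → ℕ
  bit b = if b then 1 else 0

  eval-monomial : ∀ d f x → f < d → eval d (λ k → bit ⌊ f ≟ k ⌋) x ≡ x ^ f
  eval-monomial (suc d) zero    x _ = cong suc (trans (cong (x *_)
    (trans (eval-cong d x (λ k → cong bit (⌊⌋-false (0 ≟ suc k) (λ ())))) (eval-0 d x))) (*-zeroʳ x))
  eval-monomial (suc d) (suc f) x (s≤s f<d) = cong (x *_) (trans (eval-cong d x (λ k → cong bit (same k))) (eval-monomial d f x f<d))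
    where
    same : ∀ k → ⌊ suc f ≟ suc k ⌋ ≡ ⌊ f ≟ k ⌋
    same k with f ≟ k
    ... | yes refl = ⌊⌋-true (suc k ≟ suc k) refl
    ... | no f≢k   = ⌊⌋-false (suc f ≟ suc k) (f≢k ∘ suc-injective)

  module _ {X : Set} where

    count-∷ : ∀ (p : X → Bool) x xs → count p (x ∷ xs) ≡ bit (p x) + count p xs
    count-∷ p x xs with p x
    ... | true  = refl
    ... | false = refl

    sumOver-eval : ∀ d (p : X → Bool) (f : X → ℕ) → (∀ x → f x < d) → ∀ y xs →
      sumOver xs (λ x → when (p x) ((+ y) ℤ.^ f x)) ≡ + eval d (λ k → count (λ x → p x ∧ ⌊ f x ≟ k ⌋) xs) y
    sumOver-eval d p f f<d y []       = cong +_ (sym (eval-0 d y))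
    sumOver-eval d p f f<d y (x ∷ xs) = begin
      when (p x) ((+ y) ℤ.^ f x) ℤ.+ sumOver xs _
        ≡⟨ cong₂ ℤ._+_ (head (p x)) (sumOver-eval d p f f<d y xs) ⟩
      + eval d (λ k → bit (p x ∧ ⌊ f x ≟ k ⌋)) y ℤ.+ + eval d (λ k → count _ xs) y
        ≡⟨ sym (ℤP.pos-+ (eval d (λ k → bit (p x ∧ ⌊ f x ≟ k ⌋)) y) _) ⟩
      + (eval d (λ k → bit (p x ∧ ⌊ f x ≟ k ⌋)) y + eval d (λ k → count (λ x → p x ∧ ⌊ f x ≟ k ⌋) xs) y)
        ≡⟨ cong +_ (sym (eval-+ d _ _ y)) ⟩
      + eval d (λ k → bit (p x ∧ ⌊ f x ≟ k ⌋) + count (λ x → p x ∧ ⌊ f x ≟ k ⌋) xs) y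
        ≡⟨ cong +_ (eval-cong d y (λ k → sym (count-∷ _ x xs))) ⟩
      + eval d (λ k → count (λ x → p x ∧ ⌊ f x ≟ k ⌋) (x ∷ xs)) y ∎
      where
      open ≡-Reasoning
      pos-^ : ∀ k → (+ y) ℤ.^ k ≡ + (y ^ k)
      pos-^ zero    = refl
      pos-^ (suc k) = trans (cong (+ y ℤ.*_) (pos-^ k)) (sym (ℤP.pos-* y (y ^ k)))
      head : ∀ b → when b ((+ y) ℤ.^ f x) ≡ + eval d (λ k → bit (b ∧ ⌊ f x ≟ k ⌋)) y
      head true  = trans (pos-^ (f x)) (cong +_ (sym (eval-monomial d (f x) y (f<d x))))
      head false = cong +_ (sym (eval-0 d y))

  double : ℕ → ℕ
  double zero    = zero
  double (suc j) = suc (suc (double j))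

  half-double : ∀ j → ⌊ double j /2⌋ ≡ j
  half-double zero    = refl
  half-double (suc j) = cong suc (half-double j)

  half-suc-double : ∀ j → ⌊ suc (double j) /2⌋ ≡ j
  half-suc-double zero    = refl
  half-suc-double (suc j) = cong suc (half-suc-double j)

  half-cases : ∀ f → f ≡ double ⌊ f /2⌋ ⊎ f ≡ suc (double ⌊ f /2⌋)
  half-cases zero          = inj₁ refl
  half-cases (suc zero)    = inj₂ refl
  half-cases (suc (suc f)) with half-cases f
  ... | inj₁ e = inj₁ (cong (suc ∘ suc) e)
  ... | inj₂ e = inj₂ (cong (suc ∘ suc) e)

  -- The exponent j collects the cycle numbers 2j + 1 and 2j + 2. Truncated subtraction also sends f
  -- = 0 to j = 0; that term is carried along until `Fcoeff-paired` shows that its count is 0.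
  bit-half : ∀ f j → bit ⌊ ⌊ f ∸ 1 /2⌋ ≟ j ⌋ ≡
    bit ⌊ f ≟ 0 ⌋ * bit ⌊ 0 ≟ j ⌋ + (bit ⌊ f ≟ suc (double j) ⌋ + bit ⌊ f ≟ suc (suc (double j)) ⌋)
  bit-half zero j
    rewrite ⌊⌋-false (0 ≟ suc (double j)) (λ ()) | ⌊⌋-false (0 ≟ suc (suc (double j))) (λ ())
    = sym (trans (+-identityʳ _) (+-identityʳ _))
  bit-half (suc f) j rewrite ⌊⌋-false (suc f ≟ 0) (λ ()) with ⌊ f /2⌋ ≟ j
  ... | no h≢j rewrite ⌊⌋-false (suc f ≟ suc (double j)) (λ { refl → h≢j (half-double j) })
                     | ⌊⌋-false (suc f ≟ suc (suc (double j))) (λ { refl → h≢j (half-suc-double j) }) = refl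
  ... | yes refl with half-cases f
  ...   | inj₁ e rewrite ⌊⌋-true (suc f ≟ suc (double ⌊ f /2⌋)) (cong suc e)
                       | ⌊⌋-false (suc f ≟ suc (suc (double ⌊ f /2⌋))) (λ e′ → 1+n≢n (trans (sym (suc-injective e′)) e)) = refl
  ...   | inj₂ e rewrite ⌊⌋-false (suc f ≟ suc (double ⌊ f /2⌋)) (λ e′ → 1+n≢n (trans (sym e) (suc-injective e′)))
                       | ⌊⌋-true (suc f ≟ suc (suc (double ⌊ f /2⌋))) (cong suc e) = refl

  count-half : {X : Set} (p : X → Bool) (f : X → ℕ) (j : ℕ) (xs : List X) →
    let A = λ k → count (λ x → p x ∧ ⌊ f x ≟ k ⌋) xs in
    count (λ x → p x ∧ ⌊ ⌊ f x ∸ 1 /2⌋ ≟ j ⌋) xs ≡ A 0 * bit ⌊ 0 ≟ j ⌋ + (A (suc (double j)) + A (suc (suc (double j))))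
  count-half p f j []       = refl
  count-half p f j (x ∷ xs) = begin
    count (λ x → p x ∧ ⌊ ⌊ f x ∸ 1 /2⌋ ≟ j ⌋) (x ∷ xs)
      ≡⟨ trans (count-∷ _ x xs) (cong₂ _+_ (head (p x)) (count-half p f j xs)) ⟩
    (B 0 * t + (B k₁ + B k₂)) + (A 0 * t + (A k₁ + A k₂))
      ≡⟨ lem (B 0) (B k₁) (B k₂) (A 0) (A k₁) (A k₂) t ⟩
    (B 0 + A 0) * t + ((B k₁ + A k₁) + (B k₂ + A k₂))
      ≡⟨ sym (cong₂ _+_ (cong (_* t) (count-∷ (P 0) x xs)) (cong₂ _+_ (count-∷ (P k₁) x xs) (count-∷ (P k₂) x xs))) ⟩
    _ ∎
    where
    open ≡-Reasoning
    k₁ = suc (double j)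
    k₂ = suc (suc (double j))
    t = bit ⌊ 0 ≟ j ⌋
    P = λ k x → p x ∧ ⌊ f x ≟ k ⌋
    A = λ k → count (P k) xs
    B = λ k → bit (p x ∧ ⌊ f x ≟ k ⌋)
    head : ∀ b → bit (b ∧ ⌊ ⌊ f x ∸ 1 /2⌋ ≟ j ⌋)
         ≡ bit (b ∧ ⌊ f x ≟ 0 ⌋) * t + (bit (b ∧ ⌊ f x ≟ k₁ ⌋) + bit (b ∧ ⌊ f x ≟ k₂ ⌋))
    head true  = bit-half (f x) j
    head false = refl
    lem : ∀ a b c d e f t → (a * t + (b + c)) + (d * t + (e + f)) ≡ (a + d) * t + ((b + e) + (c + f))
    lem = ℕ-solve

  -- The coefficients of (x+1)(x+2)⋯(x+r); same and other keep those of exponents ≡ r and ≢ r mod 2.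

  stir : ℕ → ℕ → ℕ
  stir zero    zero    = 1
  stir zero    (suc k) = 0
  stir (suc r) k       = suc r * stir r k + shiftUp (stir r) k

  same : ℕ → ℕ → ℕ
  other : ℕ → ℕ → ℕ
  same zero    zero    = 1
  same zero    (suc k) = 0
  same (suc r) k       = shiftUp (same r) k + suc r * other r k
  other zero    k      = 0
  other (suc r) k      = suc r * same r k + shiftUp (other r) k

  same+other : ∀ r k → same r k + other r k ≡ stir r k
  same+other zero    zero    = refl
  same+other zero    (suc k) = refl
  same+other (suc r) zero    = trans (lem (suc r) (same r 0) (other r 0)) (cong (λ z → suc r * z + 0) (same+other r 0))
    where
    lem : ∀ c u v → c * v + (c * u + 0) ≡ c * (u + v) + 0
    lem = ℕ-solve
  same+other (suc r) (suc k) = trans (lem (suc r) (same r k) (other r k) (same r (suc k)) (other r (suc k)))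
    (cong₂ (λ y z → suc r * y + z) (same+other r (suc k)) (same+other r k))
    where
    lem : ∀ c u v u′ v′ → (u + c * v′) + (c * u′ + v) ≡ c * (u′ + v′) + (u + v)
    lem = ℕ-solve

  -- The name gives the parity of r. The parity supports of `same` and `other` are stated through
  -- `double`, so that passing from r to r + 1 merely interchanges the two patterns.
  OddIndex EvenIndex : ℕ → Set
  EvenIndex r = (∀ j → same r (suc (double j)) ≡ 0) × (∀ j → other r (double j) ≡ 0)
  OddIndex  r = (∀ j → same r (double j) ≡ 0) × (∀ j → other r (suc (double j)) ≡ 0)

  even⇒odd : ∀ r → EvenIndex r → OddIndex (suc r)
  even⇒odd r (s , o) =
      (λ { zero → trans (cong (suc r *_) (o 0)) (*-zeroʳ r)
         ; (suc j) → trans (cong₂ (λ y z → y + suc r * z) (s j) (o (suc j))) (*-zeroʳ r) })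
    , (λ j → trans (cong₂ (λ y z → suc r * y + z) (s j) (o j)) (trans (+-identityʳ _) (*-zeroʳ r)))

  odd⇒even : ∀ r → OddIndex r → EvenIndex (suc r)
  odd⇒even r (s , o) =
      (λ j → trans (cong₂ (λ y z → y + suc r * z) (s j) (o j)) (*-zeroʳ r))
    , (λ { zero → trans (cong (λ y → suc r * y + 0) (s 0)) (trans (+-identityʳ _) (*-zeroʳ r))
         ; (suc j) → trans (cong₂ (λ y z → suc r * y + z) (s (suc j)) (o j)) (trans (+-identityʳ _) (*-zeroʳ r)) })

  evenIndex : ∀ i → EvenIndex (double i)
  evenIndex zero    = (λ _ → refl) , (λ _ → refl)
  evenIndex (suc i) = odd⇒even (suc (double i)) (even⇒odd (double i) (evenIndex i))

  oddIndex : ∀ i → OddIndex (suc (double i))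
  oddIndex i = even⇒odd (double i) (evenIndex i)

  -- One of the two summands always vanishes; which one depends on the parity of r. The sum gives a
  -- formula for the coefficients of F that is uniform in r.
  paired : ℕ → ℕ → ℕ
  paired r j = other r (double j) + other r (suc (double j))

  paired-odd : ∀ r i → r ≡ suc (double i) → ∀ j → paired r j ≡ stir r (double j)
  paired-odd r i refl j = trans (cong (λ ξ → other r (double j) + ξ) (proj₂ (oddIndex i) j)) (trans (+-identityʳ _)
    (trans (cong (_+ other r (double j)) (sym (proj₁ (oddIndex i) j))) (same+other r (double j))))

  paired-even : ∀ r i → r ≡ double i → ∀ j → paired r j ≡ stir r (suc (double j))
  paired-even r i refl j = trans (cong (_+ other r (suc (double j))) (proj₂ (evenIndex i) j))
    (trans (cong (_+ other r (suc (double j))) (sym (proj₁ (evenIndex i) j))) (same+other r (suc (double j))))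

  sameVal : ℕ → ℤ → ℤ
  otherVal : ℕ → ℤ → ℤ
  sameVal zero     x = + 1
  sameVal (suc r)  x = x ℤ.* sameVal r x ℤ.+ + suc r ℤ.* otherVal r x
  otherVal zero    x = + 0
  otherVal (suc r) x = + suc r ℤ.* sameVal r x ℤ.+ x ℤ.* otherVal r x

  eval-same : ∀ r d x → r < d → + eval d (same r) x ≡ sameVal r (+ x)
  eval-other : ∀ r d x → r < d → + eval d (other r) x ≡ otherVal r (+ x)
  eval-same zero    (suc d) x _ = cong (λ z → + suc z) (trans (cong (x *_) (eval-0 d x)) (*-zeroʳ x))
  eval-same (suc r) (suc d) x (s≤s r<d) = begin
    + eval (suc d) (λ k → shiftUp (same r) k + suc r * other r k) x
      ≡⟨ cong +_ (trans (eval-+ (suc d) (shiftUp (same r)) (λ k → suc r * other r k) x)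
           (cong (λ ξ → x * eval d (same r) x + ξ) (eval-* (suc d) (suc r) (other r) x))) ⟩
    + (x * eval d (same r) x + suc r * eval (suc d) (other r) x)
      ≡⟨ trans (ℤP.pos-+ (x * eval d (same r) x) (suc r * eval (suc d) (other r) x)) (cong₂ ℤ._+_ (ℤP.pos-* x (eval d (same r) x)) (ℤP.pos-* (suc r) (eval (suc d) (other r) x))) ⟩
    + x ℤ.* + eval d (same r) x ℤ.+ + suc r ℤ.* + eval (suc d) (other r) x
      ≡⟨ cong₂ (λ y z → + x ℤ.* y ℤ.+ + suc r ℤ.* z) (eval-same r d x r<d) (eval-other r (suc d) x (m<n⇒m<1+n r<d)) ⟩
    _ ∎
    where open ≡-Reasoning
  eval-other zero    d x _ = cong +_ (eval-0 d x)
  eval-other (suc r) (suc d) x (s≤s r<d) = begin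
    + eval (suc d) (λ k → suc r * same r k + shiftUp (other r) k) x
      ≡⟨ cong +_ (trans (eval-+ (suc d) (λ k → suc r * same r k) (shiftUp (other r)) x)
           (cong (_+ x * eval d (other r) x) (eval-* (suc d) (suc r) (same r) x))) ⟩
    + (suc r * eval (suc d) (same r) x + x * eval d (other r) x)
      ≡⟨ trans (ℤP.pos-+ (suc r * eval (suc d) (same r) x) (x * eval d (other r) x)) (cong₂ ℤ._+_ (ℤP.pos-* (suc r) (eval (suc d) (same r) x)) (ℤP.pos-* x (eval d (other r) x))) ⟩
    + suc r ℤ.* + eval (suc d) (same r) x ℤ.+ + x ℤ.* + eval d (other r) x
      ≡⟨ cong₂ (λ y z → + suc r ℤ.* y ℤ.+ + x ℤ.* z) (eval-same r (suc d) x (m<n⇒m<1+n r<d)) (eval-other r d x r<d) ⟩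
    _ ∎
    where open ≡-Reasoning

  rise-ascending : ∀ r x → rise (suc r) x ≡ x ℤ.* (sameVal r x ℤ.+ otherVal r x)
  rise-ascending zero    x = lem x
    where
    lem : ∀ x → + 1 ℤ.* (x ℤ.+ + 0) ≡ x ℤ.* (+ 1 ℤ.+ + 0)
    lem = ℤ-solve
  rise-ascending (suc r) x = trans (cong (ℤ._* (x ℤ.+ + suc r)) (rise-ascending r x)) (lem x (+ suc r) (sameVal r x) (otherVal r x))
    where
    lem : ∀ x c u v → x ℤ.* (u ℤ.+ v) ℤ.* (x ℤ.+ c) ≡ x ℤ.* (x ℤ.* u ℤ.+ c ℤ.* v ℤ.+ (c ℤ.* u ℤ.+ x ℤ.* v))
    lem = ℤ-solve

  -- This product is x ∏ (x - k). Changing k to -k in ∏ (x + k) reverses the sign of just those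
  -- terms whose exponent has parity different from r.
  rise-descending : ∀ r x → rise (suc r) (x ℤ.- + r) ≡ x ℤ.* (sameVal r x ℤ.- otherVal r x)
  rise-descending zero    x = lem x
    where
    lem : ∀ x → + 1 ℤ.* (x ℤ.- + 0 ℤ.+ + 0) ≡ x ℤ.* (+ 1 ℤ.- + 0)
    lem = ℤ-solve
  rise-descending (suc r) x = begin
    rise (suc (suc r)) (x ℤ.- + suc r)
      ≡⟨ cong (rise (suc (suc r))) (trans (cong (λ z → x ℤ.- z) (ℤP.pos-+ 1 r)) (lem₀ x (+ r))) ⟩
    rise (suc (suc r)) (x ℤ.- + r ℤ.- + 1)
      ≡⟨ rise-pred (suc r) (x ℤ.- + r) ⟩
    (x ℤ.- + r ℤ.- + 1) ℤ.* rise (suc r) (x ℤ.- + r)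
      ≡⟨ cong₂ ℤ._*_ (sym (trans (cong (λ z → x ℤ.- z) (ℤP.pos-+ 1 r)) (lem₀ x (+ r)))) (rise-descending r x) ⟩
    (x ℤ.- + suc r) ℤ.* (x ℤ.* (sameVal r x ℤ.- otherVal r x))
      ≡⟨ lem x (+ suc r) (sameVal r x) (otherVal r x) ⟩
    _ ∎
    where
    open ≡-Reasoning
    lem₀ : ∀ x r → x ℤ.- (+ 1 ℤ.+ r) ≡ x ℤ.- r ℤ.- + 1
    lem₀ = ℤ-solve
    lem : ∀ x c u v → (x ℤ.- c) ℤ.* (x ℤ.* (u ℤ.- v)) ≡ x ℤ.* (x ℤ.* u ℤ.+ c ℤ.* v ℤ.- (c ℤ.* u ℤ.+ x ℤ.* v))
    lem = ℤ-solve

  risingProduct : ℕ → ℕ → ℕ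
  risingProduct zero    m = 1
  risingProduct (suc j) m = (suc j + m) * risingProduct j m

  -- A part 1 is a single backward difference, so j fixed points only lower the index and multiply
  -- by a constant. This makes all F for the same r proportional.
  diff-ones : ∀ q j m x → diff q (j + m) x (replicate j 1) ≡ + risingProduct j m ℤ.* rise m x
  diff-ones q zero    m x = sym (ℤP.*-identityˡ _)
  diff-ones q (suc j) m x = begin
    diff q (suc (j + m)) x (replicate j 1) ℤ.- diff q (suc (j + m)) (x ℤ.- + 1) (replicate j 1)
      ≡⟨ diff-shift q (j + m) x (replicate j 1) ⟩
    + suc (j + m) ℤ.* diff q (j + m) x (replicate j 1)
      ≡⟨ cong (+ suc (j + m) ℤ.*_) (diff-ones q j m x) ⟩
    + suc (j + m) ℤ.* (+ risingProduct j m ℤ.* rise m x)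
      ≡⟨ sym (ℤP.*-assoc (+ suc (j + m)) (+ risingProduct j m) (rise m x)) ⟩
    + suc (j + m) ℤ.* + risingProduct j m ℤ.* rise m x
      ≡⟨ cong (ℤ._* rise m x) (sym (ℤP.pos-* (suc (j + m)) (risingProduct j m))) ⟩
    _ ∎
    where open ≡-Reasoning

  -- In the difference of the ascending and the descending product the terms with the parity of the
  -- cycle length cancel and the others double.
  diff-hook : ∀ x j r → diff x (j + suc (suc r)) x (suc r ∷ replicate j 1)
    ≡ + (2 * risingProduct j (suc (suc r))) ℤ.* (x ℤ.* otherVal (suc r) x)
  diff-hook x j r = begin
    diff x (j + suc (suc r)) x (replicate j 1) ℤ.- diff x (j + suc (suc r)) (x ℤ.- + suc r) (replicate j 1)
      ≡⟨ cong₂ ℤ._-_ (diff-ones x j (suc (suc r)) x) (diff-ones x j (suc (suc r)) (x ℤ.- + suc r)) ⟩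
    + K ℤ.* rise (suc (suc r)) x ℤ.- + K ℤ.* rise (suc (suc r)) (x ℤ.- + suc r)
      ≡⟨ cong₂ (λ y z → + K ℤ.* y ℤ.- + K ℤ.* z) (rise-ascending (suc r) x) (rise-descending (suc r) x) ⟩
    + K ℤ.* (x ℤ.* (u ℤ.+ v)) ℤ.- + K ℤ.* (x ℤ.* (u ℤ.- v))
      ≡⟨ lem (+ K) x u v ⟩
    + 2 ℤ.* + K ℤ.* (x ℤ.* v)
      ≡⟨ cong (ℤ._* (x ℤ.* v)) (sym (ℤP.pos-* 2 K)) ⟩
    _ ∎
    where
    open ≡-Reasoning
    K = risingProduct j (suc (suc r))
    u = sameVal (suc r) x
    v = otherVal (suc r) x
    lem : ∀ k x u v → k ℤ.* (x ℤ.* (u ℤ.+ v)) ℤ.- k ℤ.* (x ℤ.* (u ℤ.- v)) ≡ + 2 ℤ.* k ℤ.* (x ℤ.* v)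
    lem = ℤ-solve

  cycles≤n : ∀ {n} (ρ : Map n) → cycles ρ ≤ n
  cycles≤n {n} ρ = ≤-trans (LP.length-filter _ (allFin n)) (≤-reflexive (LP.length-tabulate (λ i → i)))

  ones : {X : Set} {Os : List (List X)} → All (λ K → length K ≡ 1) Os → map length Os ≡ replicate (length Os) 1
  ones []       = refl
  ones (e ∷ es) = cong₂ _∷_ e (ones es)

  ones-length : {X : Set} {Os : List (List X)} → All (λ K → length K ≡ 1) Os → length (List.concat Os) ≡ length Os
  ones-length []                 = refl
  ones-length {Os = K ∷ Os} (e ∷ es) = trans (LP.length-++ K) (cong₂ _+_ e (ones-length es))

  module _ {m : ℕ} (π : Map (suc m)) {c M Os} (mk : Marked π c M Os) (triv : All (λ K → length K ≡ 1) Os) where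

    private
      N = suc m
      r = suc (length M)
      K = 2 * risingProduct (length Os) (suc r)
      A : ℕ → ℕ
      A k = count (λ ζ → isNCycleᵇ ζ ∧ ⌊ cycles (ζ · π) ≟ k ⌋) (allVecs N N)

      size : suc m ≡ length Os + r
      size = sym (begin
        length Os + suc (length M)             ≡⟨ +-comm (length Os) (suc (length M)) ⟩
        suc (length M + length Os)             ≡⟨ cong (λ z → suc (length M + z)) (sym (ones-length triv)) ⟩
        suc (length M + length (List.concat Os)) ≡⟨ cong suc (sym (LP.length-++ M)) ⟩
        suc (length (M ++ List.concat Os))     ≡⟨ notation-length (proj₂ (proj₂ mk)) ⟩
        suc m                                  ∎)
        where open ≡-Reasoning

      evals : ∀ d → N < d → ∀ x → eval (suc d) (λ k → N * suc N * A k) x ≡ eval (suc d) (λ k → K * shiftUp (other r) k) x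
      evals d N<d x = ℤP.+-injective (begin
        + eval (suc d) (λ k → N * suc N * A k) x
          ≡⟨ cong +_ (eval-* (suc d) (N * suc N) A x) ⟩
        + (N * suc N * eval (suc d) A x)
          ≡⟨ trans (ℤP.pos-* (N * suc N) (eval (suc d) A x)) (cong (ℤ._* + eval (suc d) A x) (ℤP.pos-* N (suc N))) ⟩
        + N ℤ.* + suc N ℤ.* + eval (suc d) A x
          ≡⟨ cong (+ N ℤ.* + suc N ℤ.*_) (sym (sumOver-eval (suc d) isNCycleᵇ (λ ζ → cycles (ζ · π))
               (λ ζ → s≤s (≤-trans (cycles≤n (ζ · π)) (<⇒≤ N<d))) x (allVecs N N))) ⟩
        + N ℤ.* + suc N ℤ.* sumOver (allVecs N N) (λ ζ → when (isNCycleᵇ ζ) ((+ x) ℤ.^ cycles (ζ · π)))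
          ≡⟨ cycleSum-diff c (+ x) π M Os mk ⟩
        diff (+ x) (suc (suc m)) (+ x) (r ∷ map length Os)
          ≡⟨ cong₂ (λ z l → diff (+ x) z (+ x) (r ∷ l)) (trans (cong suc size) (sym (+-suc (length Os) r))) (ones triv) ⟩
        diff (+ x) (length Os + suc r) (+ x) (r ∷ replicate (length Os) 1)
          ≡⟨ diff-hook (+ x) (length Os) (length M) ⟩
        + K ℤ.* (+ x ℤ.* otherVal r (+ x))
          ≡⟨ cong (λ z → + K ℤ.* (+ x ℤ.* z)) (sym (eval-other r d x (≤-trans (s≤s (≤-trans (m≤n+m r (length Os)) (≤-reflexive (sym size)))) N<d))) ⟩
        + K ℤ.* (+ x ℤ.* + eval d (other r) x)
          ≡⟨ trans (cong (+ K ℤ.*_) (sym (ℤP.pos-* x (eval d (other r) x)))) (sym (ℤP.pos-* K (x * eval d (other r) x))) ⟩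
        + (K * eval (suc d) (shiftUp (other r)) x)
          ≡⟨ cong +_ (sym (eval-* (suc d) K (shiftUp (other r)) x)) ⟩
        + eval (suc d) (λ k → K * shiftUp (other r) k) x ∎)
        where open ≡-Reasoning

      coefficients : ∀ k → N * suc N * A k ≡ K * shiftUp (other r) k
      -- The truncation length is chosen beyond both N and k, so that it contains all exponents that
      -- occur and the one being compared.
      coefficients k = eval-injective (suc (suc (N + k))) (λ k → N * suc N * A k) (λ k → K * shiftUp (other r) k) (λ x → evals (suc (N + k)) (s≤s (m≤m+n N k)) (suc x))
        k (s≤s (m≤n⇒m≤1+n (m≤n+m k N)))

    -- The factor x in `diff-hook` shifts exponents: cycle numbers 2j + 1 and 2j + 2 become
    -- exponents 2j and 2j + 1 of `other`, and cycle number 0 gets coefficient 0.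
    Fcoeff-paired : ∀ j → N * suc N * Fcoeff π j ≡ K * paired r j
    Fcoeff-paired j = begin
      N * suc N * Fcoeff π j
        ≡⟨ cong (N * suc N *_) (trans (length-filterᵇ _ (allVecs N N))
             (count-half isNCycleᵇ (λ ζ → cycles (ζ · π)) j (allVecs N N))) ⟩
      N * suc N * (A 0 * t + (A k₁ + A k₂))
        ≡⟨ lem (N * suc N) (A 0) (A k₁) (A k₂) t ⟩
      N * suc N * A 0 * t + (N * suc N * A k₁ + N * suc N * A k₂)
        ≡⟨ cong₂ (λ y z → y * t + z) (trans (coefficients 0) (*-zeroʳ K)) (cong₂ _+_ (coefficients k₁) (coefficients k₂)) ⟩
      K * other r (double j) + K * other r (suc (double j))
        ≡⟨ sym (*-distribˡ-+ K _ _) ⟩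
      K * paired r j ∎
      where
      open ≡-Reasoning
      t = bit ⌊ 0 ≟ j ⌋
      k₁ = suc (double j)
      k₂ = suc (suc (double j))
      lem : ∀ n a b c t → n * (a * t + (b + c)) ≡ n * a * t + (n * b + n * c)
      lem = ℕ-solve

  -- Nonnegativity of the 2 by 2 minors involving neighbouring indices. Requiring it for all i ≤ j,
  -- beyond log-concavity, is what allows the induction over linear factors.
  Monotone₂ : (ℕ → ℕ) → Set
  Monotone₂ a = ∀ i j → i ≤ j → a i * a (suc j) ≤ a (suc i) * a j

  shiftUp-Monotone₂ : ∀ a → Monotone₂ a → Monotone₂ (shiftUp a)
  shiftUp-Monotone₂ a mono zero    j       _         = z≤n
  shiftUp-Monotone₂ a mono (suc i) (suc j) (s≤s i≤j) = mono i j i≤j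

  -- Multiplying by x + c with c ≥ 0 preserves the property: for i < j each of the four products on
  -- the left is bounded by a matching product on the right. For i = j both sides coincide; there
  -- the second comparison would lack its hypothesis i + 1 ≤ j.
  stir-Monotone₂ : ∀ r → Monotone₂ (stir r)
  stir-Monotone₂ zero    zero    j _ = ≤-reflexive (*-identityˡ (stir 0 (suc j)))
  stir-Monotone₂ zero    (suc i) j _ = z≤n
  stir-Monotone₂ (suc r) i j i≤j with m≤n⇒m<n∨m≡n i≤j
  ... | inj₂ refl = ≤-reflexive (*-comm (stir (suc r) i) (stir (suc r) (suc i)))
  ... | inj₁ i<j  = begin
    (c * t (suc i) + t i) * (c * t (suc (suc j)) + t (suc j))
      ≡⟨ lem₁ c (t (suc i)) (t i) (t (suc (suc j))) (t (suc j)) ⟩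
    c * c * (t (suc i) * t (suc (suc j))) + c * (t (suc i) * t (suc j)) + c * (t i * t (suc (suc j))) + t i * t (suc j)
      ≤⟨ +-mono-≤ (+-mono-≤ (+-mono-≤ (*-monoʳ-≤ (c * c) (mono (suc i) (suc j) (s≤s i≤j)))
                                      (*-monoʳ-≤ c (mono (suc i) j i<j)))
                            (*-monoʳ-≤ c (mono i (suc j) (m≤n⇒m≤1+n i≤j))))
                  (mono i j i≤j) ⟩
    c * c * (t (suc (suc i)) * t (suc j)) + c * (t (suc (suc i)) * t j) + c * (t (suc i) * t (suc j)) + t (suc i) * t j
      ≡⟨ lem₂ c (t (suc (suc i))) (t (suc i)) (t (suc j)) (t j) ⟩
    (c * t (suc (suc i)) + t (suc i)) * (c * t (suc j) + t j) ∎
    where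
    open ≤-Reasoning
    c = suc r
    -- Prepending a zero gives both summands of the recursion the same form, so the index 0 needs no
    -- separate case.
    t = shiftUp (stir r)
    mono = shiftUp-Monotone₂ (stir r) (stir-Monotone₂ r)
    lem₁ : ∀ c B A R Q → (c * B + A) * (c * R + Q) ≡ c * c * (B * R) + c * (B * Q) + c * (A * R) + A * Q
    lem₁ = ℕ-solve
    lem₂ : ∀ c C B Q P → c * c * (C * Q) + c * (C * P) + c * (B * Q) + B * P ≡ (c * C + B) * (c * Q + P)
    lem₂ = ℕ-solve

  -- Move both indices inwards twice, passing through a(k+1) a(k+3). It makes the sequences of
  -- coefficients of even and of odd exponents log-concave.
  Monotone₂-step2 : ∀ a → Monotone₂ a → ∀ k → a k * a (4 + k) ≤ a (2 + k) * a (2 + k)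
  Monotone₂-step2 a mono k = ≤-trans (mono k (3 + k) (m≤n+m k 3)) (mono (1 + k) (2 + k) (n≤1+n _))

  paired-LogConcave : ∀ r → LogConcave (paired r)
  paired-LogConcave r k with half-cases r
  ... | inj₁ e rewrite paired-even r _ e k | paired-even r _ e (1 + k) | paired-even r _ e (2 + k) =
    Monotone₂-step2 (stir r) (stir-Monotone₂ r) (suc (double k))
  ... | inj₂ e rewrite paired-odd r _ e k | paired-odd r _ e (1 + k) | paired-odd r _ e (2 + k) =
    Monotone₂-step2 (stir r) (stir-Monotone₂ r) (double k)

  LogConcave-proportional : ∀ x K (a b : ℕ → ℕ) .{{_ : NonZero x}} → (∀ j → x * a j ≡ K * b j) → LogConcave b → LogConcave a
  LogConcave-proportional x K a b e lc k = *-cancelˡ-≤ (x * x) {{m*n≢0 x x}} (begin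
    x * x * (a k * a (2 + k))           ≡⟨ lem x (a k) (a (2 + k)) ⟩
    (x * a k) * (x * a (2 + k))         ≡⟨ cong₂ _*_ (e k) (e (2 + k)) ⟩
    (K * b k) * (K * b (2 + k))         ≡⟨ sym (lem K (b k) (b (2 + k))) ⟩
    K * K * (b k * b (2 + k))           ≤⟨ *-monoʳ-≤ (K * K) (lc k) ⟩
    K * K * (b (1 + k) * b (1 + k))     ≡⟨ lem K (b (1 + k)) (b (1 + k)) ⟩
    (K * b (1 + k)) * (K * b (1 + k))   ≡⟨ sym (cong₂ _*_ (e (1 + k)) (e (1 + k))) ⟩
    (x * a (1 + k)) * (x * a (1 + k))   ≡⟨ sym (lem x (a (1 + k)) (a (1 + k))) ⟩
    x * x * (a (1 + k) * a (1 + k))     ∎)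
    where
    open ≤-Reasoning
    lem : ∀ x a b → x * x * (a * b) ≡ (x * a) * (x * b)
    lem = ℕ-solve

  Fcoeff-LogConcave : ∀ m (π : Map (suc m)) → IsPerm π → nontrivialCycles π ≤ 1 → LogConcave (Fcoeff π)
  Fcoeff-LogConcave m π perm le =
    let c , M , Os , mk , triv = atMostOne-Marked π perm le
    in LogConcave-proportional (suc m * suc (suc m)) (2 * risingProduct (length Os) (suc (suc (length M)))) (Fcoeff π)
         (paired (suc (length M))) (Fcoeff-paired π mk triv) (paired-LogConcave (suc (length M)))

-- Rational polynomials and division by approximate zeros.

module RationalPolynomials where

  open import Defs using (inv; coeffAt; scale; addP; mulLin; prodLin; toList)
  open import Data.Nat as ℕ using (ℕ; zero; suc)
  import Data.Nat.Properties as ℕP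
  open import Data.Integer as ℤ using (ℤ; +_; -[1+_])
  import Data.Integer.Properties as ℤP
  open import Data.Rational using (ℚ; mkℚ; 0ℚ; 1ℚ; ½; _+_; _*_; _-_; -_; _≤_; _<_; *≤*; ∣_∣; _/_; toℚᵘ; nonNegative)
  open import Data.Rational.Properties
  import Data.Rational.Unnormalised as ℚᵘ
  import Data.Rational.Unnormalised.Properties as ℚᵘP
  open import Data.Rational.Solver using (module +-*-Solver)
  open +-*-Solver using (solve; _:=_; _:+_; _:*_; _:-_; :-_; con)
  open import Data.List using (List; []; _∷_)
  open import Data.Vec using (Vec; []; _∷_)
  open import Data.Vec.Relation.Unary.All using (All; []; _∷_)
  open import Data.Product using (∃; _,_)
  open import Data.Sum using (inj₁; inj₂)
  open import Relation.Binary.PropositionalEquality using (_≡_; refl; sym; trans; cong; cong₂; subst)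

  ι : ℤ → ℚ
  ι i = i / 1

  private
    toℚᵘ-ι : ∀ i → toℚᵘ (ι i) ℚᵘ.≃ ℚᵘ.mkℚᵘ i 0
    toℚᵘ-ι i = toℚᵘ-fromℚᵘ (ℚᵘ.mkℚᵘ i 0)

  ι-+ : ∀ i j → ι (i ℤ.+ j) ≡ ι i + ι j
  ι-+ i j = toℚᵘ-injective (ℚᵘP.≃-trans (toℚᵘ-ι (i ℤ.+ j)) (ℚᵘP.≃-sym (ℚᵘP.≃-trans (toℚᵘ-homo-+ (ι i) (ι j))
    (ℚᵘP.≃-trans (ℚᵘP.+-cong (toℚᵘ-ι i) (toℚᵘ-ι j))
      (ℚᵘ.*≡* (cong (ℤ._* + 1) (cong₂ ℤ._+_ (ℤP.*-identityʳ i) (ℤP.*-identityʳ j))))))))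

  ι-* : ∀ i j → ι (i ℤ.* j) ≡ ι i * ι j
  ι-* i j = toℚᵘ-injective (ℚᵘP.≃-trans (toℚᵘ-ι (i ℤ.* j)) (ℚᵘP.≃-sym (ℚᵘP.≃-trans (toℚᵘ-homo-* (ι i) (ι j))
    (ℚᵘP.*-cong (toℚᵘ-ι i) (toℚᵘ-ι j)))))

  ι-≤ : ∀ {i j} → i ℤ.≤ j → ι i ≤ ι j
  ι-≤ {i} {j} i≤j = toℚᵘ-cancel-≤ (ℚᵘP.≤-respˡ-≃ (ℚᵘP.≃-sym (toℚᵘ-ι i)) (ℚᵘP.≤-respʳ-≃ (ℚᵘP.≃-sym (toℚᵘ-ι j))
    (ℚᵘ.*≤* (ℤP.*-monoʳ-≤-nonNeg (+ 1) i≤j))))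

  ι-< : ∀ {i j} → i ℤ.< j → ι i < ι j
  ι-< {i} {j} i<j = toℚᵘ-cancel-< (ℚᵘP.<-respˡ-≃ (ℚᵘP.≃-sym (toℚᵘ-ι i)) (ℚᵘP.<-respʳ-≃ (ℚᵘP.≃-sym (toℚᵘ-ι j))
    (ℚᵘ.*<* (ℤP.*-monoʳ-<-pos (+ 1) i<j))))

  inv-inverse : ∀ m → inv m * ι (+ suc m) ≡ 1ℚ
  inv-inverse m = toℚᵘ-injective (ℚᵘP.≃-trans (toℚᵘ-homo-* (inv m) (ι (+ suc m)))
    (ℚᵘP.≃-trans (ℚᵘP.*-cong (toℚᵘ-fromℚᵘ (ℚᵘ.mkℚᵘ (+ 1) m)) (toℚᵘ-ι (+ suc m)))
      (ℚᵘ.*≡* (trans (ℤP.*-identityʳ _) (cong (ℤ._*_ (+ 1)) (sym (ℤP.*-identityʳ (+ suc m))))))))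

  archimedean : ∀ q → ∃ λ Z → q ≤ ι (+ Z)
  archimedean q@(mkℚ i d _) = ℤ.∣ i ∣ , toℚᵘ-cancel-≤ (ℚᵘP.≤-respʳ-≃ (ℚᵘP.≃-sym (toℚᵘ-ι (+ ℤ.∣ i ∣)))
    (ℚᵘ.*≤* (ℤP.≤-trans (ℤP.≤-reflexive (ℤP.*-identityʳ i)) (below i))))
    where
    below : ∀ i → i ℤ.≤ + ℤ.∣ i ∣ ℤ.* + suc d
    below (+ n)    = subst (+ n ℤ.≤_) (ℤP.pos-* n (suc d)) (ℤ.+≤+ (ℕP.m≤m*n n (suc d)))
    below -[1+ n ] = ℤP.≤-trans ℤ.-≤+ (ℤP.≤-reflexive (ℤP.pos-* (suc n) (suc d)))

  0≤* : ∀ {p q} → 0ℚ ≤ p → 0ℚ ≤ q → 0ℚ ≤ p * q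
  0≤* {p} {q} a b = ≤-trans (≤-reflexive (sym (*-zeroʳ p))) (*-monoˡ-≤-nonNeg p {{nonNegative a}} b)

  0≤+ : ∀ {p q} → 0ℚ ≤ p → 0ℚ ≤ q → 0ℚ ≤ p + q
  0≤+ a b = ≤-trans (≤-reflexive (sym (+-identityˡ 0ℚ))) (+-mono-≤ a b)

  ≤⇒0≤- : ∀ {p q} → p ≤ q → 0ℚ ≤ q - p
  ≤⇒0≤- {p} {q} a = ≤-trans (≤-reflexive (sym (+-inverseʳ p))) (+-monoˡ-≤ (- p) a)

  0≤-⇒≤ : ∀ {p q} → 0ℚ ≤ q - p → p ≤ q
  0≤-⇒≤ {p} {q} a = ≤-trans (≤-reflexive (sym (+-identityˡ p))) (≤-trans (+-monoˡ-≤ p a)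
    (≤-reflexive (solve 2 (λ p q → q :- p :+ p := q) refl p q)))

  ≤-by : ∀ {p q} s → 0ℚ ≤ s → q - p ≡ s → p ≤ q
  ≤-by s a e = 0≤-⇒≤ (subst (0ℚ ≤_) (sym e) a)

  *-mono : ∀ {a b c d} → 0ℚ ≤ a → a ≤ b → 0ℚ ≤ c → c ≤ d → a * c ≤ b * d
  *-mono {a} {b} {c} {d} 0≤a a≤b 0≤c c≤d = ≤-by ((b - a) * d + a * (d - c))
    (0≤+ (0≤* (≤⇒0≤- a≤b) (≤-trans 0≤c c≤d)) (0≤* 0≤a (≤⇒0≤- c≤d)))
    (solve 4 (λ a b c d → b :* d :- a :* c := (b :- a) :* d :+ a :* (d :- c)) refl a b c d)

  ∣∣-≤ : ∀ {x b} → x ≤ b → - x ≤ b → ∣ x ∣ ≤ b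
  ∣∣-≤ {x} {b} u v with ∣p∣≡p∨∣p∣≡-p x
  ... | inj₁ e = subst (_≤ b) (sym e) u
  ... | inj₂ e = subst (_≤ b) (sym e) v

  x≤∣x∣ : ∀ x → x ≤ ∣ x ∣
  x≤∣x∣ x with ≤-total 0ℚ x
  ... | inj₁ 0≤x = ≤-reflexive (sym (0≤p⇒∣p∣≡p 0≤x))
  ... | inj₂ x≤0 = ≤-trans x≤0 (0≤∣p∣ x)

  -x≤∣x∣ : ∀ x → - x ≤ ∣ x ∣
  -x≤∣x∣ x = subst (- x ≤_) (∣-p∣≡∣p∣ x) (x≤∣x∣ (- x))

  0≤1 : 0ℚ ≤ 1ℚ
  0≤1 = *≤* (ℤ.+≤+ ℕ.z≤n)

  0≤½ : 0ℚ ≤ ½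
  0≤½ = *≤* (ℤ.+≤+ ℕ.z≤n)

  0≤ι : ∀ n → 0ℚ ≤ ι (+ n)
  0≤ι n = ι-≤ {+ 0} {+ n} (ℤ.+≤+ ℕ.z≤n)

  ι-suc : ∀ n → ι (+ suc n) ≡ 1ℚ + ι (+ n)
  ι-suc n = trans (cong ι (ℤP.pos-+ 1 n)) (ι-+ (+ 1) (+ n))

  0≤inv : ∀ m → 0ℚ ≤ inv m
  0≤inv m = toℚᵘ-cancel-≤ (ℚᵘP.≤-respʳ-≃ (ℚᵘP.≃-sym (toℚᵘ-fromℚᵘ (ℚᵘ.mkℚᵘ (+ 1) m))) (ℚᵘ.*≤* (ℤ.+≤+ ℕ.z≤n)))

  ≤-inv : ∀ {x} m → x * ι (+ suc m) ≤ 1ℚ → x ≤ inv m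
  ≤-inv {x} m le = begin
    x                            ≡⟨ sym (*-identityʳ x) ⟩
    x * 1ℚ                       ≡⟨ cong (x *_) (sym (trans (*-comm _ (inv m)) (inv-inverse m))) ⟩
    x * (ι (+ suc m) * inv m)    ≡⟨ sym (*-assoc x _ _) ⟩
    x * ι (+ suc m) * inv m      ≤⟨ *-monoʳ-≤-nonNeg (inv m) {{nonNegative (0≤inv m)}} le ⟩
    1ℚ * inv m                   ≡⟨ *-identityˡ _ ⟩
    inv m                        ∎
    where open ≤-Reasoning

  eval : List ℚ → ℚ → ℚ
  eval []      x = 0ℚ
  eval (a ∷ p) x = a + x * eval p x

  -- Bounds for size and slope on [-B, B], following Horner's scheme; the second recursion is the
  -- product rule for a + x p(x).
  supBound lipBound : ℚ → List ℚ → ℚ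
  supBound B []      = 0ℚ
  supBound B (a ∷ p) = ∣ a ∣ + B * supBound B p
  lipBound B []      = 0ℚ
  lipBound B (a ∷ p) = B * lipBound B p + supBound B p

  module _ {B : ℚ} (0≤B : 0ℚ ≤ B) where

    0≤supBound : ∀ p → 0ℚ ≤ supBound B p
    0≤supBound []      = ≤-refl
    0≤supBound (a ∷ p) = 0≤+ (0≤∣p∣ a) (0≤* 0≤B (0≤supBound p))

    0≤lipBound : ∀ p → 0ℚ ≤ lipBound B p
    0≤lipBound []      = ≤-refl
    0≤lipBound (a ∷ p) = 0≤+ (0≤* 0≤B (0≤lipBound p)) (0≤supBound p)

    eval-bounded : ∀ p {x} → ∣ x ∣ ≤ B → ∣ eval p x ∣ ≤ supBound B p
    eval-bounded []      x≤B = ≤-refl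
    eval-bounded (a ∷ p) {x} x≤B = ≤-trans (∣p+q∣≤∣p∣+∣q∣ a (x * eval p x)) (+-monoʳ-≤ ∣ a ∣
      (≤-trans (≤-reflexive (∣p*q∣≡∣p∣*∣q∣ x (eval p x)))
        (*-mono (0≤∣p∣ x) x≤B (0≤∣p∣ (eval p x)) (eval-bounded p x≤B))))

    eval-lipschitz : ∀ p {x y} → ∣ x ∣ ≤ B → ∣ y ∣ ≤ B → ∣ eval p x - eval p y ∣ ≤ lipBound B p * ∣ x - y ∣
    eval-lipschitz []      {x} {y} _ _ = ≤-reflexive (sym (*-zeroˡ ∣ x - y ∣))
    eval-lipschitz (a ∷ p) {x} {y} x≤B y≤B = begin
      ∣ a + x * eval p x - (a + y * eval p y) ∣
        ≡⟨ cong ∣_∣ (solve 5 (λ a x y u v → a :+ x :* u :- (a :+ y :* v) := x :* (u :- v) :+ v :* (x :- y))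
             refl a x y (eval p x) (eval p y)) ⟩
      ∣ x * (eval p x - eval p y) + eval p y * (x - y) ∣
        ≤⟨ ∣p+q∣≤∣p∣+∣q∣ (x * (eval p x - eval p y)) (eval p y * (x - y)) ⟩
      ∣ x * (eval p x - eval p y) ∣ + ∣ eval p y * (x - y) ∣
        ≡⟨ cong₂ _+_ (∣p*q∣≡∣p∣*∣q∣ x _) (∣p*q∣≡∣p∣*∣q∣ (eval p y) (x - y)) ⟩
      ∣ x ∣ * ∣ eval p x - eval p y ∣ + ∣ eval p y ∣ * ∣ x - y ∣
        ≤⟨ +-mono-≤ (*-mono (0≤∣p∣ x) x≤B (0≤∣p∣ (eval p x - eval p y)) (eval-lipschitz p x≤B y≤B))
             (*-mono (0≤∣p∣ (eval p y)) (eval-bounded p y≤B) (0≤∣p∣ (x - y)) ≤-refl) ⟩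
      B * (lipBound B p * ∣ x - y ∣) + supBound B p * ∣ x - y ∣
        ≡⟨ solve 4 (λ b l s d → b :* (l :* d) :+ s :* d := (b :* l :+ s) :* d) refl B (lipBound B p) (supBound B p) ∣ x - y ∣ ⟩
      (B * lipBound B p + supBound B p) * ∣ x - y ∣ ∎
      where open ≤-Reasoning

  -- The leading coefficient c is kept apart: the length of the vector is the degree, and division
  -- by a monic linear factor retains c.
  poly : ℚ → ∀ {d} → Vec ℚ d → List ℚ
  poly c []       = c ∷ []
  poly c (a ∷ as) = a ∷ poly c as

  -- Synthetic division by z − x.
  quot : ℚ → ℚ → ∀ {d} → Vec ℚ (suc d) → Vec ℚ d
  quot c x (a ∷ [])     = []
  quot c x (a ∷ b ∷ bs) = eval (poly c (b ∷ bs)) x ∷ quot c x (b ∷ bs)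

  quot-eval : ∀ c x z {d} (as : Vec ℚ (suc d)) →
    eval (poly c as) z - eval (poly c as) x ≡ (z - x) * eval (poly c (quot c x as)) z
  quot-eval c x z (a ∷ []) = solve 4 (λ a c x z → a :+ z :* (c :+ z :* con 0ℚ) :- (a :+ x :* (c :+ x :* con 0ℚ))
    := (z :- x) :* (c :+ z :* con 0ℚ)) refl a c x z
  quot-eval c x z (a ∷ b ∷ bs) = trans
    (solve 5 (λ a x z u v → a :+ z :* u :- (a :+ x :* v) := (z :- x) :* v :+ z :* (u :- v)) refl a x z
      (eval (poly c (b ∷ bs)) z) (eval (poly c (b ∷ bs)) x))
    (trans (cong (λ w → (z - x) * eval (poly c (b ∷ bs)) x + z * w) (quot-eval c x z (b ∷ bs)))
      (solve 4 (λ x z v w → (z :- x) :* v :+ z :* ((z :- x) :* w) := (z :- x) :* (v :+ z :* w)) refl x z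
        (eval (poly c (b ∷ bs)) x) (eval (poly c (quot c x (b ∷ bs))) z)))

  coeffAt-addP : ∀ p q k → coeffAt (addP p q) k ≡ coeffAt p k + coeffAt q k
  coeffAt-addP []      q       k       = sym (+-identityˡ _)
  coeffAt-addP (a ∷ p) []      k       = sym (+-identityʳ _)
  coeffAt-addP (a ∷ p) (b ∷ q) zero    = refl
  coeffAt-addP (a ∷ p) (b ∷ q) (suc k) = coeffAt-addP p q k

  coeffAt-scale : ∀ c p k → coeffAt (scale c p) k ≡ c * coeffAt p k
  coeffAt-scale c []      k       = sym (*-zeroʳ c)
  coeffAt-scale c (a ∷ p) zero    = refl
  coeffAt-scale c (a ∷ p) (suc k) = coeffAt-scale c p k

  coeffAt-mulLin : ∀ r p k → coeffAt (mulLin r p) k ≡ coeffAt (0ℚ ∷ p) k - r * coeffAt p k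
  coeffAt-mulLin r p k = trans (coeffAt-addP (0ℚ ∷ p) (scale (- r) p) k) (cong (λ ξ → coeffAt (0ℚ ∷ p) k + ξ)
    (trans (coeffAt-scale (- r) p k) (sym (neg-distribˡ-* r (coeffAt p k)))))

  constant : ℚ → ℕ → ℚ
  constant v zero    = v
  constant v (suc k) = 0ℚ

  -- Division with remainder, p = (z - x) p₁ + p(x), compared coefficient by coefficient.
  quot-coeff : ∀ c x {d} (as : Vec ℚ (suc d)) k → coeffAt (poly c as) k
    ≡ coeffAt (0ℚ ∷ poly c (quot c x as)) k - x * coeffAt (poly c (quot c x as)) k + constant (eval (poly c as) x) k
  quot-coeff c x (a ∷ [])     zero          = solve 3 (λ a c x → a := con 0ℚ :- x :* c :+ (a :+ x :* (c :+ x :* con 0ℚ))) refl a c x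
  quot-coeff c x (a ∷ [])     (suc zero)    = solve 2 (λ c x → c := c :- x :* con 0ℚ :+ con 0ℚ) refl c x
  quot-coeff c x (a ∷ [])     (suc (suc k)) = solve 1 (λ x → con 0ℚ := con 0ℚ :- x :* con 0ℚ :+ con 0ℚ) refl x
  quot-coeff c x (a ∷ b ∷ bs) zero          = solve 3 (λ a v x → a := con 0ℚ :- x :* v :+ (a :+ x :* v)) refl a (eval (poly c (b ∷ bs)) x) x
  quot-coeff c x (a ∷ b ∷ bs) (suc zero)    = trans (quot-coeff c x (b ∷ bs) zero)
    (solve 3 (λ x u v → con 0ℚ :- x :* u :+ v := v :- x :* u :+ con 0ℚ) refl x
      (coeffAt (poly c (quot c x (b ∷ bs))) 0) (eval (poly c (b ∷ bs)) x))
  quot-coeff c x (a ∷ b ∷ bs) (suc (suc k)) = quot-coeff c x (b ∷ bs) (suc k)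

  -- The points decrease, with differences of at least 1/D; the product form avoids division.
  data Separated (D : ℚ) : ∀ {d} → Vec ℚ d → Set where
    []  : Separated D []
    _∷_ : ∀ {d r} {rs : Vec ℚ d} → All (λ s → 1ℚ ≤ D * (r - s)) rs → Separated D rs → Separated D (r ∷ rs)

  -- For p = (z - r) p₁ + p(r), the error for p₁ is multiplied by at most 1 + |r| and the remainder
  -- adds ε. The factor 2D is the growth of ε in `quot-small`.
  errorFactor : ℚ → ℚ → ℕ → ℚ
  errorFactor B D zero    = 0ℚ
  errorFactor B D (suc d) = (1ℚ + B) * (errorFactor B D d * (D * (1ℚ + 1ℚ))) + 1ℚ

  module _ {B D : ℚ} (0≤B : 0ℚ ≤ B) (0≤D : 0ℚ ≤ D) where

    0≤errorFactor : ∀ d → 0ℚ ≤ errorFactor B D d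
    0≤errorFactor zero    = ≤-refl
    0≤errorFactor (suc d) = 0≤+ (0≤* (0≤+ 0≤1 0≤B) (0≤* (0≤errorFactor d) (0≤* 0≤D (0≤+ 0≤1 0≤1)))) 0≤1

    -- From (s - r) p₁(s) = p(s) - p(r): the right side is at most 2ε, and s - r is at least 1/D in
    -- absolute value. Hence the remaining points are approximate zeros of the quotient too.
    quot-small : ∀ c {d} (as : Vec ℚ (suc d)) r s ε → 1ℚ ≤ D * (r - s) →
      ∣ eval (poly c as) r ∣ ≤ ε → ∣ eval (poly c as) s ∣ ≤ ε →
      ∣ eval (poly c (quot c r as)) s ∣ ≤ D * (1ℚ + 1ℚ) * ε
    quot-small c as r s ε sep pr ps = begin
      ∣ Q ∣
        ≡⟨ sym (*-identityˡ ∣ Q ∣) ⟩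
      1ℚ * ∣ Q ∣
        ≤⟨ *-monoʳ-≤-nonNeg ∣ Q ∣ {{nonNegative (0≤∣p∣ Q)}} (≤-trans sep (*-monoˡ-≤-nonNeg D {{nonNegative 0≤D}}
             (≤-trans (≤-reflexive (solve 2 (λ r s → r :- s := :- (s :- r)) refl r s)) (-x≤∣x∣ (s - r))))) ⟩
      D * ∣ s - r ∣ * ∣ Q ∣
        ≡⟨ trans (*-assoc D _ _) (cong (D *_) (sym (∣p*q∣≡∣p∣*∣q∣ (s - r) Q))) ⟩
      D * ∣ (s - r) * Q ∣
        ≡⟨ cong (λ z → D * ∣ z ∣) (sym (quot-eval c r s as)) ⟩
      D * ∣ eval (poly c as) s - eval (poly c as) r ∣
        ≤⟨ *-monoˡ-≤-nonNeg D {{nonNegative 0≤D}} (≤-trans (∣p-q∣≤∣p∣+∣q∣ (eval (poly c as) s) (eval (poly c as) r)) (+-mono-≤ ps pr)) ⟩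
      D * (ε + ε)
        ≡⟨ solve 2 (λ D e → D :* (e :+ e) := D :* (con 1ℚ :+ con 1ℚ) :* e) refl D ε ⟩
      D * (1ℚ + 1ℚ) * ε ∎
      where
      open ≤-Reasoning
      Q = eval (poly c (quot c r as)) s

    -- Divide by z - r for the first point and apply induction to the quotient with the larger
    -- tolerance 2Dε. Once all points are used up only the constant c is left, where both sides
    -- agree.
    coeff-error : ∀ c {d} (as rs : Vec ℚ d) ε → 0ℚ ≤ ε → All (λ r → ∣ r ∣ ≤ B) rs → Separated D rs →
      All (λ r → ∣ eval (poly c as) r ∣ ≤ ε) rs → ∀ k →
      ∣ coeffAt (prodLin c (toList rs)) k - coeffAt (poly c as) k ∣ ≤ errorFactor B D d * ε
    coeff-error c [] [] ε 0≤ε _ _ _ k = ≤-trans (≤-reflexive (cong ∣_∣ (+-inverseʳ (coeffAt (c ∷ []) k))))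
      (≤-reflexive (sym (*-zeroˡ ε)))
    coeff-error c {suc d} as (r ∷ rs) ε 0≤ε (r≤B ∷ bnd) (sep ∷ seps) (pr ∷ prs) k = begin
      ∣ coeffAt (mulLin r P) k - coeffAt (poly c as) k ∣
        ≡⟨ cong ∣_∣ (cong₂ _-_ (coeffAt-mulLin r P k) (quot-coeff c r as k)) ⟩
      ∣ (P₁ - r * P₀) - (Q₁ - r * Q₀ + v) ∣
        ≡⟨ cong ∣_∣ (solve 6 (λ P₁ P₀ Q₁ Q₀ r v → (P₁ :- r :* P₀) :- (Q₁ :- r :* Q₀ :+ v)
             := (P₁ :- Q₁) :- r :* (P₀ :- Q₀) :- v) refl P₁ P₀ Q₁ Q₀ r v) ⟩
      ∣ (P₁ - Q₁) - r * (P₀ - Q₀) - v ∣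
        ≤⟨ ≤-trans (∣p-q∣≤∣p∣+∣q∣ ((P₁ - Q₁) - r * (P₀ - Q₀)) v) (+-mono-≤ (≤-trans (∣p-q∣≤∣p∣+∣q∣ (P₁ - Q₁) (r * (P₀ - Q₀)))
             (+-mono-≤ (shifted k) (≤-trans (≤-reflexive (∣p*q∣≡∣p∣*∣q∣ r (P₀ - Q₀)))
               (*-mono (0≤∣p∣ r) r≤B (0≤∣p∣ (P₀ - Q₀)) (ih k))))) (v-small k)) ⟩
      η + B * η + ε
        ≡⟨ solve 4 (λ K D ε B → K :* (D :* (con 1ℚ :+ con 1ℚ) :* ε) :+ B :* (K :* (D :* (con 1ℚ :+ con 1ℚ) :* ε)) :+ ε
             := ((con 1ℚ :+ B) :* (K :* (D :* (con 1ℚ :+ con 1ℚ))) :+ con 1ℚ) :* ε) refl (errorFactor B D d) D ε B ⟩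
      errorFactor B D (suc d) * ε ∎
      where
      open ≤-Reasoning
      P = prodLin c (toList rs)
      Q = poly c (quot c r as)
      P₁ = coeffAt (0ℚ ∷ P) k
      P₀ = coeffAt P k
      Q₁ = coeffAt (0ℚ ∷ Q) k
      Q₀ = coeffAt Q k
      v = constant (eval (poly c as) r) k
      ε′ = D * (1ℚ + 1ℚ) * ε
      η = errorFactor B D d * ε′
      0≤ε′ : 0ℚ ≤ ε′
      0≤ε′ = 0≤* (0≤* 0≤D (0≤+ 0≤1 0≤1)) 0≤ε
      small : ∀ {d′} {rs : Vec ℚ d′} → All (λ s → 1ℚ ≤ D * (r - s)) rs → All (λ s → ∣ eval (poly c as) s ∣ ≤ ε) rs →
              All (λ s → ∣ eval Q s ∣ ≤ ε′) rs
      small []       []       = []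
      small (s ∷ ss) (p ∷ ps) = quot-small c as r _ ε s pr p ∷ small ss ps
      ih : ∀ k → ∣ coeffAt P k - coeffAt Q k ∣ ≤ η
      ih = coeff-error c (quot c r as) rs ε′ 0≤ε′ bnd seps (small sep prs)
      shifted : ∀ k → ∣ coeffAt (0ℚ ∷ P) k - coeffAt (0ℚ ∷ Q) k ∣ ≤ η
      shifted zero    = 0≤* (0≤errorFactor d) 0≤ε′
      shifted (suc k) = ih k
      v-small : ∀ k → ∣ constant (eval (poly c as) r) k ∣ ≤ ε
      v-small zero    = pr
      v-small (suc k) = 0≤ε

-- Bisection, brackets, and convergence of the coefficients.

module RootFinding where

  open import Defs using (inv; ℝ; seq; reg; coeffAt; prodLin; toList; stage)
  open RationalPolynomials
  open import Data.Nat as ℕ using (ℕ; zero; suc)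
  import Data.Nat.Properties as ℕP
  open import Data.Integer as ℤ using (ℤ; +_)
  import Data.Integer.Properties as ℤP
  open import Data.Rational using (ℚ; 0ℚ; 1ℚ; ½; _+_; _*_; _-_; -_; _≤_; _<_; ∣_∣; nonNegative; positive; 1/_)
  open import Data.Rational.Properties
  open import Data.Rational.Solver using (module +-*-Solver)
  open +-*-Solver using (solve; _:=_; _:+_; _:*_; _:-_; :-_; con)
  open import Data.Vec using (Vec; []; _∷_)
  open import Data.Vec.Relation.Unary.All as All using (All; []; _∷_)
  open import Data.Product using (∃; _×_; _,_; proj₁; proj₂)
  open import Data.Sum using (_⊎_; inj₁; inj₂)
  open import Relation.Binary.PropositionalEquality using (_≡_; refl; sym; trans; cong; cong₂; subst)

  record Cell (g : ℚ → ℚ) : Set where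
    field
      lo hi : ℚ
      lo≤hi : lo ≤ hi
      g-lo  : 0ℚ ≤ g lo
      g-hi  : g hi ≤ 0ℚ
  open Cell

  width : ∀ {g} → Cell g → ℚ
  width c = hi c - lo c

  module _ {g : ℚ → ℚ} where

    middle : Cell g → ℚ
    middle c = ½ * (lo c + hi c)

    lo≤middle : ∀ c → lo c ≤ middle c
    lo≤middle c = ≤-by (½ * (hi c - lo c)) (0≤* 0≤½ (≤⇒0≤- (lo≤hi c)))
      (solve 2 (λ l u → con ½ :* (l :+ u) :- l := con ½ :* (u :- l)) refl (lo c) (hi c))

    middle≤hi : ∀ c → middle c ≤ hi c
    middle≤hi c = ≤-by (½ * (hi c - lo c)) (0≤* 0≤½ (≤⇒0≤- (lo≤hi c)))
      (solve 2 (λ l u → u :- con ½ :* (l :+ u) := con ½ :* (u :- l)) refl (lo c) (hi c))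

    record Halved (c : Cell g) : Set where
      field
        cell   : Cell g
        lo-up  : lo c ≤ lo cell
        hi-dn  : hi cell ≤ hi c
        halved : width cell ≡ ½ * width c
    open Halved

    halve : ∀ c → Halved c
    halve c with ≤-total 0ℚ (g (middle c))
    ... | inj₁ p = record
      { cell   = record { lo = middle c ; hi = hi c ; lo≤hi = middle≤hi c ; g-lo = p ; g-hi = g-hi c }
      ; lo-up  = lo≤middle c
      ; hi-dn  = ≤-refl
      ; halved = solve 2 (λ l u → u :- con ½ :* (l :+ u) := con ½ :* (u :- l)) refl (lo c) (hi c) }
    ... | inj₂ p = record
      { cell   = record { lo = lo c ; hi = middle c ; lo≤hi = lo≤middle c ; g-lo = g-lo c ; g-hi = p }
      ; lo-up  = ≤-refl
      ; hi-dn  = middle≤hi c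
      ; halved = solve 2 (λ l u → con ½ :* (l :+ u) :- l := con ½ :* (u :- l)) refl (lo c) (hi c) }

    bisect : Cell g → ℕ → Cell g
    bisect c zero    = c
    bisect c (suc n) = cell (halve (bisect c n))

    0≤width : ∀ (c : Cell g) → 0ℚ ≤ width c
    0≤width c = ≤⇒0≤- (lo≤hi c)

    bisect-nested : ∀ c m k → lo (bisect c m) ≤ lo (bisect c (k ℕ.+ m)) × hi (bisect c (k ℕ.+ m)) ≤ hi (bisect c m)
    bisect-nested c m zero    = ≤-refl , ≤-refl
    bisect-nested c m (suc k) = let l , h = bisect-nested c m k ; H = halve (bisect c (k ℕ.+ m)) in
      ≤-trans l (lo-up H) , ≤-trans (hi-dn H) h

    -- 2⁻ⁿ ≤ 1/(n + 1), proved through (n + 2)/2 ≤ n + 1; this rate is compared with `inv` directly.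
    bisect-width : ∀ c n → width (bisect c n) * ι (+ suc n) ≤ width c
    bisect-width c zero    = ≤-reflexive (*-identityʳ (width c))
    bisect-width c (suc n) = ≤-trans step (bisect-width c n)
      where
      w = width (bisect c n)
      step : width (bisect c (suc n)) * ι (+ suc (suc n)) ≤ w * ι (+ suc n)
      step = ≤-by (w * (½ * ι (+ n))) (0≤* (0≤width (bisect c n)) (0≤* 0≤½ (0≤ι n)))
        (trans (cong₂ (λ x y → w * x - width (bisect c (suc n)) * y) (ι-suc n) (trans (ι-suc (suc n)) (cong (λ ξ → 1ℚ + ξ) (ι-suc n))))
          (trans (cong (λ x → w * (1ℚ + ι (+ n)) - x * (1ℚ + (1ℚ + ι (+ n)))) (halved (halve (bisect c n))))
            (solve 2 (λ w n → w :* (con 1ℚ :+ n) :- con ½ :* w :* (con 1ℚ :+ (con 1ℚ :+ n)) := w :* (con ½ :* n)) refl w (ι (+ n)))))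

    module _ (c : Cell g) where

      private
        W = proj₁ (archimedean (width c))

        -- Chosen so that 1 + `steps m` = (W + 1)(m + 1), where W bounds the initial width; after
        -- that many halvings the width is at most `inv m`.
        steps : ℕ → ℕ
        steps m = m ℕ.+ W ℕ.* suc m

        approx : ℕ → Cell g
        approx m = bisect c (steps m)

      approx-width : ∀ m → width (approx m) ≤ inv m
      approx-width m = ≤-inv m (*-cancelˡ-≤-pos (ι (+ suc W)) {{positive (ι-< {+ 0} {+ suc W} (ℤ.+<+ (ℕ.s≤s ℕ.z≤n)))}} (begin
        ι (+ suc W) * (width (approx m) * ι (+ suc m))
          ≡⟨ solve 3 (λ x y z → x :* (y :* z) := y :* (x :* z)) refl (ι (+ suc W)) (width (approx m)) (ι (+ suc m)) ⟩
        width (approx m) * (ι (+ suc W) * ι (+ suc m))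
          ≡⟨ cong (width (approx m) *_) (trans (sym (ι-* (+ suc W) (+ suc m))) (cong ι (sym (ℤP.pos-* (suc W) (suc m))))) ⟩
        width (approx m) * ι (+ suc (steps m))
          ≤⟨ bisect-width c (steps m) ⟩
        width c
          ≤⟨ proj₂ (archimedean (width c)) ⟩
        ι (+ W)
          ≤⟨ ι-≤ {+ W} {+ suc W} (ℤ.+≤+ (ℕP.n≤1+n W)) ⟩
        ι (+ suc W)
          ≡⟨ sym (*-identityʳ _) ⟩
        ι (+ suc W) * 1ℚ ∎))
        where open ≤-Reasoning

      private
        close : ∀ m n → steps m ℕ.≤ steps n →
          lo (approx n) - lo (approx m) ≤ inv m × lo (approx m) - lo (approx n) ≤ inv m
        close m n le with ℕP.m≤n⇒∃[o]m+o≡n le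
        ... | k , e = ≤-trans (+-monoˡ-≤ (- lo (approx m)) (≤-trans (lo≤hi (approx n)) (proj₂ nested))) (approx-width m)
                    , ≤-trans (≤-by (lo (approx n) - lo (approx m)) (≤⇒0≤- (proj₁ nested))
                        (solve 2 (λ x y → con 0ℚ :- (x :- y) := y :- x) refl (lo (approx m)) (lo (approx n)))) (0≤inv m)
          where
          nested : lo (approx m) ≤ lo (approx n) × hi (approx n) ≤ hi (approx m)
          nested = subst (λ j → lo (approx m) ≤ lo (bisect c j) × hi (bisect c j) ≤ hi (approx m))
            (trans (ℕP.+-comm k (steps m)) e) (bisect-nested c (steps m) k)

      root : ℝ
      root = record { seq = λ m → lo (approx m) ; reg = regular }
        where
        regular : ∀ m n → ∣ lo (approx m) - lo (approx n) ∣ ≤ inv m + inv n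
        regular m n with ℕP.≤-total (steps m) (steps n)
        ... | inj₁ le = let u , v = close m n le in ≤-trans (∣∣-≤ v
                (≤-trans (≤-reflexive (solve 2 (λ x y → :- (x :- y) := y :- x) refl (lo (approx m)) (lo (approx n)))) u))
                (≤-trans (≤-reflexive (sym (+-identityʳ _))) (+-monoʳ-≤ (inv m) (0≤inv n)))
        ... | inj₂ le = let u , v = close n m le in ≤-trans (∣∣-≤ u
                (≤-trans (≤-reflexive (solve 2 (λ x y → :- (x :- y) := y :- x) refl (lo (approx m)) (lo (approx n)))) v))
                (≤-trans (≤-reflexive (sym (+-identityˡ _))) (+-monoˡ-≤ (inv n) (0≤inv m)))

      root-inside : ∀ m → lo c ≤ seq root m × seq root m ≤ hi c
      root-inside m = proj₁ nested , ≤-trans (lo≤hi (approx m)) (proj₂ nested)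
        where
        nested : lo c ≤ lo (approx m) × hi (approx m) ≤ hi c
        nested = subst (λ j → lo c ≤ lo (bisect c j) × hi (bisect c j) ≤ hi c) (ℕP.+-identityʳ (steps m)) (bisect-nested c 0 (steps m))

      inside-bounded : ∀ {B x} → ∣ lo c ∣ + ∣ hi c ∣ ≤ B → lo c ≤ x → x ≤ hi c → ∣ x ∣ ≤ B
      inside-bounded {B} {x} bnd l h = ≤-trans (∣∣-≤
        (≤-trans h (≤-trans (x≤∣x∣ (hi c)) (≤-trans (≤-reflexive (sym (+-identityˡ _))) (+-monoˡ-≤ ∣ hi c ∣ (0≤∣p∣ (lo c))))))
        (≤-trans (neg-antimono-≤ l) (≤-trans (-x≤∣x∣ (lo c)) (≤-trans (≤-reflexive (sym (+-identityʳ _))) (+-monoʳ-≤ ∣ lo c ∣ (0≤∣p∣ (hi c)))))))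
        bnd

      -- At the two ends of the current cell g has opposite signs, so |g| at the lower end is at
      -- most the difference, which the Lipschitz bound controls by the width.
      root-small : ∀ {B L} → 0ℚ ≤ L → ∣ lo c ∣ + ∣ hi c ∣ ≤ B →
        (∀ {x y} → ∣ x ∣ ≤ B → ∣ y ∣ ≤ B → ∣ g x - g y ∣ ≤ L * ∣ x - y ∣) →
        ∀ m → ∣ g (seq root m) ∣ ≤ L * inv m
      root-small {B} {L} 0≤L bnd lip m = begin
        ∣ g l ∣               ≡⟨ 0≤p⇒∣p∣≡p (g-lo a) ⟩
        g l                   ≤⟨ ≤-by (0ℚ - g u) (≤⇒0≤- (g-hi a)) (solve 2 (λ x y → (x :- y) :- x := con 0ℚ :- y) refl (g l) (g u)) ⟩
        g l - g u             ≤⟨ x≤∣x∣ _ ⟩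
        ∣ g l - g u ∣         ≤⟨ lip (inside-bounded bnd (proj₁ nested) (≤-trans (lo≤hi a) (proj₂ nested)))
                                     (inside-bounded bnd (≤-trans (proj₁ nested) (lo≤hi a)) (proj₂ nested)) ⟩
        L * ∣ l - u ∣         ≡⟨ cong (L *_) (trans (sym (∣-p∣≡∣p∣ (l - u))) (trans (cong ∣_∣ (solve 2 (λ l u → :- (l :- u) := u :- l) refl l u))
                                   (0≤p⇒∣p∣≡p (0≤width a)))) ⟩
        L * width a           ≤⟨ *-monoˡ-≤-nonNeg L {{nonNegative 0≤L}} (approx-width m) ⟩
        L * inv m             ∎
        where
        open ≤-Reasoning
        a = approx m
        l = lo a
        u = hi a
        nested : lo c ≤ lo a × hi a ≤ hi c
        nested = subst (λ j → lo c ≤ lo (bisect c j) × hi (bisect c j) ≤ hi c) (ℕP.+-identityʳ (steps m)) (bisect-nested c 0 (steps m))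

  SignChange : (ℚ → ℚ) → ℚ → ℚ → Set
  SignChange f x y = (0ℚ ≤ f x × f y ≤ 0ℚ) ⊎ (f x ≤ 0ℚ × 0ℚ ≤ f y)

  -- The intervals descend, each lying strictly below the bound left by its predecessor. Strictness
  -- matters because weak sign changes of touching intervals could share one zero.
  data Brackets (f : ℚ → ℚ) : ℚ → ℕ → Set where
    []   : ∀ {x} → Brackets f x 0
    cons : ∀ {x d} (lo hi : ℚ) → hi < x → lo ≤ hi → SignChange f lo hi →
           Brackets f lo d → Brackets f x (suc d)

  0≤neg : ∀ {x} → x ≤ 0ℚ → 0ℚ ≤ - x
  0≤neg p = neg-antimono-≤ p

  neg-≤0 : ∀ {x} → 0ℚ ≤ x → - x ≤ 0ℚ
  neg-≤0 p = neg-antimono-≤ p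

  downCell : ∀ {f : ℚ → ℚ} {lo hi} → lo ≤ hi → 0ℚ ≤ f lo → f hi ≤ 0ℚ → Cell f
  downCell {f} {lo} {hi} le p q = record { lo = lo ; hi = hi ; lo≤hi = le ; g-lo = p ; g-hi = q }

  upCell : ∀ {f : ℚ → ℚ} {lo hi} → lo ≤ hi → f lo ≤ 0ℚ → 0ℚ ≤ f hi → Cell (λ x → - f x)
  upCell {f} {lo} {hi} le p q = record { lo = lo ; hi = hi ; lo≤hi = le ; g-lo = 0≤neg p ; g-hi = neg-≤0 q }

  bracketRoot : ∀ {f : ℚ → ℚ} {lo hi} → lo ≤ hi → SignChange f lo hi → ℝ
  bracketRoot {f} le (inj₁ (p , q)) = root (downCell {f} le p q)
  bracketRoot {f} le (inj₂ (p , q)) = root (upCell {f} le p q)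

  bracketRoot-inside : ∀ {f : ℚ → ℚ} {lo hi} (le : lo ≤ hi) (sc : SignChange f lo hi) m → lo ≤ seq (bracketRoot {f} le sc) m × seq (bracketRoot {f} le sc) m ≤ hi
  bracketRoot-inside {f} le (inj₁ (p , q)) m = root-inside (downCell {f} le p q) m
  bracketRoot-inside {f} le (inj₂ (p , q)) m = root-inside (upCell {f} le p q) m

  bracketRoot-small : ∀ {f : ℚ → ℚ} {lo hi B L} (le : lo ≤ hi) (sc : SignChange f lo hi) → 0ℚ ≤ L → ∣ lo ∣ + ∣ hi ∣ ≤ B →
    (∀ {x y} → ∣ x ∣ ≤ B → ∣ y ∣ ≤ B → ∣ f x - f y ∣ ≤ L * ∣ x - y ∣) →
    ∀ m → ∣ f (seq (bracketRoot {f} le sc) m) ∣ ≤ L * inv m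
  bracketRoot-small {f} le (inj₁ (p , q)) 0≤L bnd lip m = root-small (downCell {f} le p q) 0≤L bnd lip m
  bracketRoot-small {f} {L = L} le (inj₂ (p , q)) 0≤L bnd lip m = subst (_≤ L * inv m) (∣-p∣≡∣p∣ _)
    (root-small (upCell {f} le p q) 0≤L bnd (λ {x} {y} bx by → ≤-trans (≤-reflexive (trans (sym (∣-p∣≡∣p∣ (- f x - - f y)))
      (cong ∣_∣ (solve 2 (λ u v → :- (:- u :- :- v) := u :- v) refl (f x) (f y))))) (lip bx by)) m)

  module _ {f : ℚ → ℚ} where

    roots : ∀ {x d} → Brackets f x d → Vec ℝ d
    roots []                       = []
    roots (cons lo hi _ le sc brs) = bracketRoot {f} le sc ∷ roots brs

    bracketBound : ∀ {x d} → Brackets f x d → ℚ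
    bracketBound []                      = 0ℚ
    bracketBound (cons lo hi _ _ _ brs) = ∣ lo ∣ + ∣ hi ∣ + bracketBound brs

    0≤bracketBound : ∀ {x d} (brs : Brackets f x d) → 0ℚ ≤ bracketBound brs
    0≤bracketBound []                      = ≤-refl
    0≤bracketBound (cons lo hi _ _ _ brs) = 0≤+ (0≤+ (0≤∣p∣ lo) (0≤∣p∣ hi)) (0≤bracketBound brs)

    +≤ˡ : ∀ {p q r} → 0ℚ ≤ q → p + q ≤ r → p ≤ r
    +≤ˡ {p} 0≤q = ≤-trans (≤-trans (≤-reflexive (sym (+-identityʳ p))) (+-monoʳ-≤ p 0≤q))

    +≤ʳ : ∀ {p q r} → 0ℚ ≤ p → p + q ≤ r → q ≤ r
    +≤ʳ {q = q} 0≤p = ≤-trans (≤-trans (≤-reflexive (sym (+-identityˡ q))) (+-monoˡ-≤ q 0≤p))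

    roots-bounded : ∀ {x d B} (brs : Brackets f x d) → bracketBound brs ≤ B → ∀ m →
      All (λ r → ∣ r ∣ ≤ B) (stage (roots brs) m)
    roots-bounded [] bnd m = []
    roots-bounded (cons lo hi _ le sc brs) bnd m =
      let l , h = bracketRoot-inside {f} le sc m
      in inside (+≤ˡ (0≤bracketBound brs) bnd) l h ∷ roots-bounded brs (+≤ʳ (0≤+ (0≤∣p∣ lo) (0≤∣p∣ hi)) bnd) m
      where
      inside : ∀ {B y} → ∣ lo ∣ + ∣ hi ∣ ≤ B → lo ≤ y → y ≤ hi → ∣ y ∣ ≤ B
      inside = inside-bounded {λ _ → 0ℚ} (record { lo = lo ; hi = hi ; lo≤hi = le ; g-lo = ≤-refl ; g-hi = ≤-refl })

    roots-small : ∀ {x d B L} (brs : Brackets f x d) → 0ℚ ≤ L → bracketBound brs ≤ B →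
      (∀ {x y} → ∣ x ∣ ≤ B → ∣ y ∣ ≤ B → ∣ f x - f y ∣ ≤ L * ∣ x - y ∣) → ∀ m →
      All (λ r → ∣ f r ∣ ≤ L * inv m) (stage (roots brs) m)
    roots-small [] 0≤L bnd lip m = []
    roots-small (cons lo hi _ le sc brs) 0≤L bnd lip m =
      bracketRoot-small le sc 0≤L (+≤ˡ (0≤bracketBound brs) bnd) lip m
      ∷ roots-small brs 0≤L (+≤ʳ (0≤+ (0≤∣p∣ lo) (0≤∣p∣ hi)) bnd) lip m

    gapFactor : ∀ {a b} → a < b → ∃ λ D → 0ℚ ≤ D × 1ℚ ≤ D * (b - a)
    gapFactor {a} {b} a<b = 1/g , nonNegative⁻¹ 1/g {{pos⇒nonNeg 1/g {{1/pos⇒pos (b - a)}}}} , ≤-reflexive (sym (*-inverseˡ (b - a)))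
      where
      instance
        pos = positive (≤-<-trans (≤-reflexive (sym (+-inverseʳ a))) (+-monoˡ-< (- a) a<b))
        nz = pos⇒nonZero (b - a)
      1/g = 1/ (b - a)

    gap-mono : ∀ {D D′ y z} → 0ℚ ≤ D → D ≤ D′ → 0ℚ ≤ y → y ≤ z → 1ℚ ≤ D * y → 1ℚ ≤ D′ * z
    gap-mono 0≤D D≤D′ 0≤y y≤z le = ≤-trans le (*-mono 0≤D D≤D′ 0≤y y≤z)

    -- Approximations never leave their brackets, so the gaps between brackets give one D for all
    -- stages m. The claim covers every larger D′ so that the reciprocals of the gaps can simply be
    -- added.
    roots-separated : ∀ {x d} (brs : Brackets f x d) → ∃ λ D → 0ℚ ≤ D × (∀ {D′} → D ≤ D′ → ∀ m →
      All (λ r → r ≤ x × 1ℚ ≤ D′ * (x - r)) (stage (roots brs) m) × Separated D′ (stage (roots brs) m))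
    roots-separated [] = 0ℚ , ≤-refl , λ _ m → [] , []
    roots-separated {x} (cons lo hi hi<x le sc brs) = D₁ + D₂ , 0≤+ 0≤D₁ 0≤D₂ , result
      where
      D₁ = proj₁ (gapFactor hi<x)
      0≤D₁ = proj₁ (proj₂ (gapFactor hi<x))
      D₂ = proj₁ (roots-separated brs)
      0≤D₂ = proj₁ (proj₂ (roots-separated brs))
      result : ∀ {D′} → D₁ + D₂ ≤ D′ → ∀ m →
        All (λ r → r ≤ x × 1ℚ ≤ D′ * (x - r)) (stage (roots (cons lo hi hi<x le sc brs)) m)
        × Separated D′ (stage (roots (cons lo hi hi<x le sc brs)) m)
      result {D′} D≤ m = (below (proj₂ inside)
                          ∷ All.map (λ p → below (≤-trans (proj₁ p) le)) (proj₁ rest))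
                       , (All.map (λ p → ≤-trans (proj₂ p) (*-monoˡ-≤-nonNeg D′ {{nonNegative (≤-trans 0≤D₁ D₁≤)}}
                            (+-monoˡ-≤ (- _) (proj₁ inside)))) (proj₁ rest)
                          ∷ proj₂ rest)
        where
        D₁≤ : D₁ ≤ D′
        D₁≤ = +≤ˡ 0≤D₂ D≤
        rest = proj₂ (proj₂ (roots-separated brs)) (+≤ʳ 0≤D₁ D≤) m
        inside = bracketRoot-inside {f} le sc m
        below : ∀ {r} → r ≤ hi → r ≤ x × 1ℚ ≤ D′ * (x - r)
        below r≤hi = ≤-trans r≤hi (<⇒≤ hi<x)
          , gap-mono 0≤D₁ D₁≤ (≤⇒0≤- (<⇒≤ hi<x)) (+-monoʳ-≤ x (neg-antimono-≤ r≤hi)) (proj₂ (proj₂ (gapFactor hi<x)))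

  ≤-inv-eventually : ∀ q j → ∃ λ N → ∀ m → N ℕ.≤ m → q * inv m ≤ inv j
  ≤-inv-eventually q j = Z ℕ.* suc j , λ m N≤m → ≤-inv j (begin
    q * inv m * ι (+ suc j)
      ≤⟨ *-monoʳ-≤-nonNeg (ι (+ suc j)) {{nonNegative (0≤ι (suc j))}}
           (*-monoʳ-≤-nonNeg (inv m) {{nonNegative (0≤inv m)}} (proj₂ (archimedean q))) ⟩
    ι (+ Z) * inv m * ι (+ suc j)
      ≡⟨ solve 3 (λ x y z → x :* y :* z := y :* (x :* z)) refl (ι (+ Z)) (inv m) (ι (+ suc j)) ⟩
    inv m * (ι (+ Z) * ι (+ suc j))
      ≡⟨ cong (inv m *_) (trans (sym (ι-* (+ Z) (+ suc j))) (cong ι (sym (ℤP.pos-* Z (suc j))))) ⟩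
    inv m * ι (+ (Z ℕ.* suc j))
      ≤⟨ *-monoˡ-≤-nonNeg (inv m) {{nonNegative (0≤inv m)}} (ι-≤ {+ (Z ℕ.* suc j)} {+ suc m} (ℤ.+≤+ (ℕP.m≤n⇒m≤1+n N≤m))) ⟩
    inv m * ι (+ suc m)
      ≡⟨ inv-inverse m ⟩
    1ℚ ∎)
    where
    open ≤-Reasoning
    Z = proj₁ (archimedean q)

  -- B, D and L depend on the brackets alone, whereas the values at the approximate zeros are at
  -- most L · `inv m`; the coefficient error is thus a constant times `inv m`.
  brackets⇒converge : ∀ c {d} (as : Vec ℚ d) {x} (brs : Brackets (eval (poly c as)) x d) → ∀ k j →
    ∃ λ N → ∀ m → N ℕ.≤ m → ∣ coeffAt (prodLin c (toList (stage (roots brs) m))) k - coeffAt (poly c as) k ∣ ≤ inv j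
  brackets⇒converge c {d} as brs k j = proj₁ eventually , λ m N≤m → ≤-trans (error m) (proj₂ eventually m N≤m)
    where
    B = bracketBound brs
    0≤B = 0≤bracketBound brs
    L = lipBound B (poly c as)
    0≤L = 0≤lipBound 0≤B (poly c as)
    sep = roots-separated brs
    D = proj₁ sep
    0≤D = proj₁ (proj₂ sep)
    eventually = ≤-inv-eventually (errorFactor B D d * L) j
    error : ∀ m → ∣ coeffAt (prodLin c (toList (stage (roots brs) m))) k - coeffAt (poly c as) k ∣ ≤ errorFactor B D d * L * inv m
    error m = ≤-trans (coeff-error 0≤B 0≤D c as (stage (roots brs) m) (L * inv m) (0≤* 0≤L (0≤inv m))
        (roots-bounded brs ≤-refl m) (proj₂ (proj₂ (proj₂ sep) ≤-refl m))
        (roots-small brs 0≤L ≤-refl (eval-lipschitz 0≤B (poly c as)) m) k)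
      (≤-reflexive (sym (*-assoc (errorFactor B D d) L (inv m))))

-- Exact counting of quarter turns with Gaussian integers.

module GaussianWalk where

  open import Data.Nat as ℕ using (ℕ; zero; suc; z≤n; s≤s)
  import Data.Nat.Properties as ℕP
  open import Data.Integer using (ℤ; +_; _+_; _*_; _-_; -_; _≤_; _<_; +≤+; +<+; 0ℤ; 1ℤ; nonNegative; positive)
  open import Data.Integer.Properties
  open import Data.Integer.Tactic.RingSolver using (solve-∀)
  open import Data.Product using (∃; _×_; _,_; proj₁; proj₂)
  open import Data.Sum using (_⊎_; inj₁; inj₂)
  open import Data.Empty using (⊥-elim)
  open import Relation.Nullary using (yes; no)
  open import Relation.Binary.PropositionalEquality using (_≡_; _≢_; refl; sym; trans; cong; cong₂; subst; module ≡-Reasoning)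

  0≤+ : ∀ {i j} → 0ℤ ≤ i → 0ℤ ≤ j → 0ℤ ≤ i + j
  0≤+ = +-mono-≤

  0≤* : ∀ {i j} → 0ℤ ≤ i → 0ℤ ≤ j → 0ℤ ≤ i * j
  0≤* {i} {j} a b = ≤-trans (≤-reflexive (sym (*-zeroʳ i))) (*-monoˡ-≤-nonNeg i {{nonNegative a}} b)

  0<* : ∀ {i j} → 0ℤ < i → 0ℤ < j → 0ℤ < i * j
  0<* {i} {j} a b = ≤-<-trans (≤-reflexive (sym (*-zeroʳ i))) (*-monoˡ-<-pos i {{positive a}} b)

  ≤-by : ∀ {i j} s → 0ℤ ≤ s → j - i ≡ s → i ≤ j
  ≤-by s a e = 0≤i-j⇒j≤i (subst (0ℤ ≤_) (sym e) a)

  ≤⇒0≤- : ∀ {i j} → i ≤ j → 0ℤ ≤ j - i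
  ≤⇒0≤- = i≤j⇒0≤j-i

  0<⇒1≤ : ∀ {i} → 0ℤ < i → 1ℤ ≤ i
  0<⇒1≤ (+<+ (s≤s p)) = +≤+ (s≤s p)

  𝔾 : Set
  𝔾 = ℤ × ℤ

  re im : 𝔾 → ℤ
  re = proj₁
  im = proj₂

  infixl 7 _⊗_
  _⊗_ : 𝔾 → 𝔾 → 𝔾
  (a , b) ⊗ (c , d) = a * c - b * d , a * d + b * c

  _⊙_ : ℤ → 𝔾 → 𝔾
  s ⊙ (a , b) = s * a , s * b

  rot : ℕ → 𝔾 → 𝔾
  rot zero    v = v
  rot (suc k) v = - im (rot k v) , re (rot k v)

  ⊗-assoc : ∀ u v w → u ⊗ v ⊗ w ≡ u ⊗ (v ⊗ w)
  ⊗-assoc (a , b) (c , d) (e , f) = cong₂ _,_ (l₁ a b c d e f) (l₂ a b c d e f)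
    where
    l₁ : ∀ a b c d e f → (a * c - b * d) * e - (a * d + b * c) * f ≡ a * (c * e - d * f) - b * (c * f + d * e)
    l₁ = solve-∀
    l₂ : ∀ a b c d e f → (a * c - b * d) * f + (a * d + b * c) * e ≡ a * (c * f + d * e) + b * (c * e - d * f)
    l₂ = solve-∀

  ⊗-comm : ∀ u v → u ⊗ v ≡ v ⊗ u
  ⊗-comm (a , b) (c , d) = cong₂ _,_ (l₁ a b c d) (l₂ a b c d)
    where
    l₁ : ∀ a b c d → a * c - b * d ≡ c * a - d * b
    l₁ = solve-∀
    l₂ : ∀ a b c d → a * d + b * c ≡ c * b + d * a
    l₂ = solve-∀

  ⊗-interchange : ∀ u v w z → (u ⊗ v) ⊗ (w ⊗ z) ≡ (u ⊗ w) ⊗ (v ⊗ z)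
  ⊗-interchange u v w z = trans (⊗-assoc u v (w ⊗ z)) (trans (cong (u ⊗_)
    (trans (sym (⊗-assoc v w z)) (trans (cong (_⊗ z) (⊗-comm v w)) (⊗-assoc w v z)))) (sym (⊗-assoc u w (v ⊗ z))))

  ⊙-⊗-⊙ : ∀ s t u v → (s ⊙ u) ⊗ (t ⊙ v) ≡ (s * t) ⊙ (u ⊗ v)
  ⊙-⊗-⊙ s t (a , b) (c , d) = cong₂ _,_ (l₁ s t a b c d) (l₂ s t a b c d)
    where
    l₁ : ∀ s t a b c d → s * a * (t * c) - s * b * (t * d) ≡ s * t * (a * c - b * d)
    l₁ = solve-∀
    l₂ : ∀ s t a b c d → s * a * (t * d) + s * b * (t * c) ≡ s * t * (a * d + b * c)
    l₂ = solve-∀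

  rot-⊗ : ∀ k v u → rot k v ⊗ u ≡ rot k (v ⊗ u)
  rot-⊗ zero    v u = refl
  rot-⊗ (suc k) v u = trans (lem (rot k v) u) (cong (rot 1) (rot-⊗ k v u))
    where
    l₁ : ∀ a b c d → - b * c - a * d ≡ - (a * d + b * c)
    l₁ = solve-∀
    l₂ : ∀ a b c d → - b * d + a * c ≡ a * c - b * d
    l₂ = solve-∀
    lem : ∀ w u → rot 1 w ⊗ u ≡ rot 1 (w ⊗ u)
    lem (a , b) (c , d) = cong₂ _,_ (l₁ a b c d) (l₂ a b c d)

  rot-⊙ : ∀ k s v → s ⊙ rot k v ≡ rot k (s ⊙ v)
  rot-⊙ zero    s v = refl
  rot-⊙ (suc k) s v = trans (lem (rot k v)) (cong (rot 1) (rot-⊙ k s v))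
    where
    lem : ∀ w → s ⊙ rot 1 w ≡ rot 1 (s ⊙ w)
    lem (a , b) = cong (_, s * a) (sym (neg-distribʳ-* s b))

  rot-rot : ∀ j k v → rot j (rot k v) ≡ rot (j ℕ.+ k) v
  rot-rot zero    k v = refl
  rot-rot (suc j) k v = cong (rot 1) (rot-rot j k v)

  -- Half-open, so that its four rotations by powers of i partition the nonzero Gaussian integers
  -- and the quadrant of a product is unambiguous.
  Quad : 𝔾 → Set
  Quad v = 0ℤ < re v × 0ℤ ≤ im v

  Quad-⊙ : ∀ {s v} → 0ℤ < s → Quad v → Quad (s ⊙ v)
  Quad-⊙ s>0 (p , q) = 0<* s>0 p , 0≤* (<⇒≤ s>0) q

  record Turn (v u : 𝔾) : Set where
    field
      carry   : ℕ
      carry≤1 : carry ℕ.≤ 1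
      rest    : 𝔾
      product : v ⊗ u ≡ rot carry rest
      quad    : Quad rest
  open Turn

  -- Two arguments in [0, π/2) add up to one in [0, π): at most one quarter turn has to be carried.
  turn : ∀ v u → Quad v → Quad u → Turn v u
  turn (x , y) (a , b) (x>0 , y≥0) (a>0 , b≥0) with 0ℤ <? x * a - y * b
  ... | yes p = record { carry = 0 ; carry≤1 = z≤n ; rest = x * a - y * b , x * b + y * a ; product = refl
                       ; quad = p , 0≤+ (0≤* (<⇒≤ x>0) b≥0) (0≤* y≥0 (<⇒≤ a>0)) }
  ... | no ¬p = record { carry = 1 ; carry≤1 = s≤s z≤n ; rest = x * b + y * a , - (x * a - y * b)
                       ; product = cong (_, x * b + y * a) (sym (neg-involutive (x * a - y * b)))
                       ; quad = up , neg-mono-≤ (≮⇒≥ ¬p) }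
    where
    xa≤yb : x * a ≤ y * b
    xa≤yb = i-j≤0⇒i≤j (≮⇒≥ ¬p)
    -- If b were 0, the inequality xa ≤ yb would contradict xa > 0.
    b>0 : 0ℤ < b
    b>0 = ≤∧≢⇒< b≥0 (λ { refl → <-irrefl refl (<-≤-trans (0<* x>0 a>0) (≤-trans xa≤yb (≤-reflexive (*-zeroʳ y)))) })
    up : 0ℤ < x * b + y * a
    up = +-mono-<-≤ (0<* x>0 b>0) (0≤* y≥0 (<⇒≤ a>0))

  private
    neg-absurd : ∀ {i j} → 0ℤ < i → 0ℤ ≤ j → i ≢ - j
    neg-absurd i>0 j≥0 refl = <-irrefl refl (<-≤-trans i>0 (neg-mono-≤ j≥0))

  -- Exponents are determined modulo 4 only; the bound 2 excludes any wrap-around and still admits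
  -- the sum of two carries.
  rot-index : ∀ a b {v w} → a ℕ.≤ 2 → b ℕ.≤ 2 → Quad v → Quad w → rot a v ≡ rot b w → a ≡ b × v ≡ w
  rot-index 0 0 _ _ _ _ e = refl , e
  rot-index 0 1 _ _ (x>0 , _) (_ , y≥0) e = ⊥-elim (neg-absurd x>0 y≥0 (cong re e))
  rot-index 0 2 _ _ (x>0 , _) (x′>0 , _) e = ⊥-elim (neg-absurd x>0 (<⇒≤ x′>0) (cong re e))
  rot-index 1 0 _ _ (_ , y≥0) (x>0 , _) e = ⊥-elim (neg-absurd x>0 y≥0 (sym (cong re e)))
  rot-index 1 1 _ _ _ _ e = refl , cong₂ _,_ (cong im e) (neg-injective (cong re e))
  rot-index 1 2 _ _ (x>0 , _) (_ , y≥0) e = ⊥-elim (neg-absurd x>0 y≥0 (cong im e))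
  rot-index 2 0 _ _ (x>0 , _) (x′>0 , _) e = ⊥-elim (neg-absurd x′>0 (<⇒≤ x>0) (sym (cong re e)))
  rot-index 2 1 _ _ (_ , y≥0) (x>0 , _) e = ⊥-elim (neg-absurd x>0 y≥0 (sym (cong im e)))
  rot-index 2 2 _ _ _ _ e = refl , cong₂ _,_ (neg-injective (cong re e)) (neg-injective (cong im e))
  rot-index (suc (suc (suc a))) b (s≤s (s≤s ())) _ _ _ _
  rot-index 0 (suc (suc (suc b))) _ (s≤s (s≤s ())) _ _ _
  rot-index 1 (suc (suc (suc b))) _ (s≤s (s≤s ())) _ _ _
  rot-index 2 (suc (suc (suc b))) _ (s≤s (s≤s ())) _ _ _

  -- Narrow j s v: the angle of v is at most that of s + j i, i.e. j steps of slope 1/(j+s) each.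
  Narrow : ℤ → ℤ → 𝔾 → Set
  Narrow j s v = im v * s ≤ j * re v

  -- Each factor of slope at most 1/(j + s) moves the bounding ray from s + j i to (s - 1) + (j + 1)
  -- i. As the sum j + s stays fixed, the ray walks down a line in equal steps, with no need for
  -- arctangents.
  Narrow-⊗ : ∀ j s {v u} → 0ℤ ≤ j → 0ℤ < s → Quad v → Narrow j s v → Quad u → im u * (j + s) ≤ re u →
    Quad (v ⊗ u) × Narrow (j + 1ℤ) (s - 1ℤ) (v ⊗ u)
  Narrow-⊗ j s {X , Y} {α , β} j≥0 s>0 (X>0 , Y≥0) nar (α>0 , β≥0) slope = (X′>0 , Y′≥0) , narrow
    where
    M = j + s
    s≥1 : 0ℤ ≤ s - 1ℤ
    s≥1 = ≤⇒0≤- (0<⇒1≤ s>0)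
    X≥0 = <⇒≤ X>0
    α≥0 = <⇒≤ α>0
    Y′≥0 : 0ℤ ≤ X * β + Y * α
    Y′≥0 = 0≤+ (0≤* X≥0 β≥0) (0≤* Y≥0 α≥0)
    -- Bounding Ys by jX and β(j + s) by α leaves Xα(s(j + s) - j), positive because s ≥ 1; the
    -- summands on the right display this.
    key : ∀ X Y α β j s → (s * (j + s)) * (X * α - Y * β)
        ≡ X * α * s + (X * α * ((j * (s - + 1) + s * (s - + 1))) + (j * X - Y * s) * α + Y * s * (α - β * (j + s)))
    key = solve-∀
    X′>0 : 0ℤ < X * α - Y * β
    X′>0 with 0ℤ <? X * α - Y * β
    ... | yes p = p
    ... | no ¬p = ⊥-elim (<-irrefl refl (<-≤-trans
      (<-≤-trans (+-mono-<-≤ (0<* (0<* X>0 α>0) s>0)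
          (0≤+ (0≤+ (0≤* (0≤* X≥0 α≥0) (0≤+ (0≤* j≥0 s≥1) (0≤* (<⇒≤ s>0) s≥1))) (0≤* (≤⇒0≤- nar) α≥0))
            (0≤* (0≤* Y≥0 (<⇒≤ s>0)) (≤⇒0≤- slope))))
        (≤-reflexive (sym (key X Y α β j s))))
      (≤-trans (*-monoˡ-≤-nonNeg (s * M) {{nonNegative (0≤* (<⇒≤ s>0) (0≤+ j≥0 (<⇒≤ s>0)))}} (≮⇒≥ ¬p))
        (≤-reflexive (*-zeroʳ (s * M))))))
    cert : ∀ X Y α β j s → (j + + 1) * (X * α - Y * β) - (X * β + Y * α) * (s - + 1)
         ≡ (α - β * (j + s)) * (X + Y + (j * X - Y * s)) + (β * (j + s) * (j * X - Y * s)
           + β * ((j + + 1) * X + (s - + 1) * Y))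
    cert = solve-∀
    narrow : (X * β + Y * α) * (s - 1ℤ) ≤ (j + 1ℤ) * (X * α - Y * β)
    narrow = ≤-by _ (0≤+ (0≤* (≤⇒0≤- slope) (0≤+ (0≤+ X≥0 Y≥0) (≤⇒0≤- nar)))
        (0≤+ (0≤* (0≤* β≥0 (0≤+ j≥0 (<⇒≤ s>0))) (≤⇒0≤- nar))
          (0≤* β≥0 (0≤+ (0≤* (0≤+ j≥0 (+≤+ z≤n)) X≥0) (0≤* s≥1 Y≥0)))))
      (cert X Y α β j s)

  module _ (h′ : ℕ) where

    h : ℤ
    h = + suc h′

    -- The factor (j+1)h + t i of h ^ r ∏ₖ (k + y i), y = t / h.
    factor : ℕ → ℕ → 𝔾
    factor t j = + suc j * h , + t

    factor-Quad : ∀ t j → Quad (factor t j)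
    factor-Quad t j = 0<* {+ suc j} {h} (+<+ (s≤s z≤n)) (+<+ (s≤s z≤n)) , +≤+ z≤n

    -- V = ∏ factor is i ^ level times a point of the half-open first quadrant.
    record Lift : Set where
      field
        level : ℕ
        point : 𝔾
        quad  : Quad point
    open Lift

    next : ∀ (u : 𝔾) → Quad u → Lift → Lift
    next u qu l = let t = turn (point l) u (Lift.quad l) qu in
      record { level = level l ℕ.+ carry t ; point = rest t ; quad = Turn.quad t }

    lift : ℕ → ℕ → Lift
    lift t zero    = record { level = 0 ; point = 1ℤ , 0ℤ ; quad = +<+ (s≤s z≤n) , +≤+ z≤n }
    lift t (suc j) = next (factor t j) (factor-Quad t j) (lift t j)

    V : ℕ → ℕ → 𝔾
    V t zero    = 1ℤ , 0ℤ
    V t (suc j) = V t j ⊗ factor t j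

    V-lift : ∀ t j → V t j ≡ rot (level (lift t j)) (point (lift t j))
    V-lift t zero    = refl
    V-lift t (suc j) = trans (cong (_⊗ factor t j) (V-lift t j)) (trans (rot-⊗ (level l) (point l) (factor t j))
      (trans (cong (rot (level l)) (product T)) (rot-rot (level l) (carry T) (rest T))))
      where
      l = lift t j
      T = turn (point l) (factor t j) (Lift.quad l) (factor-Quad t j)

    -- At t = 0 all factors are positive reals, so nothing turns.
    lift-start : ∀ j → level (lift 0 j) ≡ 0 × im (point (lift 0 j)) ≡ 0ℤ
    lift-start zero    = refl , refl
    lift-start (suc j) = cong₂ ℕ._+_ (proj₁ (lift-start j)) (sym (proj₁ same)) , trans (sym (cong im (proj₂ same))) (im0 {point (lift 0 j)} (proj₂ (lift-start j)))
      where
      l = lift 0 j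
      T = turn (point l) (factor 0 j) (Lift.quad l) (factor-Quad 0 j)
      im0 : ∀ {v} → im v ≡ 0ℤ → im (v ⊗ factor 0 j) ≡ 0ℤ
      im0 {x , y} refl = lem x (+ suc j * h)
        where
        lem : ∀ x a → x * 0ℤ + 0ℤ * a ≡ 0ℤ
        lem = solve-∀
      quad0 : ∀ {v} → Quad v → im v ≡ 0ℤ → Quad (v ⊗ factor 0 j)
      quad0 {x , y} (p , _) refl = subst (0ℤ <_) (lem x (+ suc j * h)) (0<* p (proj₁ (factor-Quad 0 j)))
          , ≤-reflexive (sym (im0 {x , 0ℤ} refl))
        where
        lem : ∀ x a → x * a ≡ x * a - 0ℤ * 0ℤ
        lem = solve-∀
      same : 0 ≡ carry T × point l ⊗ factor 0 j ≡ rest T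
      same = rot-index 0 (carry T) z≤n (ℕP.m≤n⇒m≤1+n (carry≤1 T)) (quad0 (Lift.quad l) (proj₂ (lift-start j))) (Turn.quad T) (product T)

    private
      narrow-slope : ∀ j → + suc j * h * h ≤ + suc j * h * (+ suc j * h)
      narrow-slope j = *-monoˡ-≤-nonNeg (+ suc j * h) {{nonNegative (<⇒≤ (proj₁ (factor-Quad 0 j)))}}
        (≤-trans (≤-reflexive (sym (*-identityˡ h))) (*-monoʳ-≤-nonNeg h {1ℤ} {+ suc j} (+≤+ (s≤s z≤n))))

      split : ∀ j n → j ℕ.+ n ≡ h′ → + j + + suc n ≡ h
      split j n e = trans (sym (pos-+ j (suc n))) (cong +_ (trans (ℕP.+-suc j n) (cong suc e)))

      shift₁ : ∀ j → + j + 1ℤ ≡ + suc j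
      shift₁ j = trans (sym (pos-+ j 1)) (cong +_ (ℕP.+-comm j 1))

      shift₂ : ∀ n → + suc n - 1ℤ ≡ + n
      shift₂ n = trans (cong (_- 1ℤ) (pos-+ 1 n)) (lem (+ n))
        where
        lem : ∀ n → + 1 + n - + 1 ≡ n
        lem = solve-∀

      module Small (u : ℕ → 𝔾) (u-Quad : ∀ j → Quad (u j)) (r : ℕ) (u-slope : ∀ j → j ℕ.< r → im (u j) * h ≤ re (u j)) where

        S : ℕ → 𝔾
        S zero    = 1ℤ , 0ℤ
        S (suc j) = S j ⊗ u j

        -- The bounding ray starts at h and after j steps is at (n + 1) + j i, the two coordinates
        -- adding up to h. Up to h′ = h - 1 factors its real part stays positive, so the product
        -- stays inside the quadrant.
        S-narrow : ∀ j n → j ℕ.+ n ≡ h′ → j ℕ.≤ r → Quad (S j) × Narrow (+ j) (+ suc n) (S j)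
        S-narrow zero    n e _   = (+<+ (s≤s z≤n) , +≤+ z≤n) , ≤-reflexive refl
        S-narrow (suc j) n e j<r =
          let q , nar = S-narrow j (suc n) e′ (ℕP.<⇒≤ j<r)
              q′ , nar′ = Narrow-⊗ (+ j) (+ suc (suc n)) (+≤+ z≤n) (+<+ (s≤s z≤n)) q nar (u-Quad j)
                            (subst (λ z → im (u j) * z ≤ re (u j)) (sym (split j (suc n) e′)) (u-slope j j<r))
          in q′ , subst (λ a → im (S (suc j)) * + suc n ≤ a * re (S (suc j))) (shift₁ j)
                    (subst (λ b → im (S (suc j)) * b ≤ (+ j + 1ℤ) * re (S (suc j))) (shift₂ (suc n)) nar′)
          where
          e′ : j ℕ.+ suc n ≡ h′
          e′ = trans (ℕP.+-suc j n) e

        S-Quad : ∀ j → j ℕ.≤ r → j ℕ.≤ h′ → Quad (S j)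
        S-Quad j j≤r j≤h = proj₁ (S-narrow j (h′ ℕ.∸ j) (ℕP.m+[n∸m]≡n j≤h) j≤r)

    -- The conjugate of `factor t j` times `factor (t+1) j`: the rotation of one factor in one grid
    -- step. With a = (j + 1)h its slope is a/(a² + t(t + 1)), at most 1/h.
    ratio : ℕ → ℕ → 𝔾
    ratio t j = + suc j * h * (+ suc j * h) + + t * (+ t + 1ℤ) , + suc j * h

    norm : ℕ → ℕ → ℤ
    norm t j = + suc j * h * (+ suc j * h) + + t * + t

    private
      sq>0 : ∀ j → 0ℤ < + suc j * h * (+ suc j * h)
      sq>0 j = 0<* (proj₁ (factor-Quad 0 j)) (proj₁ (factor-Quad 0 j))

      ratio-Quad : ∀ t j → Quad (ratio t j)
      ratio-Quad t j = +-mono-<-≤ (sq>0 j) (0≤* {+ t} {+ t + 1ℤ} (+≤+ z≤n) (0≤+ {+ t} {1ℤ} (+≤+ z≤n) (+≤+ z≤n))) , <⇒≤ (proj₁ (factor-Quad 0 j))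

      norm>0 : ∀ t j → 0ℤ < norm t j
      norm>0 t j = +-mono-<-≤ (sq>0 j) (0≤* {+ t} {+ t} (+≤+ z≤n) (+≤+ z≤n))

      ratio-slope : ∀ t j → + suc j * h * h ≤ re (ratio t j)
      ratio-slope t j = ≤-trans (narrow-slope j) (≤-trans (≤-reflexive (sym (+-identityʳ _)))
        (+-monoʳ-≤ (+ suc j * h * (+ suc j * h)) (0≤* {+ t} {+ t + 1ℤ} (+≤+ z≤n) (0≤+ {+ t} {1ℤ} (+≤+ z≤n) (+≤+ z≤n)))))

      factor-suc : ∀ t j → factor t j ⊗ ratio t j ≡ norm t j ⊙ factor (suc t) j
      factor-suc t j = cong₂ _,_ (l₁ (+ suc j * h) (+ t)) (trans (l₂ (+ suc j * h) (+ t)) (cong (norm t j *_) (shift₁ t)))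
        where
        l₁ : ∀ a t → a * (a * a + t * (t + + 1)) - t * a ≡ (a * a + t * t) * a
        l₁ = solve-∀
        l₂ : ∀ a t → a * a + t * (a * a + t * (t + + 1)) ≡ (a * a + t * t) * (t + + 1)
        l₂ = solve-∀

    private
      -- R is the total rotation of the first j factors from t to t + 1. Tracking the points along
      -- with the levels makes it possible to go on to the next factor.
      record Compare (t j : ℕ) (R : 𝔾) : Set where
        field
          step   : ℕ
          step≤1 : step ℕ.≤ 1
          levels : level (lift (suc t) j) ≡ level (lift t j) ℕ.+ step
          n      : ℤ
          n>0    : 0ℤ < n
          points : point (lift t j) ⊗ R ≡ rot step (n ⊙ point (lift (suc t) j))

      module _ (t : ℕ) where
        open Small (ratio t) (ratio-Quad t) h′ (λ j _ → ratio-slope t j)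

        compare : ∀ j → j ℕ.≤ h′ → Compare t j (S j)
        compare zero    _   = record { step = 0 ; step≤1 = z≤n ; levels = refl ; n = 1ℤ ; n>0 = +<+ (s≤s z≤n) ; points = refl }
        compare (suc j) j<h = record
          { step = carry E ; step≤1 = carry≤1 E
          ; levels = trans (cong (ℕ._+ carry T′) levels) (trans (ℕP.+-assoc (level l) step (carry T′))
              (trans (cong (level l ℕ.+_) (sym (proj₁ index))) (sym (ℕP.+-assoc (level l) (carry T) (carry E)))))
          ; n = n * norm t j ; n>0 = 0<* n>0 (norm>0 t j)
          ; points = trans (product E) (cong (rot (carry E)) (proj₂ index)) }
          where
          open Compare (compare j (ℕP.<⇒≤ j<h))
          l = lift t j
          l′ = lift (suc t) j
          u = factor t j
          u′ = factor (suc t) j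
          T = turn (point l) u (Lift.quad l) (factor-Quad t j)
          T′ = turn (point l′) u′ (Lift.quad l′) (factor-Quad (suc t) j)
          E = turn (rest T) (S (suc j)) (Turn.quad T) (S-Quad (suc j) j<h j<h)
          -- The product of old point, factor and rotation is normalised in two orders: first
          -- multiply and then advance t, or the reverse. Each order yields at most two carries, so
          -- `rot-index` equates the totals.
          both : rot (carry T ℕ.+ carry E) (rest E) ≡ rot (step ℕ.+ carry T′) ((n * norm t j) ⊙ rest T′)
          both = begin
            rot (carry T ℕ.+ carry E) (rest E)
              ≡⟨ sym (trans (cong (rot (carry T)) (product E)) (rot-rot (carry T) (carry E) (rest E))) ⟩
            rot (carry T) (rest T ⊗ S (suc j))
              ≡⟨ sym (rot-⊗ (carry T) (rest T) (S (suc j))) ⟩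
            rot (carry T) (rest T) ⊗ (S j ⊗ ratio t j)
              ≡⟨ cong (_⊗ (S j ⊗ ratio t j)) (sym (product T)) ⟩
            point l ⊗ u ⊗ (S j ⊗ ratio t j)
              ≡⟨ ⊗-interchange (point l) u (S j) (ratio t j) ⟩
            point l ⊗ S j ⊗ (u ⊗ ratio t j)
              ≡⟨ cong₂ _⊗_ points (factor-suc t j) ⟩
            rot step (n ⊙ point l′) ⊗ (norm t j ⊙ u′)
              ≡⟨ trans (rot-⊗ step (n ⊙ point l′) (norm t j ⊙ u′)) (cong (rot step) (⊙-⊗-⊙ n (norm t j) (point l′) u′)) ⟩
            rot step ((n * norm t j) ⊙ (point l′ ⊗ u′))
              ≡⟨ cong (rot step) (trans (cong ((n * norm t j) ⊙_) (product T′)) (rot-⊙ (carry T′) (n * norm t j) (rest T′))) ⟩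
            rot step (rot (carry T′) ((n * norm t j) ⊙ rest T′))
              ≡⟨ rot-rot step (carry T′) _ ⟩
            rot (step ℕ.+ carry T′) ((n * norm t j) ⊙ rest T′) ∎
            where open ≡-Reasoning
          index : carry T ℕ.+ carry E ≡ step ℕ.+ carry T′ × rest E ≡ (n * norm t j) ⊙ rest T′
          index = rot-index (carry T ℕ.+ carry E) (step ℕ.+ carry T′) (ℕP.+-mono-≤ (carry≤1 T) (carry≤1 E))
            (ℕP.+-mono-≤ step≤1 (carry≤1 T′)) (Turn.quad E) (Quad-⊙ (0<* n>0 (norm>0 t j)) (Turn.quad T′)) both

    level-step : ∀ t j → j ℕ.≤ h′ → level (lift (suc t) j) ≡ level (lift t j) ⊎ level (lift (suc t) j) ≡ suc (level (lift t j))
    level-step t j j≤h = cases (Compare.step C) (Compare.step≤1 C) (Compare.levels C)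
      where
      C = compare t j j≤h
      cases : ∀ e → e ℕ.≤ 1 → level (lift (suc t) j) ≡ level (lift t j) ℕ.+ e →
        level (lift (suc t) j) ≡ level (lift t j) ⊎ level (lift (suc t) j) ≡ suc (level (lift t j))
      cases 0 _ eq = inj₁ (trans eq (ℕP.+-identityʳ _))
      cases 1 _ eq = inj₂ (trans eq (ℕP.+-comm _ 1))
      cases (suc (suc _)) (s≤s ()) _

    module Far (r : ℕ) (r≤h : r ℕ.≤ h′) (T : ℕ) (T>0 : 0 ℕ.< T) (big : r ℕ.* suc h′ ℕ.* suc h′ ℕ.≤ T) where

      private
        -- `factor T j` is i times the conjugate of `u j`. For T large these u have small slope, so
        -- the deficits from a quarter turn per factor stay below a quarter in total.
        u : ℕ → 𝔾
        u j = + T , + suc j * h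

        big′ : ∀ j → j ℕ.< r → + suc j * h * h ≤ + T
        big′ j j<r = ≤-trans (*-monoʳ-≤-nonNeg h (*-monoʳ-≤-nonNeg h (+≤+ j<r)))
          (≤-trans (≤-reflexive (trans (cong (_* h) (sym (pos-* r (suc h′)))) (sym (pos-* (r ℕ.* suc h′) (suc h′))))) (+≤+ big))

      open Small u (λ j → +<+ T>0 , <⇒≤ (proj₁ (factor-Quad 0 j))) r big′

      private
        flip : 𝔾 → 𝔾
        flip (x , y) = y , x

        flip-Quad : ∀ j → j ℕ.< r → Quad (flip (S (suc j)))
        flip-Quad j j<r = +-mono-<-≤ (0<* (proj₁ q) (proj₁ (factor-Quad 0 j))) (0≤* {im (S j)} {+ T} (proj₂ q) (+≤+ z≤n))
                        , <⇒≤ (proj₁ (S-Quad (suc j) j<r (ℕP.≤-trans j<r r≤h)))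
          where q = S-Quad j (ℕP.<⇒≤ j<r) (ℕP.≤-trans (ℕP.<⇒≤ j<r) r≤h)

        flip-⊗ : ∀ v j → flip v ⊗ factor T j ≡ rot 1 (flip (v ⊗ u j))
        flip-⊗ (x , y) j = cong₂ _,_ (l₁ x y (+ T) (+ suc j * h)) (l₂ x y (+ T) (+ suc j * h))
          where
          l₁ : ∀ x y t a → y * a - x * t ≡ - (x * t - y * a)
          l₁ = solve-∀
          l₂ : ∀ x y t a → y * t + x * a ≡ x * a + y * t
          l₂ = solve-∀

      -- `flip` is i times conjugation, and the deficit product S lies strictly inside the quadrant.
      -- Hence j + 1 factors turn by slightly less than j + 1 quarters and have level j.
      level-far : ∀ j → j ℕ.< r → level (lift T (suc j)) ≡ j × point (lift T (suc j)) ≡ flip (S (suc j))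
      level-far zero    0<r = sym (proj₁ index) , sym (proj₂ index)
        where
        T₁ = turn (1ℤ , 0ℤ) (factor T 0) (+<+ (s≤s z≤n) , +≤+ z≤n) (factor-Quad T 0)
        start : flip (S 1) ≡ rot (carry T₁) (rest T₁)
        start = trans (cong₂ _,_ (l₁ (+ 1 * h) (+ T)) (l₂ (+ 1 * h) (+ T))) (product T₁)
          where
          l₁ : ∀ a t → + 1 * a + + 0 * t ≡ + 1 * a - + 0 * t
          l₁ = solve-∀
          l₂ : ∀ a t → + 1 * t - + 0 * a ≡ + 1 * t + + 0 * a
          l₂ = solve-∀
        index : 0 ≡ carry T₁ × flip (S 1) ≡ rest T₁
        index = rot-index 0 (carry T₁) z≤n (ℕP.m≤n⇒m≤1+n (carry≤1 T₁)) (flip-Quad 0 0<r) (Turn.quad T₁) start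
      level-far (suc j) j<r = trans (cong₂ ℕ._+_ (proj₁ ih) (sym (proj₁ index))) (ℕP.+-comm j 1) , sym (proj₂ index)
        where
        ih = level-far j (ℕP.<⇒≤ j<r)
        l = lift T (suc j)
        T₁ = turn (point l) (factor T (suc j)) (Lift.quad l) (factor-Quad T (suc j))
        index : 1 ≡ carry T₁ × flip (S (suc (suc j))) ≡ rest T₁
        index = rot-index 1 (carry T₁) (s≤s z≤n) (ℕP.m≤n⇒m≤1+n (carry≤1 T₁)) (flip-Quad (suc j) j<r) (Turn.quad T₁)
          (trans (sym (flip-⊗ (S (suc j)) (suc j))) (trans (cong (_⊗ factor T (suc j)) (sym (proj₂ ih))) (product T₁)))

  -- Discrete intermediate value theorem.
  climb : ∀ (f : ℕ → ℕ) → (∀ t → f (suc t) ≡ f t ⊎ f (suc t) ≡ suc (f t)) →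
    ∀ k a → f a ℕ.< f (k ℕ.+ a) → ∃ λ b → a ℕ.< b × b ℕ.≤ k ℕ.+ a × f b ≡ suc (f a)
  climb f step zero    a lt = ⊥-elim (ℕP.<-irrefl refl lt)
  climb f step (suc k) a lt with step a
  ... | inj₂ e = suc a , ℕP.≤-refl , s≤s (ℕP.m≤n+m a k) , e
  ... | inj₁ e with climb f step k (suc a) (subst (ℕ._< f (k ℕ.+ suc a)) (sym e) (subst (λ z → f a ℕ.< f z) (sym (ℕP.+-suc k a)) lt))
  ...   | b , a<b , b≤ , fb = b , ℕP.<⇒≤ a<b , subst (b ℕ.≤_) (ℕP.+-suc k a) b≤ , trans fb (cong suc e)

-- From quadrant levels to brackets and real zeros.

module RealRootedness where

  open import Defs using (Map; IsNCycle; Fcoeff; Fpoly; RealRooted; coeffAt; inv; prodLin; toList; stage)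
  open Cycles using (notation-length; Marked)
  open LongCycles using (NCycle-Marked)
  open Coefficients using (stir; shiftUp; double; half-cases; paired; paired-odd; paired-even; Fcoeff-paired)
  open RationalPolynomials
  open RootFinding
  module W = GaussianWalk
  open GaussianWalk using (𝔾; re; im; rot; Quad; climb)
  open import Data.Nat as ℕ using (ℕ; zero; suc; z≤n; s≤s; ⌊_/2⌋)
  import Data.Nat.Properties as ℕP
  open import Data.Integer as ℤ using (ℤ; +_)
  import Data.Integer.Properties as ℤP
  open import Data.Rational using (ℚ; 0ℚ; 1ℚ; _+_; _*_; _-_; -_; _≤_; _<_; ∣_∣; _/_; nonNegative; positive)
  open import Data.Rational.Properties
  open import Data.Rational.Solver using (module +-*-Solver)
  open +-*-Solver using (solve; _:=_; _:+_; _:*_; _:-_; :-_; con)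
  import Data.Fin as Fin
  open import Data.List as List using (List; []; _∷_; applyUpTo; upTo)
  import Data.List.Properties as LP
  open import Data.List.Relation.Unary.All using ([])
  open import Data.Vec using (Vec; []; _∷_)
  open import Data.Product using (∃; _×_; _,_; proj₁; proj₂)
  open import Data.Sum using (_⊎_; inj₁; inj₂)
  open import Data.Empty using (⊥-elim)
  open import Function using (_∘_; id)
  open import Relation.Binary.Definitions using (tri<; tri≈; tri>)
  open import Relation.Binary.PropositionalEquality using (_≡_; _≢_; refl; sym; trans; cong; cong₂; subst; module ≡-Reasoning)

  0<* : ∀ {p q} → 0ℚ < p → 0ℚ < q → 0ℚ < p * q
  0<* {p} {q} a b = ≤-<-trans (≤-reflexive (sym (*-zeroʳ p))) (*-monoʳ-<-pos p {{positive a}} b)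

  ι-neg : ∀ i → ι (ℤ.- i) ≡ - ι i
  ι-neg i = begin
    ι (ℤ.- i)                    ≡⟨ solve 2 (λ x y → y := (x :+ y) :- x) refl (ι i) (ι (ℤ.- i)) ⟩
    ι i + ι (ℤ.- i) - ι i        ≡⟨ cong (_- ι i) (trans (sym (ι-+ i (ℤ.- i))) (cong ι (ℤP.+-inverseʳ i))) ⟩
    0ℚ - ι i                     ≡⟨ +-identityˡ (- ι i) ⟩
    - ι i                        ∎
    where open ≡-Reasoning

  ι-- : ∀ i j → ι (i ℤ.- j) ≡ ι i - ι j
  ι-- i j = trans (ι-+ i (ℤ.- j)) (cong (λ ξ → ι i + ξ) (ι-neg j))

  0<inv : ∀ m → 0ℚ < inv m
  0<inv m = ≤∧≢⇒<ℚ (0≤inv m) (λ e → 1≢0 (trans (sym (inv-inverse m)) (trans (cong (_* ι (+ suc m)) (sym e)) (*-zeroˡ (ι (+ suc m))))))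
    where
    ≤∧≢⇒<ℚ : ∀ {p q} → p ≤ q → p ≢ q → p < q
    ≤∧≢⇒<ℚ {p} {q} p≤q p≢q with <-cmp p q
    ... | tri< lt _ _ = lt
    ... | tri≈ _ e _  = ⊥-elim (p≢q e)
    ... | tri> _ _ gt = ⊥-elim (p≢q (≤-antisym p≤q (<⇒≤ gt)))

  ι-pos : ∀ n → 0 ℕ.< n → 0ℚ < ι (+ n)
  ι-pos n 0<n = ι-< {+ 0} {+ n} (ℤ.+<+ 0<n)

  series : ℕ → (ℕ → ℚ) → ℚ → ℚ
  series zero    a z = 0ℚ
  series (suc d) a z = a 0 + z * series d (a ∘ suc) z

  series-cong : ∀ d {a b} z → (∀ k → a k ≡ b k) → series d a z ≡ series d b z
  series-cong zero    z e = refl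
  series-cong (suc d) z e = cong₂ (λ u v → u + z * v) (e 0) (series-cong d z (e ∘ suc))

  series-linear : ∀ d r a b z → series d (λ k → r * a k + b k) z ≡ r * series d a z + series d b z
  series-linear zero    r a b z = solve 1 (λ r → con 0ℚ := r :* con 0ℚ :+ con 0ℚ) refl r
  series-linear (suc d) r a b z = trans (cong (λ v → r * a 0 + b 0 + z * v) (series-linear d r (a ∘ suc) (b ∘ suc) z))
    (solve 6 (λ r a b z u v → r :* a :+ b :+ z :* (r :* u :+ v) := r :* (a :+ z :* u) :+ (b :+ z :* v)) refl
      r (a 0) (b 0) z (series d (a ∘ suc) z) (series d (b ∘ suc) z))

  series-0 : ∀ d a z → (∀ k → a k ≡ 0ℚ) → series d a z ≡ 0ℚ
  series-0 zero    a z e = refl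
  series-0 (suc d) a z e = trans (cong₂ (λ u v → u + z * v) (e 0) (series-0 d (a ∘ suc) z (e ∘ suc)))
    (solve 1 (λ z → con 0ℚ :+ z :* con 0ℚ := con 0ℚ) refl z)

  series-scale : ∀ d κ a z → series d (λ k → κ * a k) z ≡ κ * series d a z
  series-scale d κ a z = trans (series-cong d z (λ k → sym (+-identityʳ (κ * a k)))) (trans (series-linear d κ a (λ _ → 0ℚ) z)
    (trans (cong (λ ξ → κ * series d a z + ξ) (series-0 d (λ _ → 0ℚ) z (λ _ → refl))) (+-identityʳ _)))

  series-truncate : ∀ d m a z → (∀ k → d ℕ.≤ k → a k ≡ 0ℚ) → series (d ℕ.+ m) a z ≡ series d a z
  series-truncate zero    m a z e = series-0 m a z (λ k → e k z≤n)
  series-truncate (suc d) m a z e = cong (λ v → a 0 + z * v) (series-truncate d m (a ∘ suc) z (λ k d≤k → e (suc k) (s≤s d≤k)))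

  low : ∀ d → (ℕ → ℚ) → Vec ℚ d
  low zero    a = []
  low (suc d) a = a 0 ∷ low d (a ∘ suc)

  eval-low : ∀ d a z → eval (poly (a d) (low d a)) z ≡ series (suc d) a z
  eval-low zero    a z = refl
  eval-low (suc d) a z = cong (λ v → a 0 + z * v) (eval-low d (a ∘ suc) z)

  coeffAt-low : ∀ d a → (∀ k → d ℕ.< k → a k ≡ 0ℚ) → ∀ k → coeffAt (poly (a d) (low d a)) k ≡ a k
  coeffAt-low zero    a e zero    = refl
  coeffAt-low zero    a e (suc k) = sym (e (suc k) (s≤s z≤n))
  coeffAt-low (suc d) a e zero    = refl
  coeffAt-low (suc d) a e (suc k) = coeffAt-low d (a ∘ suc) (λ k d<k → e (suc k) (s≤s d<k)) k

  coeffAt-applyUpTo : ∀ N (g : ℕ → ℚ) → (∀ k → N ℕ.≤ k → g k ≡ 0ℚ) → ∀ k → coeffAt (applyUpTo g N) k ≡ g k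
  coeffAt-applyUpTo zero    g e k       = sym (e k z≤n)
  coeffAt-applyUpTo (suc N) g e zero    = refl
  coeffAt-applyUpTo (suc N) g e (suc k) = coeffAt-applyUpTo N (g ∘ suc) (λ k N≤k → e (suc k) (s≤s N≤k)) k

  stir-vanish : ∀ r k → r ℕ.< k → stir r k ≡ 0
  stir-vanish zero    (suc k) _         = refl
  stir-vanish (suc r) (suc k) (s≤s r<k) = trans (cong₂ (λ u v → suc r ℕ.* u ℕ.+ v) (stir-vanish r (suc k) (ℕP.m<n⇒m<1+n r<k))
    (stir-vanish r k r<k)) (trans (ℕP.+-identityʳ _) (ℕP.*-zeroʳ r))

  stir-positive : ∀ r k → k ℕ.≤ r → 0 ℕ.< stir r k
  stir-positive zero    zero    _   = s≤s z≤n
  stir-positive (suc r) k       k≤r with ℕP.m≤n⇒m<n∨m≡n k≤r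
  ... | inj₁ (s≤s k≤r′) = ℕP.<-≤-trans (stir-positive r k k≤r′) (ℕP.≤-trans (ℕP.m≤m+n _ _) (ℕP.m≤m+n _ _))
  ... | inj₂ refl       = ℕP.<-≤-trans (stir-positive r r ℕP.≤-refl) (ℕP.m≤n+m _ _)

  stirℚ : ℕ → ℕ → ℚ
  stirℚ r k = ι (+ stir r k)

  stirℚ-suc : ∀ r k → stirℚ (suc r) k ≡ ι (+ suc r) * stirℚ r k + ι (+ shiftUp (stir r) k)
  stirℚ-suc r k = trans (cong ι (ℤP.pos-+ (suc r ℕ.* stir r k) (shiftUp (stir r) k)))
    (trans (ι-+ (+ (suc r ℕ.* stir r k)) (+ shiftUp (stir r) k)) (cong (_+ ι (+ shiftUp (stir r) k))
      (trans (cong ι (ℤP.pos-* (suc r) (stir r k))) (ι-* (+ suc r) (+ stir r k)))))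

  -- (x+1)(x+2)⋯(x+r) = E r (x²) + x · O r (x²)
  E O : ℕ → ℚ → ℚ
  E zero    z = 1ℚ
  E (suc r) z = ι (+ suc r) * E r z + z * O r z
  O zero    z = 0ℚ
  O (suc r) z = ι (+ suc r) * O r z + E r z

  series-E : ∀ r d z → r ℕ.< d → series d (λ j → stirℚ r (double j)) z ≡ E r z
  series-O : ∀ r d z → r ℕ.< d → series d (λ j → stirℚ r (suc (double j))) z ≡ O r z
  series-E zero    (suc d) z _ = trans (cong (λ v → 1ℚ + z * v) (series-0 d _ z (λ _ → refl)))
    (solve 1 (λ z → con 1ℚ :+ z :* con 0ℚ := con 1ℚ) refl z)
  series-E (suc r) (suc d) z (s≤s r<d) = begin
    series (suc d) (λ j → stirℚ (suc r) (double j)) z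
      ≡⟨ series-cong (suc d) z (λ j → stirℚ-suc r (double j)) ⟩
    series (suc d) (λ j → ι (+ suc r) * stirℚ r (double j) + ι (+ shiftUp (stir r) (double j))) z
      ≡⟨ series-linear (suc d) (ι (+ suc r)) (λ j → stirℚ r (double j)) (λ j → ι (+ shiftUp (stir r) (double j))) z ⟩
    ι (+ suc r) * series (suc d) (λ j → stirℚ r (double j)) z + (0ℚ + z * series d (λ j → stirℚ r (suc (double j))) z)
      ≡⟨ cong₂ (λ u v → ι (+ suc r) * u + v) (series-E r (suc d) z (ℕP.m<n⇒m<1+n r<d))
           (trans (+-identityˡ _) (cong (z *_) (series-O r d z r<d))) ⟩
    _ ∎
    where open ≡-Reasoning
  series-O zero    d z _ = series-0 d _ z (λ _ → refl)
  series-O (suc r) (suc d) z (s≤s r<d) = begin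
    series (suc d) (λ j → stirℚ (suc r) (suc (double j))) z
      ≡⟨ series-cong (suc d) z (λ j → stirℚ-suc r (suc (double j))) ⟩
    series (suc d) (λ j → ι (+ suc r) * stirℚ r (suc (double j)) + stirℚ r (double j)) z
      ≡⟨ series-linear (suc d) (ι (+ suc r)) (λ j → stirℚ r (suc (double j))) (λ j → stirℚ r (double j)) z ⟩
    ι (+ suc r) * series (suc d) (λ j → stirℚ r (suc (double j))) z + series (suc d) (λ j → stirℚ r (double j)) z
      ≡⟨ cong₂ (λ u v → ι (+ suc r) * u + v) (series-O r (suc d) z (ℕP.m<n⇒m<1+n r<d)) (series-E r (suc d) z (ℕP.m<n⇒m<1+n r<d)) ⟩
    _ ∎
    where open ≡-Reasoning

  double-mono : ∀ {i j} → i ℕ.≤ j → double i ℕ.≤ double j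
  double-mono z≤n       = z≤n
  double-mono (s≤s i≤j) = s≤s (s≤s (double-mono i≤j))

  module _ (h′ : ℕ) where

    y z : ℕ → ℚ
    y t = ι (+ t) * inv h′
    z t = - (y t * y t)

    private
      H = ι (+ suc h′)

      pow : ℕ → ℚ
      pow zero    = 1ℚ
      pow (suc j) = pow j * H

      H>0 : 0ℚ < H
      H>0 = ι-pos (suc h′) (s≤s z≤n)

      pow>0 : ∀ j → 0ℚ < pow j
      pow>0 zero    = ι-pos 1 (s≤s z≤n)
      pow>0 (suc j) = 0<* (pow>0 j) H>0

      ι-t : ∀ t → ι (+ t) ≡ H * y t
      ι-t t = sym (begin
        H * (ι (+ t) * inv h′)   ≡⟨ solve 3 (λ a b c → a :* (b :* c) := b :* (c :* a)) refl H (ι (+ t)) (inv h′) ⟩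
        ι (+ t) * (inv h′ * H)   ≡⟨ cong (ι (+ t) *_) (inv-inverse h′) ⟩
        ι (+ t) * 1ℚ             ≡⟨ *-identityʳ _ ⟩
        ι (+ t)                  ∎)
        where open ≡-Reasoning

      -- V is hʲ ∏ (k + i y). The recursion for E and O is multiplication by x + k with x² = z; here
      -- x = i y, so z = -y².
      values : ∀ t j → ι (re (W.V h′ t j)) ≡ pow j * E j (z t) × ι (im (W.V h′ t j)) ≡ pow j * (y t * O j (z t))
      values t zero    = refl , sym (solve 1 (λ y → con 1ℚ :* (y :* con 0ℚ) := con 0ℚ) refl (y t))
      values t (suc j) =
          (begin
            ι (x ℤ.* k ℤ.- w ℤ.* + t)     ≡⟨ trans (ι-- (x ℤ.* k) (w ℤ.* + t)) (cong₂ _-_ (ι-* x k) (ι-* w (+ t))) ⟩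
            ι x * ι k - ι w * ι (+ t)     ≡⟨ cong₂ _-_ (cong₂ _*_ ih₁ ι-k) (cong₂ _*_ ih₂ (ι-t t)) ⟩
            pow j * E j (z t) * (ι (+ suc j) * H) - pow j * (y t * O j (z t)) * (H * y t)
              ≡⟨ solve 6 (λ p e o k H y → p :* e :* (k :* H) :- p :* (y :* o) :* (H :* y)
                   := p :* H :* (k :* e :+ :- (y :* y) :* o)) refl (pow j) (E j (z t)) (O j (z t)) (ι (+ suc j)) H (y t) ⟩
            pow (suc j) * E (suc j) (z t) ∎)
        , (begin
            ι (x ℤ.* + t ℤ.+ w ℤ.* k)     ≡⟨ trans (ι-+ (x ℤ.* + t) (w ℤ.* k)) (cong₂ _+_ (ι-* x (+ t)) (ι-* w k)) ⟩
            ι x * ι (+ t) + ι w * ι k     ≡⟨ cong₂ _+_ (cong₂ _*_ ih₁ (ι-t t)) (cong₂ _*_ ih₂ ι-k) ⟩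
            pow j * E j (z t) * (H * y t) + pow j * (y t * O j (z t)) * (ι (+ suc j) * H)
              ≡⟨ solve 6 (λ p e o k H y → p :* e :* (H :* y) :+ p :* (y :* o) :* (k :* H)
                   := p :* H :* (y :* (k :* o :+ e))) refl (pow j) (E j (z t)) (O j (z t)) (ι (+ suc j)) H (y t) ⟩
            pow (suc j) * (y t * O (suc j) (z t)) ∎)
        where
        open ≡-Reasoning
        x = re (W.V h′ t j)
        w = im (W.V h′ t j)
        k = + suc j ℤ.* + suc h′
        ι-k : ι k ≡ ι (+ suc j) * H
        ι-k = ι-* (+ suc j) (+ suc h′)
        ih₁ = proj₁ (values t j)
        ih₂ = proj₂ (values t j)

      y>0 : ∀ t → 0 ℕ.< t → 0ℚ < y t
      y>0 t 0<t = 0<* (ι-pos t 0<t) (0<inv h′)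

      cancel-≥0 : ∀ {p x} → 0ℚ < p → 0ℚ ≤ p * x → 0ℚ ≤ x
      cancel-≥0 {p} p>0 le = *-cancelˡ-≤-pos p {{positive p>0}} (≤-trans (≤-reflexive (*-zeroʳ p)) le)

      cancel-≤0 : ∀ {p x} → 0ℚ < p → p * x ≤ 0ℚ → x ≤ 0ℚ
      cancel-≤0 {p} p>0 le = *-cancelˡ-≤-pos p {{positive p>0}} (≤-trans le (≤-reflexive (sym (*-zeroʳ p))))

    E-≥0 : ∀ t r → ℤ.0ℤ ℤ.≤ re (W.V h′ t r) → 0ℚ ≤ E r (z t)
    E-≥0 t r le = cancel-≥0 (pow>0 r) (subst (0ℚ ≤_) (proj₁ (values t r)) (ι-≤ {+ 0} le))

    E-≤0 : ∀ t r → re (W.V h′ t r) ℤ.≤ ℤ.0ℤ → E r (z t) ≤ 0ℚ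
    E-≤0 t r le = cancel-≤0 (pow>0 r) (subst (_≤ 0ℚ) (proj₁ (values t r)) (ι-≤ {_} {+ 0} le))

    O-≥0 : ∀ t r → 0 ℕ.< t → ℤ.0ℤ ℤ.≤ im (W.V h′ t r) → 0ℚ ≤ O r (z t)
    O-≥0 t r t>0 le = cancel-≥0 (y>0 t t>0) (cancel-≥0 (pow>0 r) (subst (0ℚ ≤_) (proj₂ (values t r)) (ι-≤ {+ 0} le)))

    O-≤0 : ∀ t r → 0 ℕ.< t → im (W.V h′ t r) ℤ.≤ ℤ.0ℤ → O r (z t) ≤ 0ℚ
    O-≤0 t r t>0 le = cancel-≤0 (y>0 t t>0) (cancel-≤0 (pow>0 r) (subst (_≤ 0ℚ) (proj₂ (values t r)) (ι-≤ {_} {+ 0} le)))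

    z-decreasing : ∀ {s t} → s ℕ.< t → z t < z s
    z-decreasing {s} {t} s<t = neg-antimono-< (≤-<-trans
      (*-monoˡ-≤-nonNeg (y s) {{nonNegative 0≤ys}} (<⇒≤ ys<yt)) (*-monoˡ-<-pos (y t) {{positive (≤-<-trans 0≤ys ys<yt)}} ys<yt))
      where
      0≤ys : 0ℚ ≤ y s
      0≤ys = 0≤* (0≤ι s) (0≤inv h′)
      ys<yt : y s < y t
      ys<yt = *-monoˡ-<-pos (inv h′) {{positive (0<inv h′)}} (ι-< {+ s} {+ t} (ℤ.+<+ s<t))

    z<1 : ∀ t → z t < 1ℚ
    z<1 t = ≤-<-trans (neg-antimono-≤ (0≤* 0≤y 0≤y)) (ι-pos 1 (s≤s z≤n))
      where
      0≤y : 0ℚ ≤ y t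
      0≤y = 0≤* (0≤ι t) (0≤inv h′)

  -- The first real part is (-1)ᵏ re v, the second -(-1)ᵏ im w; in the quadrant both re v and im w
  -- are nonnegative.
  alternate : ∀ k {v w} → Quad v → Quad w →
    (ℤ.0ℤ ℤ.≤ re (rot (double k) v) × re (rot (suc (double k)) w) ℤ.≤ ℤ.0ℤ)
    ⊎ (re (rot (double k) v) ℤ.≤ ℤ.0ℤ × ℤ.0ℤ ℤ.≤ re (rot (suc (double k)) w))
  alternate zero    (x>0 , _) (_ , y≥0) = inj₁ (ℤP.<⇒≤ x>0 , ℤP.neg-mono-≤ y≥0)
  alternate (suc k) qv qw with alternate k qv qw
  ... | inj₁ (p , q) = inj₂ (ℤP.neg-mono-≤ p , ℤP.neg-mono-≤ q)
  ... | inj₂ (p , q) = inj₁ (ℤP.neg-mono-≤ p , ℤP.neg-mono-≤ q)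

  -- Sign changes of g at the times when the level passes from s₀ + 2k to s₀ + 2k + 1.
  module Walk (r : ℕ) (g : ℚ → ℚ) (val : ℕ → ℤ) (s₀ : ℕ) (T : ℕ) where

    -- The first r makes h = r + 1, so that the r factors number at most h′, as `W.level-step`
    -- requires; the second r takes all factors.
    level : ℕ → ℕ
    level t = W.Lift.level (W.lift r t r)

    point : ℕ → 𝔾
    point t = W.Lift.point (W.lift r t r)

    level-step : ∀ t → level (suc t) ≡ level t ⊎ level (suc t) ≡ suc (level t)
    level-step t = W.level-step r t r ℕP.≤-refl

    climbTo : ∀ a → a ℕ.≤ T → level a ℕ.< level T → ∃ λ b → a ℕ.< b × b ℕ.≤ T × level b ≡ suc (level a)
    climbTo a a≤T lt = let b , a<b , b≤ , e = climb level level-step (T ℕ.∸ a) a (subst (λ u → level a ℕ.< level u) (sym back) lt)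
                       in b , a<b , subst (b ℕ.≤_) back b≤ , e
      where
      back : T ℕ.∸ a ℕ.+ a ≡ T
      back = ℕP.m∸n+n≡m a≤T

    module _ (val-at : ∀ t m → level t ≡ s₀ ℕ.+ m → val t ≡ re (rot m (point t)))
             (sign-≥0 : ∀ t → s₀ ℕ.≤ level t → ℤ.0ℤ ℤ.≤ val t → 0ℚ ≤ g (z r t))
             (sign-≤0 : ∀ t → s₀ ℕ.≤ level t → val t ℤ.≤ ℤ.0ℤ → g (z r t) ≤ 0ℚ) where

      -- Each bracket uses two levels: between the times a and b the sign changes, and the stretch
      -- from b to a′ is left out as a gap to the next bracket. The order is reversed because z
      -- decreases in t.
      build : ∀ d k a {x} → a ℕ.≤ T → level a ≡ s₀ ℕ.+ double k → s₀ ℕ.+ double (d ℕ.+ k) ℕ.≤ level T → z r a < x → Brackets g x d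
      build zero    k a a≤T la top za<x = []
      build (suc d) k a a≤T la top za<x =
        cons (z r b) (z r a) za<x (<⇒≤ (z-decreasing r a<b)) change
          (build d (suc k) a′ a′≤T la′ (subst (λ u → s₀ ℕ.+ double u ℕ.≤ level T) (sym (ℕP.+-suc d k)) top) (z-decreasing r b<a′))
        where
        room : suc (suc (level a)) ℕ.≤ level T
        room = ℕP.≤-trans (ℕP.≤-reflexive (trans (cong (suc ∘ suc) la) (sym (trans (ℕP.+-suc s₀ _) (cong suc (ℕP.+-suc s₀ _))))))
          (ℕP.≤-trans (ℕP.+-monoʳ-≤ s₀ (double-mono (s≤s (ℕP.m≤n+m k d)))) top)
        first = climbTo a a≤T (ℕP.<⇒≤ room)
        b = proj₁ first
        a<b = proj₁ (proj₂ first)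
        b≤T = proj₁ (proj₂ (proj₂ first))
        lb : level b ≡ suc (level a)
        lb = proj₂ (proj₂ (proj₂ first))
        second = climbTo b b≤T (subst (λ u → suc u ℕ.≤ level T) (sym lb) room)
        a′ = proj₁ second
        b<a′ = proj₁ (proj₂ second)
        a′≤T = proj₁ (proj₂ (proj₂ second))
        la′ : level a′ ≡ s₀ ℕ.+ double (suc k)
        la′ = trans (proj₂ (proj₂ (proj₂ second))) (trans (cong suc lb) (trans (cong (suc ∘ suc) la)
          (sym (trans (ℕP.+-suc s₀ _) (cong suc (ℕP.+-suc s₀ _))))))
        lb′ : level b ≡ s₀ ℕ.+ suc (double k)
        lb′ = trans lb (trans (cong suc la) (sym (ℕP.+-suc s₀ _)))
        s₀≤a : s₀ ℕ.≤ level a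
        s₀≤a = ℕP.≤-trans (ℕP.m≤m+n s₀ _) (ℕP.≤-reflexive (sym la))
        s₀≤b : s₀ ℕ.≤ level b
        s₀≤b = ℕP.≤-trans (ℕP.m≤m+n s₀ _) (ℕP.≤-reflexive (sym lb′))
        va = val-at a (double k) la
        vb = val-at b (suc (double k)) lb′
        decide : (ℤ.0ℤ ℤ.≤ re (rot (double k) (point a)) × re (rot (suc (double k)) (point b)) ℤ.≤ ℤ.0ℤ)
               ⊎ (re (rot (double k) (point a)) ℤ.≤ ℤ.0ℤ × ℤ.0ℤ ℤ.≤ re (rot (suc (double k)) (point b))) →
               SignChange g (z r b) (z r a)
        decide (inj₁ (p , q)) = inj₂ (sign-≤0 b s₀≤b (subst (ℤ._≤ ℤ.0ℤ) (sym vb) q) , sign-≥0 a s₀≤a (subst (ℤ.0ℤ ℤ.≤_) (sym va) p))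
        decide (inj₂ (p , q)) = inj₁ (sign-≥0 b s₀≤b (subst (ℤ.0ℤ ℤ.≤_) (sym vb) q) , sign-≤0 a s₀≤a (subst (ℤ._≤ ℤ.0ℤ) (sym va) p))
        change : SignChange g (z r b) (z r a)
        change = decide (alternate k (W.Lift.quad (W.lift r a r)) (W.Lift.quad (W.lift r b r)))

  module _ (n : ℕ) where

    private
      r = suc n
      -- The smallest time allowed by `W.Far` when h = r + 1.
      T = r ℕ.* suc r ℕ.* suc r
      T>0 : 0 ℕ.< T
      T>0 = s≤s z≤n

      level : ℕ → ℕ
      level t = W.Lift.level (W.lift r t r)

      level-T : level T ≡ n
      level-T = proj₁ (W.Far.level-far r r ℕP.≤-refl T T>0 ℕP.≤-refl n ℕP.≤-refl)

      level-0 : level 0 ≡ 0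
      level-0 = proj₁ (W.lift-start r r)

      scaled-≥0 : ∀ {κ x} → 0ℚ < κ → 0ℚ ≤ x → 0ℚ ≤ κ * x
      scaled-≥0 κ>0 = 0≤* (<⇒≤ κ>0)

      scaled-≤0 : ∀ {κ x} → 0ℚ < κ → x ≤ 0ℚ → κ * x ≤ 0ℚ
      scaled-≤0 {κ} κ>0 le = ≤-trans (*-monoˡ-≤-nonNeg κ {{nonNegative (<⇒≤ κ>0)}} le) (≤-reflexive (*-zeroʳ κ))

    -- Between t = 0 and t = T the level rises from 0 to n = 2i. The real part yields one bracket
    -- for every two levels, which is the degree i of E.
    E-brackets : ∀ {κ} i → 0ℚ < κ → n ≡ double i → ∀ g → (∀ x → g x ≡ κ * E r x) → Brackets g 1ℚ i
    E-brackets i κ>0 e g g≡ = Walk.build r g (λ t → re (W.V r t r)) 0 T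
      (λ t m lt → cong re (trans (W.V-lift r t r) (cong (λ u → rot u (W.Lift.point (W.lift r t r))) lt)))
      (λ t _ le → subst (0ℚ ≤_) (sym (g≡ _)) (scaled-≥0 κ>0 (E-≥0 r t r le)))
      (λ t _ le → subst (_≤ 0ℚ) (sym (g≡ _)) (scaled-≤0 κ>0 (E-≤0 r t r le)))
      i 0 0 z≤n level-0 (ℕP.≤-reflexive (trans (cong double (ℕP.+-identityʳ i)) (trans (sym e) (sym level-T)))) (z<1 r 0)

    -- The imaginary part of i · iᵐ v is the real part of iᵐ v, so the count starts at level 1. From
    -- there to n = 2i + 1 are 2i levels, again as many brackets as the degree of O.
    O-brackets : ∀ {κ} i → 0ℚ < κ → n ≡ suc (double i) → ∀ g → (∀ x → g x ≡ κ * O r x) → Brackets g 1ℚ i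
    O-brackets i κ>0 e g g≡ = Walk.build r g (λ t → im (W.V r t r)) 1 T
      (λ t m lt → cong im (trans (W.V-lift r t r) (cong (λ u → rot u (W.Lift.point (W.lift r t r))) lt)))
      (λ t lt le → subst (0ℚ ≤_) (sym (g≡ _)) (scaled-≥0 κ>0 (O-≥0 r t r (t>0 t lt) le)))
      (λ t lt le → subst (_≤ 0ℚ) (sym (g≡ _)) (scaled-≤0 κ>0 (O-≤0 r t r (t>0 t lt) le)))
      i 0 (proj₁ first) (proj₁ (proj₂ (proj₂ first))) (trans (proj₂ (proj₂ (proj₂ first))) (cong suc level-0))
      (ℕP.≤-reflexive (trans (cong (suc ∘ double) (ℕP.+-identityʳ i)) (trans (sym e) (sym level-T)))) (z<1 r (proj₁ first))
      where
      first = Walk.climbTo r g (λ t → im (W.V r t r)) 1 T 0 z≤n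
        (subst (ℕ._< level T) (sym level-0) (subst (0 ℕ.<_) (sym (trans level-T e)) (s≤s z≤n)))
      -- The imaginary part is y O, so its sign gives the sign of O only where y > 0; level 1 is not
      -- yet reached at t = 0.
      t>0 : ∀ t → 1 ℕ.≤ level t → 0 ℕ.< t
      t>0 zero    lt = ⊥-elim (ℕP.<-irrefl refl (ℕP.≤-trans lt (ℕP.≤-reflexive level-0)))
      t>0 (suc t) lt = s≤s z≤n

  realRooted : ∀ (p : List ℕ) d (a : ℕ → ℚ) → a d ≢ 0ℚ → (∀ k → coeffAt (List.map (λ a → (+ a) / 1) p) k ≡ a k) →
    (∀ k → d ℕ.< k → a k ≡ 0ℚ) → Brackets (eval (poly (a d) (low d a))) 1ℚ d → RealRooted p
  realRooted p d a ad≢0 coeff vanish brs = d , a d , ad≢0 , roots brs , λ k j →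
    let N , close = brackets⇒converge (a d) (low d a) brs k j
    in N , λ m N≤m → subst (λ c → ∣ coeffAt (prodLin (a d) (toList (stage (roots brs) m))) k - c ∣ ≤ inv j)
         (trans (coeffAt-low d a vanish k) (sym (coeff k))) (close m N≤m)

  module _ (n : ℕ) (π : Map (suc n)) (nc : IsNCycle π) where

    private
      r = suc n
      -- 2/(r(r + 1)): an r-cycle in the symmetric group on r points has no further fixed points, so
      -- `risingProduct` is 1.
      κ = ι (+ 2) * (inv n * inv r)

      κ>0 : 0ℚ < κ
      κ>0 = 0<* (ι-pos 2 (s≤s z≤n)) (0<* (0<inv n) (0<inv r))

      Fcoeff≡ : ∀ j → r ℕ.* suc r ℕ.* Fcoeff π j ≡ 2 ℕ.* paired r j
      Fcoeff≡ j = from (NCycle-Marked Fin.zero π nc)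
        where
        from : (∃ λ M → Marked π Fin.zero M []) → r ℕ.* suc r ℕ.* Fcoeff π j ≡ 2 ℕ.* paired r j
        from (M , mk) = subst (λ l → r ℕ.* suc r ℕ.* Fcoeff π j ≡ 2 ℕ.* paired (suc l) j) len (Fcoeff-paired π mk [] j)
          where
          len : List.length M ≡ n
          len = trans (cong List.length (sym (LP.++-identityʳ M))) (ℕP.suc-injective (notation-length (proj₂ (proj₂ mk))))

      Fcoeffℚ : ∀ j → ι (+ Fcoeff π j) ≡ κ * ι (+ paired r j)
      Fcoeffℚ j = begin
        ι (+ F)
          ≡⟨ sym (trans (cong₂ (λ u v → u * v * ι (+ F)) (inv-inverse n) (inv-inverse r)) (solve 1 (λ f → con 1ℚ :* con 1ℚ :* f := f) refl (ι (+ F)))) ⟩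
        inv n * ι (+ r) * (inv r * ι (+ suc r)) * ι (+ F)
          ≡⟨ solve 5 (λ a b c d f → a :* b :* (c :* d) :* f := a :* c :* (b :* d :* f)) refl (inv n) (ι (+ r)) (inv r) (ι (+ suc r)) (ι (+ F)) ⟩
        inv n * inv r * (ι (+ r) * ι (+ suc r) * ι (+ F))
          ≡⟨ cong (inv n * inv r *_) (trans (cong (_* ι (+ F)) (sym (ι-ℕ* r (suc r)))) (trans (sym (ι-ℕ* (r ℕ.* suc r) F))
               (trans (cong (λ u → ι (+ u)) (Fcoeff≡ j)) (ι-ℕ* 2 (paired r j))))) ⟩
        inv n * inv r * (ι (+ 2) * ι (+ paired r j))
          ≡⟨ solve 3 (λ a b c → a :* (b :* c) := b :* a :* c) refl (inv n * inv r) (ι (+ 2)) (ι (+ paired r j)) ⟩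
        κ * ι (+ paired r j) ∎
        where
        open ≡-Reasoning
        F = Fcoeff π j
        ι-ℕ* : ∀ a b → ι (+ (a ℕ.* b)) ≡ ι (+ a) * ι (+ b)
        ι-ℕ* a b = trans (cong ι (ℤP.pos-* a b)) (ι-* (+ a) (+ b))

      coeffs : ∀ (a : ℕ → ℚ) → (∀ k → r ℕ.≤ k → a k ≡ 0ℚ) → (∀ k → κ * ι (+ paired r k) ≡ a k) →
        ∀ k → coeffAt (List.map (λ a → (+ a) / 1) (Fpoly π)) k ≡ a k
      coeffs a vanish e k = trans (cong (λ l → coeffAt l k)
          (trans (sym (LP.map-∘ (upTo r))) (LP.map-applyUpTo id (λ j → ι (+ Fcoeff π j)) r)))
        (trans (coeffAt-applyUpTo r (λ j → ι (+ Fcoeff π j)) (λ j r≤j → trans (same j) (vanish j r≤j)) k) (same k))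
        where
        same : ∀ j → ι (+ Fcoeff π j) ≡ a j
        same j = trans (Fcoeffℚ j) (e j)

      nonzero : ∀ k → k ℕ.≤ r → κ * stirℚ r k ≢ 0ℚ
      nonzero k k≤r e = <-irrefl (sym e) (0<* κ>0 (ι-pos (stir r k) (stir-positive r k k≤r)))

      zero-beyond : ∀ k → r ℕ.< k → κ * stirℚ r k ≡ 0ℚ
      zero-beyond k r<k = trans (cong (λ u → κ * ι (+ u)) (stir-vanish r k r<k)) (*-zeroʳ κ)

      -- The series for E and O are known for lengths above r only, whereas `poly` has length d + 1;
      -- the vanishing coefficients in between bridge the two.
      evalEq : ∀ d c (G : ℕ → ℚ → ℚ) → (∀ k → suc d ℕ.≤ k → c k ≡ 0ℚ) →
        (∀ x → series (suc d ℕ.+ r) c x ≡ G r x) → ∀ x →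
        eval (poly (κ * c d) (low d (λ k → κ * c k))) x ≡ κ * G r x
      evalEq d c G vanish full x = trans (eval-low d (λ k → κ * c k) x) (trans (series-scale (suc d) κ c x)
        (cong (κ *_) (trans (sym (series-truncate (suc d) r c x vanish)) (full x))))

    Fpoly-RealRooted : RealRooted (Fpoly π)
    Fpoly-RealRooted = byParity (half-cases n)
      where
      i = ⌊ n /2⌋
      byParity : n ≡ double i ⊎ n ≡ suc (double i) → RealRooted (Fpoly π)
      -- For n even r is odd, and F keeps the even exponents up to n = r - 1; the leading
      -- coefficient is that of x to the power r - 1, which is positive.
      byParity (inj₁ e) = realRooted (Fpoly π) i a (nonzero (double i) (ℕP.≤-trans (ℕP.≤-reflexive (sym e)) (ℕP.n≤1+n n)))
          (coeffs a (λ k r≤k → vanish k (ℕP.≤-trans (s≤s (ℕP.⌊n/2⌋≤n n)) r≤k))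
            (λ k → cong (λ u → κ * ι (+ u)) (paired-odd r i (cong suc e) k))) vanish
          (E-brackets n i κ>0 e _ (evalEq i (λ k → stirℚ r (double k)) E
            (λ k i<k → cong (λ u → ι (+ u)) (stir-vanish r (double k) (big i<k)))
            (λ x → series-E r (suc i ℕ.+ r) x (s≤s (ℕP.m≤n+m r i)))))
        where
        a = λ k → κ * stirℚ r (double k)
        big : ∀ {k} → i ℕ.< k → r ℕ.< double k
        big {k} i<k = subst (λ u → suc (suc u) ℕ.≤ double k) (sym e) (double-mono i<k)
        vanish : ∀ k → i ℕ.< k → a k ≡ 0ℚ
        vanish k i<k = zero-beyond (double k) (big i<k)
      byParity (inj₂ e) = realRooted (Fpoly π) i a (nonzero (suc (double i)) (ℕP.≤-trans (ℕP.≤-reflexive (sym e)) (ℕP.n≤1+n n)))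
          (coeffs a (λ k r≤k → vanish k (ℕP.≤-trans (s≤s (ℕP.⌊n/2⌋≤n n)) r≤k))
            (λ k → cong (λ u → κ * ι (+ u)) (paired-even r (suc i) (cong suc e) k))) vanish
          (O-brackets n i κ>0 e _ (evalEq i (λ k → stirℚ r (suc (double k))) O
            (λ k i<k → cong (λ u → ι (+ u)) (stir-vanish r (suc (double k)) (big i<k)))
            (λ x → series-O r (suc i ℕ.+ r) x (s≤s (ℕP.m≤n+m r i)))))
        where
        a = λ k → κ * stirℚ r (suc (double k))
        big : ∀ {k} → i ℕ.< k → r ℕ.< suc (double k)
        big {k} i<k = subst (λ u → suc (suc u) ℕ.≤ suc (double k)) (sym e) (s≤s (double-mono i<k))
        vanish : ∀ k → i ℕ.< k → a k ≡ 0ℚ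
        vanish k i<k = zero-beyond (suc (double k)) (big i<k)

open import Defs
open import Data.Nat using (ℕ; suc; _≤_)
open import Data.Product using (_×_; _,_)

theorem4p4 : (∀ (n : ℕ) (π : Map (suc n)) → IsNCycle π → RealRooted (Fpoly π))
    × (∀ (n : ℕ) (π : Map (suc n)) → IsPerm π → nontrivialCycles π ≤ 1
    → LogConcave (Fcoeff π))
theorem4p4 = RealRootedness.Fpoly-RealRooted , Coefficients.Fcoeff-LogConcave
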